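{- Let $k=2m-1\ge 1$ and $\mathfrak{g}_k=\mathfrak{p}^A\frac{k+2|k}{2k+2}$ (a Frobenius type-A seaweed). The spectrum of $\mathfrak{g}_k$ is $\{ -2,-1^2,0^3,1^3,2^2,3\}$ if $k=1$; $\{ -3,-2^4,-1^8,0^{11},1^{11},2^8,3^4,4\}$ if $k=3$; $\{ -4,-3^4,-2^{10},-1^{17},0^{22},1^{22},2^{17},3^{10},4^4,5\}$ if $k=5$; $\{ -5,-4^4,-3^{10},-2^{19},-1^{28},0^{34},1^{34},2^{28},3^{19},4^{10},5^4,6\}$ if $k=7$; and for $k>7$ it is $$\{ -m-1,-m^4,(-m+1)^{10},(-m+2)^{19},-1^{6k-14},0^{6k-8},1^{6k-8},2^{6k-14},(m-1)^{19},m^{10},(m+1)^4,m+2\}\cup\bigcup_{i=1}^{m-4}\{(-m+i+2)^{12i+18},(m-i-1)^{12i+18}\}.$$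
   Context: Type-A seaweeds: for compositions $\underline a=(a_1,\dots,a_m)$ and $\underline b=(b_1,\dots,b_t)$ of $n$, let $e_1,\dots,e_n$ be a basis of $V=\mathbb{C}^n$, $V_i=\mathrm{span}\{e_1,\dots,e_{a_1+\dots+a_i}\}$ and $W_j=\mathrm{span}\{e_{b_1+\dots+b_j+1},\dots,e_n\}$. The type-A seaweed $\mathfrak{p}^A\frac{a_1|\cdots|a_m}{b_1|\cdots|b_t}$ is the subalgebra of $\mathfrak{sl}(n)$ of matrices preserving both flags $0\subset V_1\subset\dots\subset V_m=V$ and $V=W_0\supset W_1\supset\dots\supset W_t=0$. A Lie algebra $\mathfrak{g}$ is Frobenius if there is $F\in\mathfrak{g}^*$ with $(x,y)\mapsto F([x,y])$ nondegenerate; then there is a unique $\widehat F\in\mathfrak{g}$ with $F([\widehat F,x])=F(x)$ for all $x$, and the spectrum of $\mathfrak{g}$ is the multiset of eigenvalues of $\mathrm{ad}\,\widehat F$ on $\mathfrak{g}$ (independent of the choice of Frobenius $F$). Notation: $\{x^k\}$ denotes $x$ with multiplicity $k$, and $\cup$ denotes multiset union (multiplicities add). -}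

module Defs where

open import Level using (Level; _⊔_) renaming (suc to lsuc)
open import Algebra.Bundles using (CommutativeRing)
open import Data.Bool using (Bool; true; false; not; _∧_; if_then_else_)
open import Data.Nat using (ℕ; zero; suc; _∸_; _<ᵇ_; _≡ᵇ_) renaming (_+_ to _+ℕ_; _*_ to _*ℕ_)
open import Data.Fin using (Fin; toℕ; punchIn) renaming (zero to fzero; suc to fsuc)
import Data.Fin as Fin
open import Data.Integer using (ℤ; +_; -[1+_])
import Data.Integer as ℤ
open import Data.List using (List; []; _∷_; _++_; length; lookup; replicate; concatMap; filterᵇ; map; foldr; upTo; allFin)
open import Data.Product using (Σ; _×_; _,_)
open import Relation.Nullary using (¬_; does)
open import Relation.Binary.PropositionalEquality using (_≡_)

record Field (c ℓ : Level) : Set (lsuc (c ⊔ ℓ)) where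
  field
    commutativeRing : CommutativeRing c ℓ
  open CommutativeRing commutativeRing public
  field
    1≉0     : ¬ (1# ≈ 0#)
    inverse : ∀ x → ¬ (x ≈ 0#) → Σ Carrier (λ y → x * y ≈ 1#)

module _ {c ℓ : Level} (K : Field c ℓ) where
  open Field K

  natK : ℕ → Carrier
  natK zero    = 0#
  natK (suc n) = 1# + natK n

  intK : ℤ → Carrier
  intK (+ n)      = natK n
  intK -[1+ n ]   = - natK (suc n)

  CharZero : Set ℓ
  CharZero = ∀ n → ¬ (natK (suc n) ≈ 0#)

  sumF : ∀ {n} → (Fin n → Carrier) → Carrier
  sumF {zero}  f = 0#
  sumF {suc n} f = f fzero + sumF (λ i → f (fsuc i))

  prodL : List Carrier → Carrier
  prodL = foldr _*_ 1#

  Mat : ℕ → Set c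
  Mat N = Fin N → Fin N → Carrier

  _≈M_ : ∀ {N} → Mat N → Mat N → Set ℓ
  X ≈M Y = ∀ i j → X i j ≈ Y i j

  0M : ∀ {N} → Mat N
  0M i j = 0#

  _+M_ _-M_ _·M_ : ∀ {N} → Mat N → Mat N → Mat N
  (X +M Y) i j = X i j + Y i j
  (X -M Y) i j = X i j - Y i j
  (X ·M Y) i j = sumF (λ l → X i l * Y l j)

  ⟦_,_⟧ : ∀ {N} → Mat N → Mat N → Mat N
  ⟦ X , Y ⟧ = (X ·M Y) -M (Y ·M X)

  trace : ∀ {N} → Mat N → Carrier
  trace X = sumF (λ i → X i i)

  unitM : ∀ {N} → ℕ → ℕ → Mat N
  unitM r c a b = if (toℕ a ≡ᵇ r) ∧ (toℕ b ≡ᵇ c) then 1# else 0#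

  det : ∀ {n} → Mat n → Carrier
  det {zero}  A = 1#
  det {suc n} A =
    sumF (λ j → sgn (toℕ j) * (A fzero j * det (λ r s → A (fsuc r) (punchIn j s))))
    where
      sgn : ℕ → Carrier
      sgn zero          = 1#
      sgn (suc zero)    = - 1#
      sgn (suc (suc k)) = sgn k

  charPolyAt : ∀ {n} → Mat n → Carrier → Carrier
  charPolyAt A t = det (λ i j → (if does (i Fin.≟ j) then t else 0#) - A i j)

-- The seaweed g_k = p^A (k+2 | k) / (2k+2), with k = 2m-1, n = 2k+2 = 4m.
-- 0-indexed coordinates: X preserves V_1 = span{e_0..e_{k+1}} iff
-- X i j = 0 whenever i ≥ k+2 = 2m+1 and j < 2m+1.  The lower flag
-- V = W_0 ⊃ W_1 = 0 imposes no condition.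

sizeN : ℕ → ℕ
sizeN m = 4 *ℕ m

kOf : ℕ → ℕ
kOf m = 2 *ℕ m ∸ 1

allowedᵇ : ∀ {N} → ℕ → Fin N → Fin N → Bool
allowedᵇ m i j = not ((2 *ℕ m <ᵇ toℕ i) ∧ (toℕ j <ᵇ 2 *ℕ m +ℕ 1))

-- labels of a basis of g_k: off-diagonal units E_ij (i ≠ j, allowed),
-- and Cartan elements H_i = E_ii - E_00 for i ≠ 0
data Label (N : ℕ) : Set where
  off  : Fin N → Fin N → Label N
  cart : Fin N → Label N

labels : (m : ℕ) → List (Label (sizeN m))
labels m =
  concatMap (λ i → map (off i)
     (filterᵇ (λ j → not (toℕ i ≡ᵇ toℕ j) ∧ allowedᵇ m i j) (allFin (sizeN m))))
     (allFin (sizeN m))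
  ++ map cart (filterᵇ (λ i → not (toℕ i ≡ᵇ 0)) (allFin (sizeN m)))

dimG : ℕ → ℕ
dimG m = length (labels m)

labelAt : (m : ℕ) → Fin (dimG m) → Label (sizeN m)
labelAt m = lookup (labels m)

module _ {c ℓ : Level} (K : Field c ℓ) where
  open Field K

  InG : (m : ℕ) → Mat K (sizeN m) → Set ℓ
  InG m X = (trace K X ≈ 0#) × (∀ i j → allowedᵇ m i j ≡ false → X i j ≈ 0#)

  basisMat : ∀ {N} → Label N → Mat K N
  basisMat (off i j) = unitM K (toℕ i) (toℕ j)
  basisMat (cart i)  = _-M_ K (unitM K (toℕ i) (toℕ i)) (unitM K 0 0)

  coord : ∀ {N} → Label N → Mat K N → Carrier
  coord (off i j) X = X i j
  coord (cart i)  X = X i i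

  Functional : ℕ → Set c
  Functional m = Fin (dimG m) → Carrier

  evalF : (m : ℕ) → Functional m → Mat K (sizeN m) → Carrier
  evalF m f X = sumF K (λ a → f a * coord (labelAt m a) X)

  IsFrobenius : (m : ℕ) → Functional m → Set (c ⊔ ℓ)
  IsFrobenius m f =
    ∀ X → InG m X → (∀ Y → InG m Y → evalF m f (⟦_,_⟧ K X Y) ≈ 0#) → _≈M_ K X (0M K)

  IsPrincipal : (m : ℕ) → Functional m → Mat K (sizeN m) → Set (c ⊔ ℓ)
  IsPrincipal m f Fh = InG m Fh × (∀ X → InG m X → evalF m f (⟦_,_⟧ K Fh X) ≈ evalF m f X)

  adMat : (m : ℕ) → Mat K (sizeN m) → Mat K (dimG m)
  adMat m Fh a b = coord (labelAt m a) (⟦_,_⟧ K Fh (basisMat (labelAt m b)))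

infix 6 _^^_
_^^_ : ℤ → ℕ → List ℤ
z ^^ n = replicate n z

p : ℕ → ℤ
p n = + n
n : ℕ → ℤ
n zero    = + 0
n (suc k) = -[1+ k ]

spectrum : ℕ → List ℤ
spectrum 1 = n 2 ^^ 1 ++ n 1 ^^ 2 ++ p 0 ^^ 3 ++ p 1 ^^ 3 ++ p 2 ^^ 2 ++ p 3 ^^ 1
spectrum 2 = n 3 ^^ 1 ++ n 2 ^^ 4 ++ n 1 ^^ 8 ++ p 0 ^^ 11 ++ p 1 ^^ 11 ++ p 2 ^^ 8
             ++ p 3 ^^ 4 ++ p 4 ^^ 1
spectrum 3 = n 4 ^^ 1 ++ n 3 ^^ 4 ++ n 2 ^^ 10 ++ n 1 ^^ 17 ++ p 0 ^^ 22 ++ p 1 ^^ 22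
             ++ p 2 ^^ 17 ++ p 3 ^^ 10 ++ p 4 ^^ 4 ++ p 5 ^^ 1
spectrum 4 = n 5 ^^ 1 ++ n 4 ^^ 4 ++ n 3 ^^ 10 ++ n 2 ^^ 19 ++ n 1 ^^ 28 ++ p 0 ^^ 34
             ++ p 1 ^^ 34 ++ p 2 ^^ 28 ++ p 3 ^^ 19 ++ p 4 ^^ 10 ++ p 5 ^^ 4 ++ p 6 ^^ 1
spectrum m =
  (ℤ.- M ℤ.- p 1) ^^ 1 ++ (ℤ.- M) ^^ 4 ++ (ℤ.- M ℤ.+ p 1) ^^ 10 ++ (ℤ.- M ℤ.+ p 2) ^^ 19
  ++ n 1 ^^ (6 *ℕ k ∸ 14) ++ p 0 ^^ (6 *ℕ k ∸ 8) ++ p 1 ^^ (6 *ℕ k ∸ 8) ++ p 2 ^^ (6 *ℕ k ∸ 14)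
  ++ (M ℤ.- p 1) ^^ 19 ++ M ^^ 10 ++ (M ℤ.+ p 1) ^^ 4 ++ (M ℤ.+ p 2) ^^ 1
  ++ concatMap (λ i → (ℤ.- M ℤ.+ p i ℤ.+ p 2) ^^ (12 *ℕ i +ℕ 18) ++ (M ℤ.- p i ℤ.- p 1) ^^ (12 *ℕ i +ℕ 18))
               (map suc (upTo (m ∸ 4)))
  where
    M : ℤ
    M = + m
    k : ℕ
    k = kOf m

{-# OPTIONS --safe #-}
-- The spectrum does not depend on the Frobenius functional: on the segment
-- f_s = f₀ + s (f₁ - f₀), over the power series in s, the principal element F of f_s
-- satisfies D F = [F, Z] for every derivation D in s, where f_s([Z, -]) = D f_s. Hence
-- det (t - ad F) has derivative zero and is its value at s = 0. Multiplying by a power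
-- of the determinant of the Frobenius form turns this into an identity of polynomials
-- in s, which can be evaluated at s = 1. Nothing is divided by except determinants that
-- are nonzero at an end point, so equality in the field need not be decidable.
--
-- At s = 0 we take the functional X ↦ Σ X(v_{j+2}, w_j) + Σ X(v_j, v_{j+2}) + X(v₁, v₀),
-- where the v_j are a basis of V₁ and the w_j complete it to a basis of V. Its principal
-- element is diagonal, so the spectrum consists of differences of explicit weights. When
-- m grows by 1, these differences are enlarged by 24 intervals of integers and twelve
-- single ones, which match the growth of the stated multiplicities.
module Submission where

open import Defs using
  ( Field; CharZero; Functional; IsFrobenius; Mat; IsPrincipal; InG; charPolyAt; adMat; prodL; natK; intK
  ; spectrum; sumF; evalF; coord; basisMat; Label; off; cart; labels; labelAt; dimG; sizeN; allowedᵇ; _^^_; kOf )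
import Defs
open import Level using (Level; _⊔_; Lift; lift; Setω)
open import Algebra.Bundles using (CommutativeRing; CommutativeMonoid)
open import Data.Bool using (Bool; true; false; if_then_else_; _∧_; not; T; T?)
open import Data.Empty using (⊥-elim)
open import Data.Fin as Fin using (Fin; zero; suc; toℕ; punchIn)
import Data.Fin.Properties as Finₚ
open import Data.Integer as ℤ using (ℤ; +_; -[1+_])
import Data.Integer.Properties as ℤP
open import Data.Integer.Solver using () renaming (module +-*-Solver to ℤ-Solver)
open import Data.List as List using (List; []; _∷_; _++_; map; concatMap; filterᵇ; allFin; lookup; tabulate)
open import Data.List.Membership.Propositional using (_∈_)
open import Data.List.Membership.Propositional.Properties using (∈-lookup; ∈-map⁻)
import Data.List.Properties as ListP
open import Data.List.Relation.Binary.Permutation.Propositional as Perm using (_↭_; ↭-sym; ↭-trans; ↭-reflexive)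
import Data.List.Relation.Binary.Permutation.Propositional.Properties as PermP
open import Data.List.Relation.Unary.All as All using (All; []; _∷_)
import Data.List.Relation.Unary.All.Properties as AllP
open import Data.List.Relation.Unary.AllPairs as AllPairs using ([]; _∷_)
import Data.List.Relation.Unary.AllPairs.Properties as AllPairsP
open import Data.List.Relation.Unary.Unique.Propositional using (Unique)
import Data.List.Relation.Unary.Unique.Propositional.Properties as UniqueP
open import Data.List.Sort.Base ℤP.≤-totalOrder using (SortingAlgorithm)
open import Data.List.Sort.MergeSort ℤP.≤-decTotalOrder using (mergeSort)
open import Data.Maybe using (Maybe; just; nothing)
open import Data.Nat as ℕ using (ℕ; zero; suc; _≤_)
import Data.Nat.Properties as ℕP
open import Data.Nat.Solver using (module +-*-Solver)
open import Data.Product using (Σ; _×_; _,_; proj₁; proj₂)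
open import Data.Sum using (_⊎_; inj₁; inj₂)
open import Data.Unit using (⊤; tt)
open import Data.Vec.Functional using () renaming (_∷_ to infixr 5 _◂_)
open import Function using (_∘_; id)
open import Relation.Binary.PropositionalEquality as ≡ using (_≡_; _≢_)
open import Relation.Nullary using (Dec; ¬_; yes; no; does)

-- Classically, independence of the functional follows from conjugacy: over an algebraically closed
-- field the Frobenius functionals form one orbit of the adjoint group. Over an arbitrary field of
-- characteristic zero conjugacy is used only infinitesimally: D F = [F, Z] is a Lax equation, whose
-- invariant is the characteristic polynomial, and no group element is constructed. The entries read
-- by the standard functional are the edges of a tree on the basis vectors: the v_j of even index
-- form a path, those of odd index another, one edge joins v₁ to v₀, and each w_j is a leaf attached
-- to v_{j+2}. Along each edge the weights must differ by 1, so they are determined up to a common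
-- constant, which the trace fixes. That this functional is Frobenius is checked on the kernel of
-- its form: pairing with unit matrices shows that a kernel element acts on V / V₁ as on the v_j
-- with j ≥ 2, and that its block on V₁ repeats along the diagonals in steps of two, up to a scalar
-- s. Comparing the two paths gives 4m s = 0; then the matrix is scalar, and zero by its trace.

-- Integers in a commutative ring, and the ring solver.

module IntegerCoefficients {c ℓ : Level} (R : CommutativeRing c ℓ) where
  open CommutativeRing R hiding (zero)
  open import Algebra.Properties.Ring ring
  open import Algebra.Properties.Semiring.Mult semiring as Mult using (×-homo-+; ×1-homo-*)
  open import Algebra.Solver.Ring.AlmostCommutativeRing
    using (AlmostCommutativeRing; _-Raw-AlmostCommutative⟶_; fromCommutativeRing; Induced-equivalence)
  open import Relation.Binary.Reasoning.Setoid setoid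
  open import Algebra.Properties.CommutativeSemigroup +-commutativeSemigroup using (interchange)

  nat : ℕ → Carrier
  nat n = n Mult.× 1#

  int : ℤ → Carrier
  int (+ n)    = nat n
  int -[1+ n ] = - nat (suc n)

  int-⊖ : ∀ m n → int (m ℤ.⊖ n) ≈ nat m - nat n
  int-⊖ m       zero    = sym (trans (+-congˡ -0#≈0#) (+-identityʳ _))
  int-⊖ zero    (suc n) = sym (+-identityˡ _)
  int-⊖ (suc m) (suc n) = begin
    int (suc m ℤ.⊖ suc n)            ≡⟨ ≡.cong int (ℤP.[1+m]⊖[1+n]≡m⊖n m n) ⟩
    int (m ℤ.⊖ n)                    ≈⟨ int-⊖ m n ⟩
    nat m - nat n                    ≈⟨ +-identityˡ _ ⟨
    0# + (nat m - nat n)             ≈⟨ +-congʳ (-‿inverseʳ 1#) ⟨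
    (1# - 1#) + (nat m - nat n)      ≈⟨ interchange _ _ _ _ ⟩
    (1# + nat m) + (- 1# - nat n)    ≈⟨ +-congˡ (-‿+-comm 1# (nat n)) ⟩
    nat (suc m) - nat (suc n)        ∎

  int-neg : ∀ i → int (ℤ.- i) ≈ - int i
  int-neg (+ zero)  = sym -0#≈0#
  int-neg (+ suc n) = refl
  int-neg -[1+ n ]  = sym (-‿involutive _)

  int-+ : ∀ i j → int (i ℤ.+ j) ≈ int i + int j
  int-+ (+ m)    (+ n)    = ×-homo-+ 1# m n
  int-+ (+ m)    -[1+ n ] = int-⊖ m (suc n)
  int-+ -[1+ m ] (+ n)    = trans (int-⊖ n (suc m)) (+-comm _ _)
  int-+ -[1+ m ] -[1+ n ] = begin
    - nat (suc (suc (m ℕ.+ n)))      ≡⟨ ≡.cong (λ k → - nat (suc k)) (ℕP.+-suc m n) ⟨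
    - nat (suc m ℕ.+ suc n)          ≈⟨ -‿cong (×-homo-+ 1# (suc m) (suc n)) ⟩
    - (nat (suc m) + nat (suc n))    ≈⟨ -‿+-comm _ _ ⟨
    - nat (suc m) - nat (suc n)      ∎

  int-- : ∀ i j → int (i ℤ.- j) ≈ int i - int j
  int-- i j = trans (int-+ i (ℤ.- j)) (+-congˡ (int-neg j))

  int-*⁺ : ∀ m j → int (+ m ℤ.* j) ≈ nat m * int j
  int-*⁺ m (+ n)    = begin
    int (+ m ℤ.* + n)  ≡⟨ ≡.cong int (ℤP.pos-* m n) ⟨
    nat (m ℕ.* n)      ≈⟨ ×1-homo-* m n ⟩
    nat m * nat n      ∎
  int-*⁺ m -[1+ n ] = begin
    int (+ m ℤ.* -[1+ n ])         ≡⟨ ≡.cong int (ℤP.neg-distribʳ-* (+ m) (+ suc n)) ⟨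
    int (ℤ.- (+ m ℤ.* + suc n))    ≈⟨ int-neg (+ m ℤ.* + suc n) ⟩
    - int (+ m ℤ.* + suc n)        ≈⟨ -‿cong (int-*⁺ m (+ suc n)) ⟩
    - (nat m * nat (suc n))        ≈⟨ -‿distribʳ-* _ _ ⟩
    nat m * - nat (suc n)          ∎

  int-* : ∀ i j → int (i ℤ.* j) ≈ int i * int j
  int-* (+ m)    j = int-*⁺ m j
  int-* -[1+ m ] j = begin
    int (-[1+ m ] ℤ.* j)           ≡⟨ ≡.cong int (ℤP.neg-distribˡ-* (+ suc m) j) ⟨
    int (ℤ.- (+ suc m ℤ.* j))      ≈⟨ int-neg (+ suc m ℤ.* j) ⟩
    - int (+ suc m ℤ.* j)          ≈⟨ -‿cong (int-*⁺ (suc m) j) ⟩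
    - (nat (suc m) * int j)        ≈⟨ -‿distribˡ-* _ _ ⟩
    - nat (suc m) * int j          ∎

  private
    almost : AlmostCommutativeRing c ℓ
    almost = fromCommutativeRing R

    morphism : ℤ.+-*-rawRing -Raw-AlmostCommutative⟶ almost
    morphism = record
      { ⟦_⟧ = int ; +-homo = int-+ ; *-homo = int-* ; -‿homo = int-neg
      ; 0-homo = refl ; 1-homo = +-identityʳ 1# }

    -- Coefficients are compared in ℤ, because equality in `R` need not be decidable.
    equal? : ∀ i j → Maybe (Induced-equivalence morphism i j)
    equal? i j with i ℤ.≟ j
    ... | yes i≡j = just (reflexive (≡.cong int i≡j))
    ... | no  _   = nothing

  open import Algebra.Solver.Ring ℤ.+-*-rawRing almost morphism equal? public
    using (solve; con; _:=_; _:+_; _:*_; _:-_; :-_)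

-- Finite sums.

module Sums {c ℓ : Level} (R : CommutativeRing c ℓ) where
  open CommutativeRing R hiding (zero)
  open import Algebra.Properties.Ring ring using (-0#≈0#; -‿+-comm)
  import Algebra.Properties.Semiring.Sum semiring as Sum
  import Algebra.Properties.Semiring.Mult semiring as Mult

  infixl 10 ∑
  opaque
    ∑ : ∀ {n} → (Fin n → Carrier) → Carrier
    ∑ = Sum.sum

  syntax ∑ (λ i → x) = ∑[ i ] x

  opaque
    unfolding ∑

    ∑≡sum : ∀ {n} (f : Fin n → Carrier) → ∑ f ≡ Sum.sum f
    ∑≡sum f = ≡.refl

    ∑-nil : ∀ (f : Fin 0 → Carrier) → ∑ f ≈ 0#
    ∑-nil f = refl

    ∑-suc : ∀ {n} (f : Fin (suc n) → Carrier) → ∑ f ≈ f zero + ∑ (f ∘ suc)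
    ∑-suc f = refl

    ∑-cong : ∀ {n} {f g : Fin n → Carrier} → (∀ i → f i ≈ g i) → ∑ f ≈ ∑ g
    ∑-cong = Sum.sum-cong-≋

    ∑-+ : ∀ {n} (f g : Fin n → Carrier) → ∑[ i ] (f i + g i) ≈ ∑ f + ∑ g
    ∑-+ = Sum.∑-distrib-+

    ∑-swap : ∀ {m n} (f : Fin m → Fin n → Carrier) → ∑[ i ] ∑[ j ] f i j ≈ ∑[ j ] ∑[ i ] f i j
    ∑-swap = Sum.∑-comm

    *-∑ : ∀ {n} x (f : Fin n → Carrier) → x * ∑ f ≈ ∑[ i ] (x * f i)
    *-∑ = Sum.*-distribˡ-sum

    ∑-* : ∀ {n} x (f : Fin n → Carrier) → ∑ f * x ≈ ∑[ i ] (f i * x)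
    ∑-* = Sum.*-distribʳ-sum

    ∑-remove : ∀ {n} i (f : Fin (suc n) → Carrier) → ∑ f ≈ f i + ∑ (f ∘ punchIn i)
    ∑-remove i f = Sum.sum-remove {i = i} f

    ∑-replicate : ∀ n x → ∑ {n} (λ _ → x) ≈ n Mult.× x
    ∑-replicate n x = Sum.sum-replicate n

  ∑-0 : ∀ {n} {f : Fin n → Carrier} → (∀ i → f i ≈ 0#) → ∑ f ≈ 0#
  ∑-0 {zero}  f≈0 = ∑-nil _
  ∑-0 {suc n} f≈0 = trans (∑-suc _) (trans (+-cong (f≈0 zero) (∑-0 (f≈0 ∘ suc))) (+-identityˡ _))

  ∑-neg : ∀ {n} (f : Fin n → Carrier) → ∑[ i ] (- f i) ≈ - ∑ f
  ∑-neg {zero}  f = trans (∑-nil _) (trans (sym -0#≈0#) (-‿cong (sym (∑-nil f))))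
  ∑-neg {suc n} f = trans (∑-suc _) (trans (+-congˡ (∑-neg (f ∘ suc)))
    (trans (-‿+-comm _ _) (-‿cong (sym (∑-suc f)))))

  ∑-- : ∀ {n} (f g : Fin n → Carrier) → ∑[ i ] (f i - g i) ≈ ∑ f - ∑ g
  ∑-- f g = trans (∑-+ f (λ i → - g i)) (+-congˡ (∑-neg g))

  δ : ∀ {n} → Fin n → Fin n → Carrier
  δ i j = if does (i Fin.≟ j) then 1# else 0#

  δ-refl : ∀ {n} (i : Fin n) → δ i i ≡ 1#
  δ-refl i with i Fin.≟ i
  ... | yes _  = ≡.refl
  ... | no i≢i = ⊥-elim (i≢i ≡.refl)

  δ-off : ∀ {n} {i j : Fin n} → i ≢ j → δ i j ≡ 0#
  δ-off {i = i} {j} i≢j with i Fin.≟ j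
  ... | yes i≡j = ⊥-elim (i≢j i≡j)
  ... | no _    = ≡.refl

  ∑-single : ∀ {n} (f : Fin n → Carrier) i → (∀ j → i ≢ j → f j ≈ 0#) → ∑ f ≈ f i
  ∑-single {suc n} f zero    others =
    trans (∑-suc f) (trans (+-congˡ (∑-0 λ j → others (suc j) λ ())) (+-identityʳ _))
  ∑-single {suc n} f (suc i) others =
    trans (∑-suc f) (trans
      (+-cong (others zero λ ()) (∑-single (f ∘ suc) i λ j i≢j → others (suc j) λ { ≡.refl → i≢j ≡.refl }))
      (+-identityˡ _))

  ∑-δ : ∀ {n} i (f : Fin n → Carrier) → ∑[ j ] (δ i j * f j) ≈ f i
  ∑-δ i f = trans
    (∑-single _ i λ j i≢j → trans (*-congʳ (reflexive (δ-off i≢j))) (zeroˡ _))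
    (trans (*-congʳ (reflexive (δ-refl i))) (*-identityˡ _))

-- Determinants and alternating forms over a commutative ring.

module Determinant {c ℓ : Level} (R : CommutativeRing c ℓ) where
  open CommutativeRing R hiding (zero)
  open IntegerCoefficients R using (solve; con; _:=_; _:+_; _:*_; _:-_; :-_)
  open Sums R
  open import Algebra.Properties.Ring ring
  open import Relation.Binary.Reasoning.Setoid setoid
  open import Algebra.Properties.Monoid.Sum *-monoid using () renaming (sum to product)
  open import Algebra.Properties.Semiring.Exp semiring using (_^_)

  Vect : ℕ → Set c
  Vect n = Fin n → Carrier

  Mat′ : ℕ → ℕ → Set c
  Mat′ m n = Fin m → Vect n

  infix 4 _≋_
  _≋_ : ∀ {m n} → Mat′ m n → Mat′ m n → Set ℓ
  A ≋ B = ∀ i j → A i j ≈ B i j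

  sgn : ℕ → Carrier
  sgn zero    = 1#
  sgn (suc n) = - sgn n

  minor : ∀ {m n} → Fin (suc n) → Mat′ m (suc n) → Mat′ m n
  minor j A r s = A r (punchIn j s)

  det : ∀ {n} → Mat′ n n → Carrier
  det {zero}  A = 1#
  det {suc n} A = ∑[ j ] (sgn (toℕ j) * (A zero j * det (minor j (A ∘ suc))))

  det-cong : ∀ {n} {A B : Mat′ n n} → A ≋ B → det A ≈ det B
  det-cong {zero}  A≋B = refl
  det-cong {suc n} A≋B = ∑-cong λ j → *-congˡ (*-cong (A≋B zero j) (det-cong λ r s → A≋B (suc r) (punchIn j s)))

  -- Alternating multilinear forms in n vectors; linearity in a later vector is
  -- linearity in the head of the form with the earlier vectors fixed.
  Form : ℕ → ℕ → Set c
  Form n N = Mat′ n N → Carrier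

  Congruent : ∀ {n N} → Form n N → Set (c ⊔ ℓ)
  Congruent Φ = ∀ {A B} → A ≋ B → Φ A ≈ Φ B

  HeadLinear : ∀ {n N} → Form (suc n) N → Set (c ⊔ ℓ)
  HeadLinear Φ = ∀ a u v A → Φ ((λ k → a * u k + v k) ◂ A) ≈ a * Φ (u ◂ A) + Φ (v ◂ A)

  -- Only equal neighbours at the head are required to give zero; `equal-rows` reaches distant
  -- arguments by transposing neighbours.
  HeadRepeat : ∀ n {N} → Form (suc n) N → Set (c ⊔ ℓ)
  HeadRepeat zero    Φ = Lift _ ⊤
  HeadRepeat (suc n) Φ = ∀ v A → Φ (v ◂ v ◂ A) ≈ 0#

  Alternating : ∀ n {N} → Form n N → Set (c ⊔ ℓ)
  Alternating zero    Φ = Congruent Φ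
  Alternating (suc n) Φ =
    Congruent Φ × HeadLinear Φ × HeadRepeat n Φ × (∀ v → Alternating n (λ A → Φ (v ◂ A)))

  ◂-cong : ∀ {n N} {u v : Vect N} {A B : Mat′ n N} → (∀ k → u k ≈ v k) → A ≋ B → (u ◂ A) ≋ (v ◂ B)
  ◂-cong u≈v A≋B zero    = u≈v
  ◂-cong u≈v A≋B (suc i) = A≋B i

  ◂-eta : ∀ {n N} (A : Mat′ (suc n) N) → A ≋ (A zero ◂ (A ∘ suc))
  ◂-eta A zero    k = refl
  ◂-eta A (suc i) k = refl

  congruent : ∀ {n N} {Φ : Form n N} → Alternating n Φ → Congruent Φ
  congruent {zero}  alt = alt
  congruent {suc n} alt = proj₁ alt

  repeat : ∀ {n N} {Φ : Form (suc (suc n)) N} → Alternating (suc (suc n)) Φ → HeadRepeat (suc n) Φ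
  repeat alt = proj₁ (proj₂ (proj₂ alt))

  rest : ∀ {n N} {Φ : Form (suc n) N} → Alternating (suc n) Φ → ∀ v → Alternating n (λ A → Φ (v ◂ A))
  rest alt = proj₂ (proj₂ (proj₂ alt))

  module _ {n N} {Φ : Form (suc n) N} (alt : Alternating (suc n) Φ) where
    headLinear : HeadLinear Φ
    headLinear = proj₁ (proj₂ alt)

    head-+ : ∀ u v A → Φ ((λ k → u k + v k) ◂ A) ≈ Φ (u ◂ A) + Φ (v ◂ A)
    head-+ u v A = begin
      Φ ((λ k → u k + v k) ◂ A)       ≈⟨ congruent alt (◂-cong (λ k → +-congʳ (*-identityˡ (u k))) λ i k → refl) ⟨
      Φ ((λ k → 1# * u k + v k) ◂ A)  ≈⟨ headLinear 1# u v A ⟩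
      1# * Φ (u ◂ A) + Φ (v ◂ A)      ≈⟨ +-congʳ (*-identityˡ _) ⟩
      Φ (u ◂ A) + Φ (v ◂ A)           ∎

    head-0 : ∀ A → Φ ((λ k → 0#) ◂ A) ≈ 0#
    head-0 A = +-identityˡ-unique _ _ (begin
      Φ ((λ k → 0#) ◂ A) + Φ ((λ k → 0#) ◂ A)  ≈⟨ head-+ _ _ A ⟨
      Φ ((λ k → 0# + 0#) ◂ A)                  ≈⟨ congruent alt (◂-cong (λ k → +-identityˡ 0#) λ i k → refl) ⟩
      Φ ((λ k → 0#) ◂ A)                       ∎)

    head-∑ : ∀ {m} (a : Fin m → Carrier) (e : Mat′ m N) A →
             Φ ((λ k → ∑[ j ] (a j * e j k)) ◂ A) ≈ ∑[ j ] (a j * Φ (e j ◂ A))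
    head-∑ {zero}  a e A = begin
      Φ ((λ k → ∑[ j ] (a j * e j k)) ◂ A)  ≈⟨ congruent alt (◂-cong (λ k → ∑-nil _) λ i k → refl) ⟩
      Φ ((λ k → 0#) ◂ A)                    ≈⟨ head-0 A ⟩
      0#                                    ≈⟨ ∑-nil _ ⟨
      ∑[ j ] (a j * Φ (e j ◂ A))            ∎
    head-∑ {suc m} a e A = begin
      Φ ((λ k → ∑[ j ] (a j * e j k)) ◂ A)
        ≈⟨ congruent alt (◂-cong (λ k → ∑-suc _) λ i k → refl) ⟩
      Φ ((λ k → a zero * e zero k + ∑[ j ] (a (suc j) * e (suc j) k)) ◂ A)
        ≈⟨ headLinear (a zero) (e zero) _ A ⟩
      a zero * Φ (e zero ◂ A) + Φ ((λ k → ∑[ j ] (a (suc j) * e (suc j) k)) ◂ A)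
        ≈⟨ +-congˡ (head-∑ (a ∘ suc) (e ∘ suc) A) ⟩
      a zero * Φ (e zero ◂ A) + ∑[ j ] (a (suc j) * Φ (e (suc j) ◂ A))
        ≈⟨ ∑-suc _ ⟨
      ∑[ j ] (a j * Φ (e j ◂ A)) ∎

  -- Polarisation: the form vanishes at the pair (u + v, u + v), and so do two of the four terms of
  -- its expansion.
  swap : ∀ {n N} {Φ : Form (suc (suc n)) N} → Alternating (suc (suc n)) Φ →
         ∀ u v A → Φ (u ◂ v ◂ A) ≈ - Φ (v ◂ u ◂ A)
  swap {Φ = Φ} alt u v A = +-inverseˡ-unique _ _ (begin
    Φ (u ◂ v ◂ A) + Φ (v ◂ u ◂ A)
      ≈⟨ +-cong (trans (+-congʳ (repeat alt u A)) (+-identityˡ _)) (trans (+-congˡ (repeat alt v A)) (+-identityʳ _)) ⟨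
    (Φ (u ◂ u ◂ A) + Φ (u ◂ v ◂ A)) + (Φ (v ◂ u ◂ A) + Φ (v ◂ v ◂ A))
      ≈⟨ +-cong (head-+ (rest alt u) u v A) (head-+ (rest alt v) u v A) ⟨
    Φ (u ◂ w ◂ A) + Φ (v ◂ w ◂ A)
      ≈⟨ head-+ alt u v (w ◂ A) ⟨
    Φ (w ◂ w ◂ A)
      ≈⟨ repeat alt w A ⟩
    0# ∎)
    where
    w : Vect _
    w k = u k + v k

  equal-rows : ∀ {n N} {Φ : Form (suc n) N} → Alternating (suc n) Φ →
               ∀ v A i → (∀ k → A i k ≈ v k) → Φ (v ◂ A) ≈ 0#
  equal-rows {suc n} {Φ = Φ} alt v A zero    A₀≈v = begin
    Φ (v ◂ A)            ≈⟨ congruent alt (◂-cong (λ k → refl) λ { zero → A₀≈v ; (suc i) k → refl }) ⟩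
    Φ (v ◂ v ◂ A ∘ suc)  ≈⟨ repeat alt v (A ∘ suc) ⟩
    0#                   ∎
  equal-rows {suc n} {Φ = Φ} alt v A (suc i) Aᵢ≈v = begin
    Φ (v ◂ A)                   ≈⟨ congruent alt (◂-cong (λ k → refl) (◂-eta A)) ⟩
    Φ (v ◂ A zero ◂ A ∘ suc)    ≈⟨ swap alt v (A zero) (A ∘ suc) ⟩
    - Φ (A zero ◂ v ◂ A ∘ suc)  ≈⟨ -‿cong (equal-rows (rest alt (A zero)) v (A ∘ suc) i Aᵢ≈v) ⟩
    - 0#                        ≈⟨ -0#≈0# ⟩
    0#                          ∎

  -- An argument is cleared of its multiple of `v` while it stands next to `v`; transposing `v` past
  -- it exposes the next argument.
  sweep : ∀ {n N} {Φ : Form (suc n) N} → Alternating (suc n) Φ →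
          ∀ v (a : Fin n → Carrier) A → Φ (v ◂ (λ i k → a i * v k + A i k)) ≈ Φ (v ◂ A)
  sweep {zero}          alt v a A = congruent alt (◂-cong (λ k → refl) λ ())
  sweep {suc n} {Φ = Φ} alt v a A = begin
    Φ (v ◂ A′)                                             ≈⟨ congruent alt (◂-cong (λ k → refl) (◂-eta A′)) ⟩
    Φ (v ◂ A′ zero ◂ A′ ∘ suc)                             ≈⟨ headLinear (rest alt v) (a zero) v (A zero) (A′ ∘ suc) ⟩
    a zero * Φ (v ◂ v ◂ A′ ∘ suc) + Φ (v ◂ A zero ◂ A′ ∘ suc)  ≈⟨ +-congʳ (trans (*-congˡ (repeat alt v (A′ ∘ suc))) (zeroʳ _)) ⟩
    0# + Φ (v ◂ A zero ◂ A′ ∘ suc)                         ≈⟨ +-identityˡ _ ⟩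
    Φ (v ◂ A zero ◂ A′ ∘ suc)                              ≈⟨ swap alt v (A zero) (A′ ∘ suc) ⟩
    - Φ (A zero ◂ v ◂ A′ ∘ suc)                            ≈⟨ -‿cong (sweep (rest alt (A zero)) v (a ∘ suc) (A ∘ suc)) ⟩
    - Φ (A zero ◂ v ◂ A ∘ suc)                             ≈⟨ swap alt v (A zero) (A ∘ suc) ⟨
    Φ (v ◂ A zero ◂ A ∘ suc)                               ≈⟨ congruent alt (◂-cong (λ k → refl) (◂-eta A)) ⟨
    Φ (v ◂ A)                                              ∎
    where
    A′ : Mat′ _ _
    A′ i k = a i * v k + A i k

  to-front : ∀ {n N} {Φ : Form (suc n) N} → Alternating (suc n) Φ →
             ∀ e j → Φ (e j ◂ (e ∘ punchIn j)) ≈ sgn (toℕ j) * Φ e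
  to-front {Φ = Φ} alt e zero = trans (sym (congruent alt (◂-eta e))) (sym (*-identityˡ _))
  to-front {suc n} {Φ = Φ} alt e (suc j) = begin
    Φ (e (suc j) ◂ (e ∘ punchIn (suc j)))
      ≈⟨ congruent alt (◂-cong (λ k → refl) (◂-eta (e ∘ punchIn (suc j)))) ⟩
    Φ (e (suc j) ◂ e zero ◂ (e ∘ suc ∘ punchIn j))
      ≈⟨ swap alt _ _ _ ⟩
    - Φ (e zero ◂ e (suc j) ◂ (e ∘ suc ∘ punchIn j))
      ≈⟨ -‿cong (to-front (rest alt (e zero)) (e ∘ suc) j) ⟩
    - (sgn (toℕ j) * Φ (e zero ◂ (e ∘ suc)))
      ≈⟨ -‿distribˡ-* _ _ ⟩
    - sgn (toℕ j) * Φ (e zero ◂ (e ∘ suc))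
      ≈⟨ *-congˡ (congruent alt (◂-eta e)) ⟨
    - sgn (toℕ j) * Φ e ∎

  infixl 7 _⊡_
  _⊡_ : ∀ {l m n} → Mat′ l m → Mat′ m n → Mat′ l n
  _⊡_ {m = m} A B i k = ∑[ j ] (A i j * B j k)

  -- Expanding the first argument over the `e j` reproduces the Laplace expansion: `sweep` removes
  -- `e j` from the other arguments, the induction hypothesis yields the minor, and moving `e j`
  -- back to its place costs the sign.
  alternating-unique : ∀ {n N} {Φ : Form n N} → Alternating n Φ →
                       ∀ A (e : Mat′ n N) → Φ (A ⊡ e) ≈ det A * Φ e
  alternating-unique {zero}  {Φ = Φ} alt A e = trans (alt λ ()) (sym (*-identityˡ _))
  alternating-unique {suc n} {Φ = Φ} alt A e = begin
    Φ (A ⊡ e)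
      ≈⟨ congruent alt (◂-eta (A ⊡ e)) ⟩
    Φ ((A ⊡ e) zero ◂ (A ⊡ e) ∘ suc)
      ≈⟨ head-∑ alt (A zero) e _ ⟩
    ∑[ j ] (A zero j * Φ (e j ◂ (A ⊡ e) ∘ suc))
      ≈⟨ ∑-cong (λ j → trans (*-congˡ (term j))
           (solve 4 (λ a d s f → a :* (d :* (s :* f)) := (s :* (a :* d)) :* f) refl (A zero j) _ (sgn (toℕ j)) _)) ⟩
    ∑[ j ] (sgn (toℕ j) * (A zero j * det (minor j (A ∘ suc))) * Φ e)
      ≈⟨ ∑-* (Φ e) (λ j → sgn (toℕ j) * (A zero j * det (minor j (A ∘ suc)))) ⟨
    det A * Φ e ∎
    where
    term : ∀ j → Φ (e j ◂ (A ⊡ e) ∘ suc) ≈ det (minor j (A ∘ suc)) * (sgn (toℕ j) * Φ e)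
    term j = begin
      Φ (e j ◂ (A ⊡ e) ∘ suc)
        ≈⟨ congruent alt (◂-cong (λ k → refl) λ i k → ∑-remove j (λ l → A (suc i) l * e l k)) ⟩
      Φ (e j ◂ (λ i k → A (suc i) j * e j k + (minor j (A ∘ suc) ⊡ (e ∘ punchIn j)) i k))
        ≈⟨ sweep alt (e j) (λ i → A (suc i) j) _ ⟩
      Φ (e j ◂ (minor j (A ∘ suc) ⊡ (e ∘ punchIn j)))
        ≈⟨ alternating-unique (rest alt (e j)) (minor j (A ∘ suc)) (e ∘ punchIn j) ⟩
      det (minor j (A ∘ suc)) * Φ (e j ◂ (e ∘ punchIn j))
        ≈⟨ *-congˡ (to-front alt e j) ⟩
      det (minor j (A ∘ suc)) * (sgn (toℕ j) * Φ e) ∎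

  alternating-resp : ∀ {n N} {Φ Ψ : Form n N} → (∀ A → Φ A ≈ Ψ A) → Alternating n Φ → Alternating n Ψ
  alternating-resp {zero}  Φ≈Ψ alt A≋B = trans (sym (Φ≈Ψ _)) (trans (alt A≋B) (Φ≈Ψ _))
  alternating-resp {suc n} {N} {Φ} {Ψ} Φ≈Ψ alt =
    (λ A≋B → trans (sym (Φ≈Ψ _)) (trans (congruent alt A≋B) (Φ≈Ψ _))) ,
    (λ a u v A → trans (sym (Φ≈Ψ _)) (trans (headLinear alt a u v A) (+-cong (*-congˡ (Φ≈Ψ _)) (Φ≈Ψ _)))) ,
    rep n alt Φ≈Ψ ,
    (λ v → alternating-resp (λ A → Φ≈Ψ (v ◂ A)) (rest alt v))
    where
    rep : ∀ n {Φ Ψ : Form (suc n) N} → Alternating (suc n) Φ → (∀ A → Φ A ≈ Ψ A) → HeadRepeat n Ψ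
    rep zero    alt Φ≈Ψ     = lift tt
    rep (suc n) alt Φ≈Ψ v A = trans (sym (Φ≈Ψ _)) (repeat alt v A)

  alternating-∑ : ∀ {n N m} (a : Fin m → Carrier) {Φ : Fin m → Form n N} →
                  (∀ j → Alternating n (Φ j)) → Alternating n (λ A → ∑[ j ] (a j * Φ j A))
  alternating-∑ {zero}  a alt A≋B = ∑-cong λ j → *-congˡ (alt j A≋B)
  alternating-∑ {suc n} {N} {m} a {Φ} alt =
    (λ A≋B → ∑-cong λ j → *-congˡ (congruent (alt j) A≋B)) ,
    linear ,
    rep n alt ,
    (λ v → alternating-∑ a λ j → rest (alt j) v)
    where
    linear : HeadLinear (λ A → ∑[ j ] (a j * Φ j A))
    linear b u v A = begin
      ∑[ j ] (a j * Φ j ((λ k → b * u k + v k) ◂ A))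
        ≈⟨ ∑-cong (λ j → trans (*-congˡ (headLinear (alt j) b u v A))
             (solve 4 (λ a b x y → a :* (b :* x :+ y) := b :* (a :* x) :+ a :* y) refl (a j) b _ _)) ⟩
      ∑[ j ] (b * (a j * Φ j (u ◂ A)) + a j * Φ j (v ◂ A))
        ≈⟨ ∑-+ (λ j → b * (a j * Φ j (u ◂ A))) _ ⟩
      ∑[ j ] (b * (a j * Φ j (u ◂ A))) + ∑[ j ] (a j * Φ j (v ◂ A))
        ≈⟨ +-congʳ (*-∑ b (λ j → a j * Φ j (u ◂ A))) ⟨
      b * ∑[ j ] (a j * Φ j (u ◂ A)) + ∑[ j ] (a j * Φ j (v ◂ A)) ∎
    rep : ∀ n {Φ : Fin m → Form (suc n) N} → (∀ j → Alternating (suc n) (Φ j)) →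
          HeadRepeat n (λ A → ∑[ j ] (a j * Φ j A))
    rep zero    alt     = lift tt
    rep (suc n) alt v A = ∑-0 λ j → trans (*-congˡ (repeat (alt j) v A)) (zeroʳ _)

  alternating-minor : ∀ {n N} (j : Fin (suc N)) {Φ : Form n N} →
                      Alternating n Φ → Alternating n (λ A → Φ (minor j A))
  alternating-minor {zero}  j alt A≋B = alt (λ i k → A≋B i (punchIn j k))
  alternating-minor {suc n} {N} j {Φ} alt =
    (λ A≋B → congruent alt λ i k → A≋B i (punchIn j k)) ,
    (λ a u v A → trans (congruent alt (minor-◂ _ A)) (trans (headLinear alt a _ _ _)
      (+-cong (*-congˡ (sym (congruent alt (minor-◂ u A)))) (sym (congruent alt (minor-◂ v A)))))) ,
    rep n alt ,
    (λ v → alternating-resp (λ A → sym (congruent alt (minor-◂ v A)))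
             (alternating-minor j (rest alt (v ∘ punchIn j))))
    where
    minor-◂ : ∀ {n} v (A : Mat′ n (suc N)) → minor j (v ◂ A) ≋ ((v ∘ punchIn j) ◂ minor j A)
    minor-◂ v A zero    k = refl
    minor-◂ v A (suc i) k = refl
    rep : ∀ n {Φ : Form (suc n) N} → Alternating (suc n) Φ → HeadRepeat n (λ A → Φ (minor j A))
    rep zero    alt     = lift tt
    rep (suc n) alt v A =
      trans (congruent alt λ i k → trans (minor-◂ v (v ◂ A) i k) (◂-cong (λ k → refl) (minor-◂ v A) i k))
            (repeat alt (v ∘ punchIn j) (minor j A))

  -- The terms of the double Laplace expansion cancel in the pairs (0, k), (suc k, 0);
  -- the remaining terms form the same sum with the column 0 kept.
  double-expansion : ∀ n (v : Vect (suc (suc n))) (D : (Fin n → Fin (suc (suc n))) → Carrier) →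
    (∀ {f g} → (∀ x → f x ≡ g x) → D f ≈ D g) →
    ∑[ j ] ∑[ k ]
      (sgn (toℕ j) * (v j * (sgn (toℕ k) * (v (punchIn j k) * D (punchIn j ∘ punchIn k))))) ≈ 0#
  double-expansion n v D D-cong = begin
    ∑[ j ] ∑ (Ψ j)
      ≈⟨ ∑-suc _ ⟩
    ∑ (Ψ zero) + ∑[ j ] ∑ (Ψ (suc j))
      ≈⟨ +-congˡ (∑-cong λ j → ∑-suc (Ψ (suc j))) ⟩
    ∑ (Ψ zero) + ∑[ j ] (Ψ (suc j) zero + ∑ (Ψ (suc j) ∘ suc))
      ≈⟨ +-congˡ (∑-+ (λ j → Ψ (suc j) zero) _) ⟩
    ∑ (Ψ zero) + (∑[ j ] Ψ (suc j) zero + ∑[ j ] ∑ (Ψ (suc j) ∘ suc))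
      ≈⟨ +-assoc _ _ _ ⟨
    ∑ (Ψ zero) + ∑[ j ] Ψ (suc j) zero + ∑[ j ] ∑ (Ψ (suc j) ∘ suc)
      ≈⟨ +-cong (sym (∑-+ (Ψ zero) _)) (inner n v D D-cong) ⟩
    ∑[ k ] (Ψ zero k + Ψ (suc k) zero) + 0#
      ≈⟨ +-identityʳ _ ⟩
    ∑[ k ] (Ψ zero k + Ψ (suc k) zero)
      ≈⟨ ∑-0 (λ k → trans (+-congʳ (*-identityˡ _)) (trans (+-congˡ (*-congˡ (*-congˡ (*-identityˡ _))))
           (solve 4 (λ a s b d → a :* (s :* (b :* d)) :+ (:- s) :* (b :* (a :* d)) := con (+ 0)) refl
             (v zero) (sgn (toℕ k)) (v (suc k)) _))) ⟩
    0# ∎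
    where
    Ψ : Fin (suc (suc n)) → Fin (suc n) → Carrier
    Ψ j k = sgn (toℕ j) * (v j * (sgn (toℕ k) * (v (punchIn j k) * D (punchIn j ∘ punchIn k))))
    inner : ∀ n (v : Vect (suc (suc n))) (D : (Fin n → Fin (suc (suc n))) → Carrier) →
      (∀ {f g} → (∀ x → f x ≡ g x) → D f ≈ D g) →
      ∑[ j ] ∑[ k ] (- sgn (toℕ j) * (v (suc j) * (- sgn (toℕ k) *
        (v (suc (punchIn j k)) * D (punchIn (suc j) ∘ punchIn (suc k)))))) ≈ 0#
    inner zero    v D D-cong = ∑-0 {1} λ j → ∑-nil _
    inner (suc n) v D D-cong = trans
      (∑-cong λ j → ∑-cong λ k → trans
        (solve 5 (λ s a t b d → (:- s) :* (a :* ((:- t) :* (b :* d))) := s :* (a :* (t :* (b :* d)))) refl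
          (sgn (toℕ j)) _ (sgn (toℕ k)) _ _)
        (*-congˡ (*-congˡ (*-congˡ (*-congˡ (D-cong λ { zero → ≡.refl ; (suc x) → ≡.refl }))))))
      (double-expansion n (v ∘ suc) (λ f → D (λ { zero → zero ; (suc x) → suc (f x) }))
        (λ f≗g → D-cong λ { zero → ≡.refl ; (suc x) → ≡.cong suc (f≗g x) }))

  -- With the first row fixed, the determinant is a linear combination of determinants of minors,
  -- which are alternating by induction. Equal first and second rows are the one new condition, and
  -- this is `double-expansion`.
  det-alternating : ∀ n → Alternating n (det {n})
  det-alternating zero    A≋B = refl
  det-alternating (suc n) =
    det-cong ,
    (λ a u v A → begin
      ∑[ j ] (sgn (toℕ j) * ((a * u j + v j) * det (minor j A)))
        ≈⟨ ∑-cong (λ j → solve 5 (λ s a u v d → s :* ((a :* u :+ v) :* d) := a :* (s :* (u :* d)) :+ s :* (v :* d))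
             refl (sgn (toℕ j)) a (u j) (v j) _) ⟩
      ∑[ j ] (a * (sgn (toℕ j) * (u j * det (minor j A))) + sgn (toℕ j) * (v j * det (minor j A)))
        ≈⟨ ∑-+ (λ j → a * (sgn (toℕ j) * (u j * det (minor j A)))) _ ⟩
      ∑[ j ] (a * (sgn (toℕ j) * (u j * det (minor j A)))) + det (v ◂ A)
        ≈⟨ +-congʳ (*-∑ a (λ j → sgn (toℕ j) * (u j * det (minor j A)))) ⟨
      a * det (u ◂ A) + det (v ◂ A) ∎) ,
    rep n ,
    (λ v → alternating-resp (λ A → ∑-cong λ j → *-assoc _ _ _)
             (alternating-∑ (λ j → sgn (toℕ j) * v j) λ j → alternating-minor j (det-alternating n)))
    where
    rep : ∀ n → HeadRepeat n (det {suc n})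
    rep zero        = lift tt
    rep (suc n) v A = trans
      (∑-cong λ j → trans (*-congˡ (*-∑ (v j) _)) (*-∑ (sgn (toℕ j)) _))
      (double-expansion n v (λ f → det (λ r s → A r (f s)))
        λ f≗g → det-cong λ r s → reflexive (≡.cong (A r) (f≗g s)))

  -- Uniqueness applied to the form `det` itself, at the rows of `B`.
  det-⊡ : ∀ {n} (A B : Mat′ n n) → det (A ⊡ B) ≈ det A * det B
  det-⊡ {n} = alternating-unique (det-alternating n)

  -- Cramer's rule and McCoy's theorem.

  -- The signed maximal minors, a generalised cross product: pairing with a further row gives the
  -- determinant of the completed square matrix.
  kernelVector : ∀ {n} → Mat′ n (suc n) → Vect (suc n)
  kernelVector A j = sgn (toℕ j) * det (minor j A)

  ∑-kernelVector : ∀ {n} v (A : Mat′ n (suc n)) → ∑[ j ] (v j * kernelVector A j) ≈ det (v ◂ A)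
  ∑-kernelVector v A = ∑-cong λ j →
    solve 3 (λ v s d → v :* (s :* d) := s :* (v :* d)) refl (v j) (sgn (toℕ j)) _

  kernelVector-kernel : ∀ {n} (A : Mat′ n (suc n)) i → ∑[ j ] (A i j * kernelVector A j) ≈ 0#
  kernelVector-kernel {n} A i =
    trans (∑-kernelVector (A i) A) (equal-rows (det-alternating (suc n)) (A i) A i λ k → refl)

  -- The kernel vector of the augmented matrix (b | A) starts with det A; its other coordinates,
  -- negated, solve A x = det A b. No division occurs, so the solution is polynomial in the entries
  -- and is carried along by every ring relation.
  cramer : ∀ {n} → Mat′ n n → Vect n → Vect n
  cramer A b j = - kernelVector (λ i → b i ◂ A i) (suc j)

  cramer-correct : ∀ {n} (A : Mat′ n n) b i → ∑[ j ] (A i j * cramer A b j) ≈ det A * b i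
  cramer-correct {n} A b i = begin
    ∑[ j ] (A i j * - k (suc j))                                     ≈⟨ ∑-cong (λ j → sym (-‿distribʳ-* (A i j) (k (suc j)))) ⟩
    ∑[ j ] (- (A i j * k (suc j)))                                   ≈⟨ ∑-neg (λ j → A i j * k (suc j)) ⟩
    - (∑[ j ] (A i j * k (suc j)))                                   ≈⟨ solve 3 (λ b d s → :- s := d :* b :- (b :* d :+ s)) refl (b i) (det A) _ ⟩
    det A * b i - (b i * det A + ∑[ j ] (A i j * k (suc j)))         ≈⟨ +-congˡ (-‿cong (+-congʳ (*-congˡ (*-identityˡ _)))) ⟨
    det A * b i - (b i * k zero + ∑[ j ] (A i j * k (suc j)))        ≈⟨ +-congˡ (-‿cong (trans (sym (∑-suc _)) (kernelVector-kernel (λ i → b i ◂ A i) i))) ⟩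
    det A * b i - 0#                                                     ≈⟨ trans (+-congˡ -0#≈0#) (+-identityʳ _) ⟩
    det A * b i                                                          ∎
    where
    k : Vect (suc n)
    k = kernelVector (λ i → b i ◂ A i)

  det-scale : ∀ {n} a (A : Mat′ n n) → det (λ i j → a * A i j) ≈ a ^ n * det A
  det-scale {zero}  a A = sym (*-identityˡ _)
  det-scale {suc n} a A = begin
    ∑[ j ] (sgn (toℕ j) * (a * A zero j * det (λ r s → a * minor j (A ∘ suc) r s)))
      ≈⟨ ∑-cong (λ j → trans (*-congˡ (*-congˡ (det-scale a (minor j (A ∘ suc)))))
           (solve 5 (λ s a x p d → s :* (a :* x :* (p :* d)) := a :* p :* (s :* (x :* d))) refl
             (sgn (toℕ j)) a (A zero j) (a ^ n) (det (minor j (A ∘ suc))))) ⟩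
    ∑[ j ] (a * a ^ n * (sgn (toℕ j) * (A zero j * det (minor j (A ∘ suc)))))
      ≈⟨ *-∑ (a * a ^ n) (λ j → sgn (toℕ j) * (A zero j * det (minor j (A ∘ suc)))) ⟨
    a * a ^ n * det A ∎

  det-diagonal : ∀ {n} (A : Mat′ n n) → (∀ {i j} → i ≢ j → A i j ≈ 0#) → det A ≈ product (λ i → A i i)
  det-diagonal {zero}  A others = refl
  det-diagonal {suc n} A others = begin
    det A
      ≈⟨ ∑-single _ zero (λ j 0≢j → trans (*-congˡ (trans (*-congʳ (others 0≢j)) (zeroˡ _))) (zeroʳ _)) ⟩
    1# * (A zero zero * det (λ r s → A (suc r) (suc s)))
      ≈⟨ *-identityˡ _ ⟩
    A zero zero * det (λ r s → A (suc r) (suc s))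
      ≈⟨ *-congˡ (det-diagonal (λ r s → A (suc r) (suc s)) λ i≢j → others λ { ≡.refl → i≢j ≡.refl }) ⟩
    A zero zero * product (λ i → A (suc i) (suc i)) ∎

  Injective : ∀ {m n} → Mat′ m n → Set (c ⊔ ℓ)
  Injective {m} {n} A = ∀ (x : Vect n) → (∀ i → ∑[ j ] (A i j * x j) ≈ 0#) → ∀ j → x j ≈ 0#

  -- McCoy's theorem, in place of Gaussian elimination, which needs decidable equality.
  minors≈0⇒1≈0 : ∀ {m n} (A : Mat′ m n) → Injective A →
    (∀ (ρ : Fin n → Fin m) → det (A ∘ ρ) ≈ 0#) → 1# ≈ 0#
  minors≈0⇒1≈0 {m} {zero}  A inj minors = minors λ ()
  minors≈0⇒1≈0 {m} {suc n} A inj minors = minors≈0⇒1≈0 (λ i → A i ∘ suc)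
    (λ x ker j → inj (0# ◂ x) (λ i → trans (∑-suc _) (trans (+-cong (zeroʳ _) (ker i)) (+-identityˡ _))) (suc j))
    -- The signed minors of the chosen rows are killed by every row of `A`, since pairing with a row
    -- gives a vanishing minor of the next size. Injectivity makes them zero, and their coordinate
    -- `zero` is the minor without the first column.
    (λ ρ → trans (sym (*-identityˡ _)) (inj (kernelVector (A ∘ ρ))
      (λ i → trans (∑-kernelVector (A i) (A ∘ ρ))
        (trans (det-cong {suc n} {A i ◂ (A ∘ ρ)} {A ∘ (i ◂ ρ)} λ { zero k → refl ; (suc r) k → refl }) (minors (i ◂ ρ)))) zero))

  -- Choosing rows by `ρ`, possibly with repetition, is multiplication by a matrix of deltas, so all
  -- these minors are multiples of det A.
  injective⇒det : ∀ {n} (A : Mat′ n n) → Injective A → det A ≈ 0# → 1# ≈ 0#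
  injective⇒det A inj det≈0 = minors≈0⇒1≈0 A inj λ ρ → begin
    det (A ∘ ρ)                      ≈⟨ det-cong (λ i k → ∑-δ (ρ i) (λ l → A l k)) ⟨
    det ((λ i l → δ (ρ i) l) ⊡ A)    ≈⟨ det-⊡ (λ i l → δ (ρ i) l) A ⟩
    det (λ i l → δ (ρ i) l) * det A  ≈⟨ *-congˡ det≈0 ⟩
    det (λ i l → δ (ρ i) l) * 0#     ≈⟨ zeroʳ _ ⟩
    0#                               ∎

-- Relations between rings, respected by sums and determinants.

-- A subring of R × S rather than a homomorphism: the value at 1 of a power series exists only for
-- polynomials, yet has to be treated on a par with constant terms and with x ↦ x + ε D x.
record RingRelation {c ℓ : Level} (R S : CommutativeRing c ℓ) (r : Level) : Set (Level.suc r ⊔ c ⊔ ℓ) where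
  private
    module R = CommutativeRing R
    module S = CommutativeRing S
  infix 4 _~_
  field
    _~_    : R.Carrier → S.Carrier → Set r
    ~-resp : ∀ {x x′ y y′} → x R.≈ x′ → y S.≈ y′ → x ~ y → x′ ~ y′
    ~-0    : R.0# ~ S.0#
    ~-1    : R.1# ~ S.1#
    ~-+    : ∀ {x x′ y y′} → x ~ y → x′ ~ y′ → x R.+ x′ ~ y S.+ y′
    ~-*    : ∀ {x x′ y y′} → x ~ y → x′ ~ y′ → x R.* x′ ~ y S.* y′
    ~-neg  : ∀ {x y} → x ~ y → R.- x ~ S.- y

module RelatedSums {c ℓ r : Level} {R S : CommutativeRing c ℓ} (ρ : RingRelation R S r) where
  open RingRelation ρ
  private
    module R = CommutativeRing R
    module S = CommutativeRing S
    module ΣR = Sums R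
    module ΣS = Sums S
    module DR = Determinant R
    module DS = Determinant S

  ~-∑ : ∀ {n} {f : Fin n → R.Carrier} {g : Fin n → S.Carrier} → (∀ i → f i ~ g i) → ΣR.∑ f ~ ΣS.∑ g
  ~-∑ {zero}  f~g = ~-resp (R.sym (ΣR.∑-nil _)) (S.sym (ΣS.∑-nil _)) ~-0
  ~-∑ {suc n} f~g = ~-resp (R.sym (ΣR.∑-suc _)) (S.sym (ΣS.∑-suc _)) (~-+ (f~g zero) (~-∑ (f~g ∘ suc)))

  ~-sgn : ∀ n → DR.sgn n ~ DS.sgn n
  ~-sgn zero    = ~-1
  ~-sgn (suc n) = ~-neg (~-sgn n)

  ~-det : ∀ {n} {A : DR.Mat′ n n} {B : DS.Mat′ n n} → (∀ i j → A i j ~ B i j) → DR.det A ~ DS.det B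
  ~-det {zero}  A~B = ~-1
  ~-det {suc n} A~B = ~-∑ λ j →
    ~-* (~-sgn (toℕ j)) (~-* (A~B zero j) (~-det λ r s → A~B (suc r) (punchIn j s)))

-- Dual numbers.

module DualNumbers {c ℓ : Level} (R : CommutativeRing c ℓ) where
  open CommutativeRing R hiding (zero)
  open IntegerCoefficients R using (solve; _:=_; _:+_; _:*_)
  open Sums R

  -- The ring R[ε] with ε² = 0; the pair (a , a′) stands for a + ε a′.
  dualRing : CommutativeRing c ℓ
  dualRing = record
    { Carrier = Carrier × Carrier
    ; _≈_ = λ x y → proj₁ x ≈ proj₁ y × proj₂ x ≈ proj₂ y
    ; _+_ = λ x y → proj₁ x + proj₁ y , proj₂ x + proj₂ y
    ; _*_ = λ x y → proj₁ x * proj₁ y , proj₁ x * proj₂ y + proj₂ x * proj₁ y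
    ; -_  = λ x → - proj₁ x , - proj₂ x
    ; 0#  = 0# , 0#
    ; 1#  = 1# , 0#
    ; isCommutativeRing = record
      { isRing = record
        { +-isAbelianGroup = record
          { isGroup = record
            { isMonoid = record
              { isSemigroup = record
                { isMagma = record
                  { isEquivalence = record
                    { refl  = refl , refl
                    ; sym   = λ p → sym (proj₁ p) , sym (proj₂ p)
                    ; trans = λ p q → trans (proj₁ p) (proj₁ q) , trans (proj₂ p) (proj₂ q) }
                  ; ∙-cong = λ p q → +-cong (proj₁ p) (proj₁ q) , +-cong (proj₂ p) (proj₂ q) }
                ; assoc = λ x y z → +-assoc _ _ _ , +-assoc _ _ _ }
              ; identity = (λ x → +-identityˡ _ , +-identityˡ _) , (λ x → +-identityʳ _ , +-identityʳ _) }
            ; inverse = (λ x → -‿inverseˡ _ , -‿inverseˡ _) , (λ x → -‿inverseʳ _ , -‿inverseʳ _)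
            ; ⁻¹-cong = λ p → -‿cong (proj₁ p) , -‿cong (proj₂ p) }
          ; comm = λ x y → +-comm _ _ , +-comm _ _ }
        ; *-cong = λ p q → *-cong (proj₁ p) (proj₁ q) ,
                           +-cong (*-cong (proj₁ p) (proj₂ q)) (*-cong (proj₂ p) (proj₁ q))
        ; *-assoc = λ (a , a′) (b , b′) (d , d′) → *-assoc _ _ _ ,
            solve 6 (λ a a′ b b′ d d′ → a :* b :* d′ :+ (a :* b′ :+ a′ :* b) :* d
                                     := a :* (b :* d′ :+ b′ :* d) :+ a′ :* (b :* d)) refl a a′ b b′ d d′
        ; *-identity = (λ (a , a′) → *-identityˡ a ,
                          trans (+-cong (*-identityˡ a′) (zeroˡ a)) (+-identityʳ a′)) ,
                       (λ (a , a′) → *-identityʳ a ,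
                          trans (+-cong (zeroʳ a) (*-identityʳ a′)) (+-identityˡ a′))
        ; distrib = (λ (a , a′) (b , b′) (d , d′) → distribˡ _ _ _ ,
                       solve 6 (λ a a′ b b′ d d′ → a :* (b′ :+ d′) :+ a′ :* (b :+ d)
                                  := a :* b′ :+ a′ :* b :+ (a :* d′ :+ a′ :* d)) refl a a′ b b′ d d′) ,
                    (λ (a , a′) (b , b′) (d , d′) → distribʳ _ _ _ ,
                       solve 6 (λ a a′ b b′ d d′ → (b :+ d) :* a′ :+ (b′ :+ d′) :* a
                                  := b :* a′ :+ b′ :* a :+ (d :* a′ :+ d′ :* a)) refl a a′ b b′ d d′)
        }
      ; *-comm = λ (a , a′) (b , b′) → *-comm _ _ ,
          solve 4 (λ a a′ b b′ → a :* b′ :+ a′ :* b := b :* a′ :+ b′ :* a) refl a a′ b b′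
      }
    }

  private
    module T = CommutativeRing dualRing
    module ΣT = Sums dualRing

  ∑-dual : ∀ {n} (f : Fin n → T.Carrier) → ΣT.∑ f T.≈ (∑ (proj₁ ∘ f) , ∑ (proj₂ ∘ f))
  ∑-dual {zero}  f = T.trans (ΣT.∑-nil f) (sym (∑-nil _) , sym (∑-nil _))
  ∑-dual {suc n} f = T.trans (ΣT.∑-suc f)
    (T.trans (T.+-congˡ (∑-dual (f ∘ suc))) (sym (∑-suc _) , sym (∑-suc _)))

  realPart : RingRelation dualRing R ℓ
  realPart = record
    { _~_    = λ x y → proj₁ x ≈ y
    ; ~-resp = λ x≈x′ y≈y′ p → trans (sym (proj₁ x≈x′)) (trans p y≈y′)
    ; ~-0 = refl ; ~-1 = refl ; ~-+ = +-cong ; ~-* = *-cong ; ~-neg = -‿cong }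

-- Derivations and the derivative of a determinant.

module Derivation {c ℓ : Level} (R : CommutativeRing c ℓ) where
  open CommutativeRing R hiding (zero)
  open IntegerCoefficients R using (solve; con; _:=_; _:+_; _:*_; _:-_; :-_)
  open Sums R
  open Determinant R
  open DualNumbers R
  open import Algebra.Properties.Ring ring
  open import Relation.Binary.Reasoning.Setoid setoid
  open import Algebra.Properties.Monoid.Sum *-monoid using () renaming (sum to product)

  record IsDerivation (D : Carrier → Carrier) : Set (c ⊔ ℓ) where
    field
      D-cong : ∀ {x y} → x ≈ y → D x ≈ D y
      D-+    : ∀ x y → D (x + y) ≈ D x + D y
      D-*    : ∀ x y → D (x * y) ≈ x * D y + D x * y

    D-0 : D 0# ≈ 0#
    D-0 = +-identityˡ-unique _ _ (trans (sym (D-+ 0# 0#)) (D-cong (+-identityˡ 0#)))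

    D-1 : D 1# ≈ 0#
    D-1 = +-identityˡ-unique _ _ (trans
      (+-cong (sym (*-identityˡ _)) (sym (*-identityʳ _)))
      (trans (sym (D-* 1# 1#)) (D-cong (*-identityˡ 1#))))

    D-neg : ∀ x → D (- x) ≈ - D x
    D-neg x = +-inverseˡ-unique _ _ (trans (sym (D-+ (- x) x)) (trans (D-cong (-‿inverseˡ x)) D-0))

    D-- : ∀ x y → D (x - y) ≈ D x - D y
    D-- x y = trans (D-+ x (- y)) (+-congˡ (D-neg y))

    D-∑ : ∀ {n} (f : Fin n → Carrier) → D (∑ f) ≈ ∑ (D ∘ f)
    D-∑ {zero}  f = trans (D-cong (∑-nil f)) (trans D-0 (sym (∑-nil _)))
    D-∑ {suc n} f = trans (D-cong (∑-suc f)) (trans (D-+ _ _)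
      (trans (+-congˡ (D-∑ (f ∘ suc))) (sym (∑-suc _))))

    -- By the Leibniz rule x ↦ x + ε D x is a ring homomorphism. It commutes with determinants, so D
    -- (det N) is available without differentiating the Laplace expansion.
    firstOrder : RingRelation R dualRing ℓ
    firstOrder = record
      { _~_    = λ x y → x ≈ proj₁ y × D x ≈ proj₂ y
      ; ~-resp = λ p q (u , v) → trans (sym p) (trans u (proj₁ q)) , trans (D-cong (sym p)) (trans v (proj₂ q))
      ; ~-0    = refl , D-0
      ; ~-1    = refl , D-1
      ; ~-+    = λ (u , v) (u′ , v′) → +-cong u u′ , trans (D-+ _ _) (+-cong v v′)
      ; ~-*    = λ (u , v) (u′ , v′) → *-cong u u′ , trans (D-* _ _) (+-cong (*-cong u v′) (*-cong v u′))
      ; ~-neg  = λ (u , v) → -‿cong u , trans (D-neg _) (-‿cong v) }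

  product-1 : ∀ n → product {n} (λ i → 1#) ≈ 1#
  product-1 zero    = refl
  product-1 (suc n) = trans (*-identityˡ _) (product-1 n)

  -- Its `firstOrder` is the inclusion of the constants into the dual numbers.
  zeroDerivation : IsDerivation (λ _ → 0#)
  zeroDerivation = record
    { D-cong = λ _ → refl
    ; D-+    = λ _ _ → sym (+-identityˡ 0#)
    ; D-*    = λ x y → sym (trans (+-cong (zeroʳ x) (zeroˡ y)) (+-identityˡ 0#)) }

  module _ {D : Carrier → Carrier} (der : IsDerivation D) where
    open IsDerivation der

    private
      module T = CommutativeRing dualRing
      module DT = Determinant dualRing
      module ΣT = Sums dualRing

    -- With ε² = 0 the hypothesis reads (N + ε D N)(1 - ε W) = (1 - ε W) N.
    D-det≈0 : ∀ {n} (N W : Mat′ n n) →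
      (∀ i j → D (N i j) ≈ (N ⊡ W) i j - (W ⊡ N) i j) → D (det N) ≈ 0#
    D-det≈0 {n} N W DN = begin
      D (det N)
        -- The ε-part of `determinants` reads det N u₁ + D (det N) u₀ = u₁ det N, and u₀ = 1.
        ≈⟨ solve 4 (λ x y a b → y := (x :* b :+ y :* a) :- x :* b :+ y :* (con (+ 1) :- a)) refl (det N) (D (det N)) u₀ u₁ ⟩
      (det N * u₁ + D (det N) * u₀) - det N * u₁ + D (det N) * (nat1 - u₀)
        ≈⟨ +-cong (+-congʳ (proj₂ determinants)) (*-congˡ (+-cong (+-identityʳ 1#) (-‿cong u₀≈1))) ⟩
      (u₀ * 0# + u₁ * det N) - det N * u₁ + D (det N) * (1# - 1#)
        ≈⟨ +-cong (+-congʳ (+-congʳ (zeroʳ u₀))) (trans (*-congˡ (-‿inverseʳ 1#)) (zeroʳ _)) ⟩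
      (0# + u₁ * det N) - det N * u₁ + 0#
        ≈⟨ solve 2 (λ x b → con (+ 0) :+ b :* x :- x :* b :+ con (+ 0) := con (+ 0)) refl (det N) u₁ ⟩
      0# ∎
      where
      -- The form 1# + 0# in which the solver expresses the constant 1.
      nat1 : Carrier
      nat1 = 1# + 0#
      N₀ N₁ U : DT.Mat′ n n
      N₀ i j = N i j , 0#
      N₁ i j = N i j , D (N i j)
      U  i j = δ i j , - W i j
      u₀ u₁ : Carrier
      u₀ = proj₁ (DT.det U)
      u₁ = proj₂ (DT.det U)
      u₀≈1 : u₀ ≈ 1#
      u₀≈1 = begin
        u₀                       ≈⟨ RelatedSums.~-det realPart {A = U} {δ} (λ i j → refl) ⟩
        det (δ {n})              ≈⟨ det-diagonal (δ {n}) (λ i≢j → reflexive (δ-off i≢j)) ⟩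
        product (λ i → δ {n} i i) ≡⟨ Prod.sum-cong-≗ (δ-refl {n}) ⟩
        product {n} (λ i → 1#)   ≈⟨ product-1 n ⟩
        1#                       ∎
        where import Algebra.Properties.Monoid.Sum *-monoid as Prod
      ∑-δʳ : ∀ j (f : Fin n → Carrier) → ∑[ l ] (f l * δ l j) ≈ f j
      ∑-δʳ j f = trans (∑-single _ j λ l j≢l → trans (*-congˡ (reflexive (δ-off (j≢l ∘ ≡.sym)))) (zeroʳ _))
                       (trans (*-congˡ (reflexive (δ-refl j))) (*-identityʳ _))
      intertwine : ∀ i j → (N₁ DT.⊡ U) i j T.≈ (U DT.⊡ N₀) i j
      intertwine i j = T.trans (∑-dual _) (T.trans
        ( trans (∑-δʳ j (N i)) (sym (∑-δ i (λ l → N l j)))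
        , (begin
            ∑[ l ] (N i l * - W l j + D (N i l) * δ l j)
              ≈⟨ ∑-+ (λ l → N i l * - W l j) _ ⟩
            ∑[ l ] (N i l * - W l j) + ∑[ l ] (D (N i l) * δ l j)
              ≈⟨ +-cong (trans (∑-cong λ l → sym (-‿distribʳ-* _ _)) (∑-neg _)) (trans (∑-δʳ j _) (DN i j)) ⟩
            - (N ⊡ W) i j + ((N ⊡ W) i j - (W ⊡ N) i j)
              ≈⟨ solve 2 (λ x y → :- x :+ (x :- y) := con (+ 0) :- y) refl ((N ⊡ W) i j) ((W ⊡ N) i j) ⟩
            0# - (W ⊡ N) i j
              ≈⟨ +-cong (∑-0 λ l → zeroʳ (δ i l)) (trans (∑-cong λ l → sym (-‿distribˡ-* _ _)) (∑-neg _)) ⟨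
            ∑[ l ] (δ i l * 0#) + ∑[ l ] (- W i l * N l j)
              ≈⟨ ∑-+ (λ l → δ i l * 0#) _ ⟨
            ∑[ l ] (δ i l * 0# + - W i l * N l j) ∎))
        (T.sym (∑-dual (λ l → U i l T.* N₀ l j))))
      determinants : (det N , D (det N)) T.* DT.det U T.≈ DT.det U T.* (det N , 0#)
      determinants = T.trans (T.*-congʳ {x = DT.det U} (RelatedSums.~-det firstOrder {A = N} {N₁} λ i j → refl , refl))
        (T.trans (T.sym (DT.det-⊡ N₁ U)) (T.trans (DT.det-cong intertwine)
        (T.trans (DT.det-⊡ U N₀) (T.*-congˡ {x = DT.det U} (T.sym
          (RelatedSums.~-det (IsDerivation.firstOrder zeroDerivation) {A = N} {N₀} λ i j → refl , refl))))))

-- Formal power series, the Euler derivation, and values at 1.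

module PowerSeries {c ℓ : Level} (R : CommutativeRing c ℓ) where
  open CommutativeRing R hiding (zero)
  open IntegerCoefficients R using (nat; solve; con; _:=_; _:+_; _:*_; _:-_; :-_)
  open Sums R
  open import Algebra.Properties.Ring ring using (-‿distribˡ-*)
  open import Relation.Binary.Reasoning.Setoid setoid
  import Algebra.Construct.Pointwise ℕ as Pointwise

  Series : Set c
  Series = ℕ → Carrier

  infix 4 _≈ₛ_
  _≈ₛ_ : Series → Series → Set ℓ
  f ≈ₛ g = ∀ n → f n ≈ g n

  tail : Series → Series
  tail f n = f (suc n)

  const : Carrier → Series
  const a zero    = a
  const a (suc n) = 0#

  shift : Series → Series
  shift f zero    = 0#
  shift f (suc n) = f n

  infixl 7 _*ₛ_
  -- The Cauchy product, from (f₀ + s f′) g = f₀ g + s f′ g with f′ the tail of f.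
  _*ₛ_ : Series → Series → Series
  (f *ₛ g) zero    = f 0 * g 0
  (f *ₛ g) (suc n) = f 0 * g (suc n) + (tail f *ₛ g) n

  private
    *ₛ-cong : ∀ {f f′ g g′} → f ≈ₛ f′ → g ≈ₛ g′ → f *ₛ g ≈ₛ f′ *ₛ g′
    *ₛ-cong p q zero    = *-cong (p 0) (q 0)
    *ₛ-cong p q (suc n) = +-cong (*-cong (p 0) (q (suc n))) (*ₛ-cong (p ∘ suc) q n)

    *ₛ-zeroˡ : ∀ f g → f ≈ₛ (λ _ → 0#) → f *ₛ g ≈ₛ (λ _ → 0#)
    *ₛ-zeroˡ f g p zero    = trans (*-congʳ (p 0)) (zeroˡ _)
    *ₛ-zeroˡ f g p (suc n) = trans (+-cong (trans (*-congʳ (p 0)) (zeroˡ _)) (*ₛ-zeroˡ (tail f) g (p ∘ suc) n)) (+-identityˡ _)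

    *ₛ-distribʳ : ∀ h f g → (λ n → f n + g n) *ₛ h ≈ₛ (λ n → (f *ₛ h) n + (g *ₛ h) n)
    *ₛ-distribʳ h f g zero    = distribʳ _ _ _
    *ₛ-distribʳ h f g (suc n) = trans (+-congˡ (*ₛ-distribʳ h (tail f) (tail g) n))
      (solve 5 (λ a b x y z → (a :+ b) :* x :+ (y :+ z) := (a :* x :+ y) :+ (b :* x :+ z)) refl (f 0) (g 0) (h (suc n)) _ _)

    *ₛ-scale : ∀ a f g → (λ n → a * f n) *ₛ g ≈ₛ (λ n → a * (f *ₛ g) n)
    *ₛ-scale a f g zero    = *-assoc _ _ _
    *ₛ-scale a f g (suc n) = trans (+-congˡ (*ₛ-scale a (tail f) g n))
      (solve 4 (λ a x y z → a :* x :* y :+ a :* z := a :* (x :* y :+ z)) refl a (f 0) (g (suc n)) _)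

    *ₛ-assoc : ∀ f g h → (f *ₛ g) *ₛ h ≈ₛ f *ₛ (g *ₛ h)
    *ₛ-assoc f g h zero    = *-assoc _ _ _
    *ₛ-assoc f g h (suc n) = begin
      f 0 * g 0 * h (suc n) + (tail (f *ₛ g) *ₛ h) n
        ≈⟨ +-congˡ (*ₛ-distribʳ h (λ k → f 0 * tail g k) (tail f *ₛ g) n) ⟩
      f 0 * g 0 * h (suc n) + (((λ k → f 0 * tail g k) *ₛ h) n + ((tail f *ₛ g) *ₛ h) n)
        ≈⟨ +-congˡ (+-cong (*ₛ-scale (f 0) (tail g) h n) (*ₛ-assoc (tail f) g h n)) ⟩
      f 0 * g 0 * h (suc n) + (f 0 * (tail g *ₛ h) n + (tail f *ₛ (g *ₛ h)) n)
        ≈⟨ solve 5 (λ a b x y z → a :* b :* x :+ (a :* y :+ z) := a :* (b :* x :+ y) :+ z) refl (f 0) (g 0) (h (suc n)) _ _ ⟩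
      f 0 * (g 0 * h (suc n) + (tail g *ₛ h) n) + (tail f *ₛ (g *ₛ h)) n ∎

    *ₛ-sucʳ : ∀ f g n → (f *ₛ g) (suc n) ≈ (f *ₛ tail g) n + f (suc n) * g 0
    *ₛ-sucʳ f g zero    = refl
    *ₛ-sucʳ f g (suc n) = trans (+-congˡ (*ₛ-sucʳ (tail f) g n)) (sym (+-assoc _ _ _))

    *ₛ-comm : ∀ f g → f *ₛ g ≈ₛ g *ₛ f
    *ₛ-comm f g zero    = *-comm _ _
    *ₛ-comm f g (suc n) = begin
      f 0 * g (suc n) + (tail f *ₛ g) n  ≈⟨ +-cong (*-comm _ _) (*ₛ-comm (tail f) g n) ⟩
      g (suc n) * f 0 + (g *ₛ tail f) n  ≈⟨ +-comm _ _ ⟩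
      (g *ₛ tail f) n + g (suc n) * f 0  ≈⟨ *ₛ-sucʳ g f n ⟨
      (g *ₛ f) (suc n)                   ∎

    *ₛ-identityˡ : ∀ f → const 1# *ₛ f ≈ₛ f
    *ₛ-identityˡ f zero    = *-identityˡ _
    *ₛ-identityˡ f (suc n) = trans (+-cong (*-identityˡ _) (*ₛ-zeroˡ _ f (λ _ → refl) n)) (+-identityʳ _)

  powerSeriesRing : CommutativeRing c ℓ
  powerSeriesRing = record
    { Carrier = Series
    ; _≈_ = _≈ₛ_
    ; _+_ = λ f g n → f n + g n
    ; _*_ = _*ₛ_
    ; -_  = λ f n → - f n
    ; 0#  = λ _ → 0#
    ; 1#  = const 1#
    ; isCommutativeRing = record
      { isRing = record
        { +-isAbelianGroup = Pointwise.isAbelianGroup +-isAbelianGroup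
        ; *-cong = *ₛ-cong
        ; *-assoc = *ₛ-assoc
        ; *-identity = *ₛ-identityˡ , λ f n → trans (*ₛ-comm f (const 1#) n) (*ₛ-identityˡ f n)
        ; distrib = (λ f g h n → trans (*ₛ-comm f _ n) (trans (*ₛ-distribʳ f g h n)
                       (+-cong (*ₛ-comm g f n) (*ₛ-comm h f n)))) , *ₛ-distribʳ }
      ; *-comm = *ₛ-comm } }

  private
    module S = CommutativeRing powerSeriesRing

  constantTerm : RingRelation powerSeriesRing R ℓ
  constantTerm = record
    { _~_    = λ f x → f 0 ≈ x
    ; ~-resp = λ p q u → trans (sym (p 0)) (trans u q)
    ; ~-0 = refl ; ~-1 = refl ; ~-+ = +-cong ; ~-* = *-cong ; ~-neg = -‿cong }

  -- The derivation s d/ds. Unlike d/ds it does not shift indices, and in the absence of torsion it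
  -- likewise kills only the constants.
  euler : Series → Series
  euler f n = nat n * f n

  euler-isDerivation : Derivation.IsDerivation powerSeriesRing euler
  euler-isDerivation = record
    { D-cong = λ p n → *-congˡ (p n)
    ; D-+    = λ f g n → distribˡ _ _ _
    ; D-*    = leibniz }
    where
    leibniz : ∀ f g → euler (f *ₛ g) ≈ₛ (λ n → (f *ₛ euler g) n + (euler f *ₛ g) n)
    leibniz f g zero    = solve 2 (λ x y → con (+ 0) :* (x :* y) := x :* (con (+ 0) :* y) :+ con (+ 0) :* x :* y) refl (f 0) (g 0)
    leibniz f g (suc n) = begin
      nat (suc n) * (f 0 * g (suc n) + (tail f *ₛ g) n)
        -- The factor n + 1 is split as 1 + n because the tail of `euler f` is `tail f` plus
        -- `euler (tail f)`; the spare product supplies the first of these.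
        ≈⟨ trans (distribˡ _ _ _) (+-congˡ (trans (distribʳ _ _ _) (+-congʳ (*-identityˡ _)))) ⟩
      nat (suc n) * (f 0 * g (suc n)) + ((tail f *ₛ g) n + nat n * (tail f *ₛ g) n)
        ≈⟨ +-congˡ (+-congˡ (leibniz (tail f) g n)) ⟩
      nat (suc n) * (f 0 * g (suc n)) + ((tail f *ₛ g) n + ((tail f *ₛ euler g) n + (euler (tail f) *ₛ g) n))
        ≈⟨ solve 7 (λ s x y a b d z → s :* (x :* y) :+ (a :+ (b :+ d)) := (x :* (s :* y) :+ b) :+ (con (+ 0) :* x :* z :+ (a :+ d)))
             refl (nat (suc n)) (f 0) (g (suc n)) _ _ _ (g (suc n)) ⟩
      (f 0 * (nat (suc n) * g (suc n)) + (tail f *ₛ euler g) n) +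
        (0# * f 0 * g (suc n) + ((tail f *ₛ g) n + (euler (tail f) *ₛ g) n))
        ≈⟨ +-congˡ (+-congˡ (*ₛ-distribʳ g (tail f) (euler (tail f)) n)) ⟨
      (f 0 * (nat (suc n) * g (suc n)) + (tail f *ₛ euler g) n) +
        (0# * f 0 * g (suc n) + ((λ k → tail f k + euler (tail f) k) *ₛ g) n)
        ≈⟨ +-congˡ (+-congˡ (*ₛ-cong (λ k → trans (distribʳ _ _ _) (+-congʳ (*-identityˡ _))) (λ _ → refl) n)) ⟨
      (f *ₛ euler g) (suc n) + (euler f *ₛ g) (suc n) ∎

  -- The deformation argument uses the absence of torsion here only.
  euler≈0⇒const : (∀ n x → nat (suc n) * x ≈ 0# → x ≈ 0#) → ∀ f → euler f ≈ₛ (λ _ → 0#) → f ≈ₛ const (f 0)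
  euler≈0⇒const torsionFree f p zero    = refl
  euler≈0⇒const torsionFree f p (suc n) = torsionFree n _ (p (suc n))

  module _ (f : Series) (u : Carrier) where
    -- Coefficients n, n-1, …, 0 of the inverse series.
    inverseCoefficients : ∀ n → Fin (suc n) → Carrier
    inverseCoefficients zero    = λ _ → u
    inverseCoefficients (suc n) =
      - u * ∑[ i ] (f (suc (toℕ i)) * inverseCoefficients n i) ◂ inverseCoefficients n

    inverse : Series
    inverse n = inverseCoefficients n zero

    -- As the coefficients of the inverse are stored in reverse order, the convolution becomes an
    -- ordinary dot product.
    *ₛ-inverse-∑ : ∀ h n → (h *ₛ inverse) n ≈ ∑[ i ] (h (toℕ i) * inverseCoefficients n i)
    *ₛ-inverse-∑ h zero    = sym (trans (∑-suc _) (trans (+-congˡ (∑-nil _)) (+-identityʳ _)))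
    *ₛ-inverse-∑ h (suc n) = trans (+-congˡ (*ₛ-inverse-∑ (tail h) n)) (sym (∑-suc _))

    *ₛ-inverse : f 0 * u ≈ 1# → f *ₛ inverse ≈ₛ const 1#
    *ₛ-inverse fu≈1 zero    = fu≈1
    *ₛ-inverse fu≈1 (suc n) = begin
      f 0 * (- u * s) + (tail f *ₛ inverse) n  ≈⟨ +-congˡ (*ₛ-inverse-∑ (tail f) n) ⟩
      f 0 * (- u * s) + s                      ≈⟨ solve 3 (λ x u s → x :* ((:- u) :* s) :+ s := s :- x :* u :* s) refl (f 0) u s ⟩
      s - f 0 * u * s                          ≈⟨ +-congˡ (-‿cong (trans (*-congʳ fu≈1) (*-identityˡ s))) ⟩
      s - s                                    ≈⟨ -‿inverseʳ s ⟩
      0#                                       ∎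
      where
      s : Carrier
      s = ∑[ i ] (f (suc (toℕ i)) * inverseCoefficients n i)

  -- f ↝ x: the series f is a polynomial, with value x at 1.
  infix 4 _↝_
  data _↝_ : Series → Carrier → Set (c ⊔ ℓ) where
    nil  : ∀ {f x} → f ≈ₛ (λ _ → 0#) → x ≈ 0# → f ↝ x
    cons : ∀ {f x y} → tail f ↝ y → x ≈ f 0 + y → f ↝ x

  ↝-resp : ∀ {f f′ x x′} → f ≈ₛ f′ → x ≈ x′ → f ↝ x → f′ ↝ x′
  ↝-resp p q (nil z w)  = nil (λ n → trans (sym (p n)) (z n)) (trans (sym q) w)
  ↝-resp p q (cons r w) = cons (↝-resp (p ∘ suc) refl r) (trans (sym q) (trans w (+-congʳ (p 0))))

  -- Lets `nil` be read as a further zero coefficient, so that polynomials presented with different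
  -- lengths can be added and multiplied.
  ↝-head : ∀ {f x} → f ↝ x → Σ Carrier λ y → tail f ↝ y × x ≈ f 0 + y
  ↝-head (nil z w)  = 0# , nil (z ∘ suc) refl , trans w (sym (trans (+-congʳ (z 0)) (+-identityˡ _)))
  ↝-head (cons r w) = _ , r , w

  ↝-+ : ∀ {f g x y} → f ↝ x → g ↝ y → (λ n → f n + g n) ↝ x + y
  ↝-+ (nil z w) q =
    ↝-resp (λ n → sym (trans (+-congʳ (z n)) (+-identityˡ _))) (sym (trans (+-congʳ w) (+-identityˡ _))) q
  ↝-+ {f} {g} (cons p w) q with ↝-head q
  ... | _ , r , v = cons (↝-+ p r) (trans (+-cong w v)
    (solve 4 (λ a b x y → (a :+ x) :+ (b :+ y) := (a :+ b) :+ (x :+ y)) refl (f 0) (g 0) _ _))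

  ↝-scale : ∀ a {f x} → f ↝ x → (λ n → a * f n) ↝ a * x
  ↝-scale a (nil z w)  = nil (λ n → trans (*-congˡ (z n)) (zeroʳ a)) (trans (*-congˡ w) (zeroʳ a))
  ↝-scale a (cons p w) = cons (↝-scale a p) (trans (*-congˡ w) (distribˡ _ _ _))

  ↝-const : ∀ a → const a ↝ a
  ↝-const a = cons (nil (λ _ → refl) refl) (sym (+-identityʳ a))

  ↝-shift : ∀ {f x} → f ↝ x → shift f ↝ x
  ↝-shift p = cons p (sym (+-identityˡ _))

  ↝-* : ∀ {f g x y} → f ↝ x → g ↝ y → f *ₛ g ↝ x * y
  ↝-* {g = g} (nil z w) q = nil (*ₛ-zeroˡ _ g z) (trans (*-congʳ w) (zeroˡ _))
  ↝-* {f} {g} (cons p w) q with ↝-head q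
  ... | _ , r , v = cons (↝-+ (↝-scale (f 0) r) (↝-* p q)) (trans (trans (*-congʳ w) (distribʳ _ _ _))
    (trans (+-congʳ (trans (*-congˡ v) (distribˡ _ _ _))) (+-assoc _ _ _)))

  -- Two presentations of a polynomial differ only in trailing zeros, which contribute nothing to
  -- the value.
  ↝-unique : ∀ {f x y} → f ↝ x → f ↝ y → x ≈ y
  ↝-unique (nil z w)  q          = trans w (sym (vanish z q))
    where
    vanish : ∀ {f y} → f ≈ₛ (λ _ → 0#) → f ↝ y → y ≈ 0#
    vanish z (nil _ w)  = w
    vanish z (cons r w) = trans w (trans (+-cong (z 0) (vanish (z ∘ suc) r)) (+-identityˡ _))
  ↝-unique (cons p w) q with ↝-head q
  ... | _ , r , v = trans w (trans (+-congˡ (↝-unique p r)) (sym v))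

  evaluation : RingRelation powerSeriesRing R (c ⊔ ℓ)
  evaluation = record
    { _~_    = _↝_
    ; ~-resp = ↝-resp
    ; ~-0    = nil (λ _ → refl) refl
    ; ~-1    = ↝-const 1#
    ; ~-+    = ↝-+
    ; ~-*    = ↝-*
    ; ~-neg  = λ p → ↝-resp (λ n → minus1 _) (minus1 _) (↝-scale (- 1#) p) }
    where
    minus1 : ∀ x → - 1# * x ≈ - x
    minus1 x = trans (sym (-‿distribˡ-* 1# x)) (-‿cong (*-identityˡ x))

-- Lie brackets in coordinates and the form of a functional.

module FrobeniusForm {c ℓ : Level} (R : CommutativeRing c ℓ) where
  open CommutativeRing R hiding (zero)
  open IntegerCoefficients R using (solve; _:=_; _:+_; _:*_; _:-_; :-_)
  open Sums R
  open Determinant R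
  open import Algebra.Properties.Ring ring
  open import Relation.Binary.Reasoning.Setoid setoid

  infixl 6 _⊕_
  infixr 7 _⊙_
  _⊕_ : ∀ {n} → Vect n → Vect n → Vect n
  (x ⊕ y) k = x k + y k

  _⊙_ : ∀ {n} → Carrier → Vect n → Vect n
  (a ⊙ x) k = a * x k

  infix 4 _≃_
  _≃_ : ∀ {n} → Vect n → Vect n → Set ℓ
  x ≃ y = ∀ k → x k ≈ y k

  record IsLieBracket {d} (br : Vect d → Vect d → Vect d) : Set (c ⊔ ℓ) where
    field
      br-cong   : ∀ {x x′ y y′} → x ≃ x′ → y ≃ y′ → br x y ≃ br x′ y′
      br-linear : ∀ a x y z → br (a ⊙ x ⊕ y) z ≃ a ⊙ br x z ⊕ br y z
      br-anti   : ∀ x y k → br x y k ≈ - br y x k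
      jacobi    : ∀ x y z k → br (br x y) z k ≈ br x (br y z) k - br y (br x z) k

  pairing : ∀ {d} → Vect d → Vect d → Carrier
  pairing f x = ∑[ k ] (f k * x k)

  pairing-cong : ∀ {d} {f g x y : Vect d} → f ≃ g → x ≃ y → pairing f x ≈ pairing g y
  pairing-cong f≃g x≃y = ∑-cong λ k → *-cong (f≃g k) (x≃y k)

  pairing-linear : ∀ {d} (f : Vect d) a x y → pairing f (a ⊙ x ⊕ y) ≈ a * pairing f x + pairing f y
  pairing-linear f a x y = begin
    ∑[ k ] (f k * (a * x k + y k))             ≈⟨ ∑-cong (λ k → solve 4 (λ f a x y → f :* (a :* x :+ y) := a :* (f :* x) :+ f :* y) refl (f k) a (x k) (y k)) ⟩
    ∑[ k ] (a * (f k * x k) + f k * y k)       ≈⟨ ∑-+ (λ k → a * (f k * x k)) _ ⟩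
    ∑[ k ] (a * (f k * x k)) + pairing f y     ≈⟨ +-congʳ (*-∑ a (λ k → f k * x k)) ⟨
    a * pairing f x + pairing f y              ∎

  pairing-neg : ∀ {d} (f x : Vect d) → pairing f (λ k → - x k) ≈ - pairing f x
  pairing-neg f x = trans (∑-cong λ k → sym (-‿distribʳ-* _ _)) (∑-neg _)

  pairing-- : ∀ {d} (f x y : Vect d) → pairing f (λ k → x k - y k) ≈ pairing f x - pairing f y
  pairing-- f x y = trans (∑-cong λ k → trans (distribˡ _ _ _) (+-congˡ (sym (-‿distribʳ-* _ _)))) (∑-- (λ k → f k * x k) _)

  module _ {d} (L : Vect d → Carrier) (L-cong : ∀ {x y} → x ≃ y → L x ≈ L y)
           (L-linear : ∀ a x y → L (a ⊙ x ⊕ y) ≈ a * L x + L y) where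

    linear-0 : L (λ k → 0#) ≈ 0#
    linear-0 = +-identityˡ-unique _ _ (begin
      L (λ k → 0#) + L (λ k → 0#)               ≈⟨ +-congʳ (*-identityˡ _) ⟨
      1# * L (λ k → 0#) + L (λ k → 0#)          ≈⟨ L-linear 1# _ _ ⟨
      L (1# ⊙ (λ k → 0#) ⊕ (λ k → 0#))          ≈⟨ L-cong (λ k → trans (+-identityʳ _) (zeroʳ _)) ⟩
      L (λ k → 0#)                              ∎)

    linear-⊙ : ∀ a x → L (a ⊙ x) ≈ a * L x
    linear-⊙ a x = begin
      L (a ⊙ x)                    ≈⟨ L-cong (λ k → sym (+-identityʳ _)) ⟩
      L (a ⊙ x ⊕ (λ k → 0#))       ≈⟨ L-linear a x _ ⟩
      a * L x + L (λ k → 0#)       ≈⟨ trans (+-congˡ linear-0) (+-identityʳ _) ⟩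
      a * L x                      ∎

    linear-∑ : ∀ {m} (a : Vect m) (e : Fin m → Vect d) → L (λ k → ∑[ j ] (a j * e j k)) ≈ ∑[ j ] (a j * L (e j))
    linear-∑ {zero}  a e = trans (L-cong λ k → ∑-nil _) (trans linear-0 (sym (∑-nil _)))
    linear-∑ {suc m} a e = begin
      L (λ k → ∑[ j ] (a j * e j k))                                   ≈⟨ L-cong (λ k → ∑-suc _) ⟩
      L (a zero ⊙ e zero ⊕ (λ k → ∑[ j ] (a (suc j) * e (suc j) k)))   ≈⟨ L-linear (a zero) (e zero) _ ⟩
      a zero * L (e zero) + L (λ k → ∑[ j ] (a (suc j) * e (suc j) k)) ≈⟨ +-congˡ (linear-∑ (a ∘ suc) (e ∘ suc)) ⟩
      a zero * L (e zero) + ∑[ j ] (a (suc j) * L (e (suc j)))         ≈⟨ ∑-suc _ ⟨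
      ∑[ j ] (a j * L (e j))                                           ∎

    linear-δ : ∀ x → L x ≈ ∑[ a ] (x a * L (δ a))
    linear-δ x = trans (L-cong λ k → sym (∑-δʳ k)) (linear-∑ x δ)
      where
      ∑-δʳ : ∀ k → ∑[ a ] (x a * δ a k) ≈ x k
      ∑-δʳ k = trans (∑-single _ k λ l k≢l → trans (*-congˡ (reflexive (δ-off (k≢l ∘ ≡.sym)))) (zeroʳ _))
                     (trans (*-congˡ (reflexive (δ-refl k))) (*-identityʳ _))

  module Bracket {d} {br : Vect d → Vect d → Vect d} (isLie : IsLieBracket br) where
    open IsLieBracket isLie

    br-linearʳ : ∀ x a y z → br x (a ⊙ y ⊕ z) ≃ a ⊙ br x y ⊕ br x z
    br-linearʳ x a y z k = begin
      br x (a ⊙ y ⊕ z) k             ≈⟨ br-anti x _ k ⟩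
      - br (a ⊙ y ⊕ z) x k           ≈⟨ -‿cong (br-linear a y z x k) ⟩
      - (a * br y x k + br z x k)    ≈⟨ solve 3 (λ a p q → :- (a :* p :+ q) := a :* (:- p) :+ :- q) refl a (br y x k) (br z x k) ⟩
      a * - br y x k + - br z x k    ≈⟨ +-cong (*-congˡ (br-anti x y k)) (br-anti x z k) ⟨
      a * br x y k + br x z k        ∎

    br-⊙ˡ : ∀ a x y → br (a ⊙ x) y ≃ a ⊙ br x y
    br-⊙ˡ a x y k = linear-⊙ (λ x → br x y k) (λ p → br-cong p (λ _ → refl) k) (λ a x z → br-linear a x z y k) a x

    br-δ : ∀ x y k → br x y k ≈ ∑[ b ] (y b * br x (δ b) k)
    br-δ x y k = linear-δ (λ y → br x y k) (λ p → br-cong (λ _ → refl) p k) (λ a y z → br-linearʳ x a y z k) y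

    ad : Vect d → Mat′ d d
    ad x a b = br x (δ b) a

    br-0ʳ : ∀ x {y} → (∀ k → y k ≈ 0#) → ∀ k → br x y k ≈ 0#
    br-0ʳ x y≈0 k = trans (br-cong {x} (λ _ → refl) y≈0 k)
      (linear-0 (λ y → br x y k) (λ p → br-cong (λ _ → refl) p k) (λ a y z → br-linearʳ x a y z k))

    ad-br : ∀ x y a b → ad (br x y) a b ≈ (ad x ⊡ ad y) a b - (ad y ⊡ ad x) a b
    ad-br x y a b = trans (jacobi x y (δ b) a) (+-cong (composite x y) (-‿cong (composite y x)))
      where
      composite : ∀ x y → br x (br y (δ b)) a ≈ (ad x ⊡ ad y) a b
      composite x y = trans (br-δ x _ a) (∑-cong λ l → *-comm _ _)

    -- The Kirillov form f([e_a, e_b]), with indices ordered so that the matrix sends x to the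
    -- coordinates of f([x, -]).
    form : Vect d → Mat′ d d
    form f b a = pairing f (br (δ a) (δ b))

    charMatrix : Carrier → Vect d → Mat′ d d
    charMatrix t x i j = t * δ i j - ad x i j

    module _ (f : Vect d) where
      pairing-brˡ : ∀ x y → pairing f (br x y) ≈ ∑[ a ] (x a * pairing f (br (δ a) y))
      pairing-brˡ x y = linear-δ (λ x → pairing f (br x y))
        (λ p → pairing-cong (λ _ → refl) (br-cong p (λ _ → refl)))
        (λ a x z → trans (pairing-cong (λ _ → refl) (br-linear a x z y)) (pairing-linear f a _ _)) x

      pairing-brʳ : ∀ x y → pairing f (br x y) ≈ ∑[ b ] (y b * pairing f (br x (δ b)))
      pairing-brʳ x y = linear-δ (λ y → pairing f (br x y))
        (λ p → pairing-cong (λ _ → refl) (br-cong (λ _ → refl) p))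
        (λ a y z → trans (pairing-cong (λ _ → refl) (br-linearʳ x a y z)) (pairing-linear f a _ _)) y

      form-mul : ∀ x b → ∑[ a ] (form f b a * x a) ≈ pairing f (br x (δ b))
      form-mul x b = trans (∑-cong λ a → *-comm _ _) (sym (pairing-brˡ x (δ b)))

      -- The functional f([x, -]) is g. For g = f this makes x the principal element, and for g = D
      -- f it makes x the element Z that moves the principal element.
      Represents : Vect d → Vect d → Set ℓ
      Represents x g = ∀ b → pairing f (br x (δ b)) ≈ g b

      represents-pairing : ∀ {x g} → Represents x g → ∀ y → pairing f (br x y) ≈ pairing g y
      represents-pairing {x} rep y = trans (pairing-brʳ x y) (∑-cong λ b → trans (*-comm _ _) (*-congʳ (rep b)))

      represents-⊙ : ∀ a {x g} → Represents x g → Represents (a ⊙ x) (a ⊙ g)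
      represents-⊙ a {x} rep b = trans (pairing-cong (λ _ → refl) (br-⊙ˡ a x (δ b)))
        (trans (linear-⊙ (pairing f) (pairing-cong λ _ → refl) (pairing-linear f) a _) (*-congˡ (rep b)))

      -- Free of division, hence meaningful for power series and polynomial along the segment, at
      -- the price of the factor det.
      cramer-represents : ∀ g → Represents (cramer (form f) g) (det (form f) ⊙ g)
      cramer-represents g b = trans (sym (form-mul _ b)) (cramer-correct (form f) g b)

      module _ (u : Carrier) (unit : det (form f) * u ≈ 1#) where
        solution : ∀ g → Represents (u ⊙ cramer (form f) g) g
        solution g b = trans (represents-⊙ u (cramer-represents g) b)
          (trans (sym (*-assoc _ _ _)) (trans (*-congʳ (trans (*-comm _ _) unit)) (*-identityˡ _)))

        -- Surjectivity gives injectivity by antisymmetry: the coordinate x k is f([w, x]) for some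
        -- w, and this is - f([x, w]) = 0.
        nondegenerate : ∀ {x} → Represents x (λ _ → 0#) → ∀ k → x k ≈ 0#
        nondegenerate {x} rep k = begin
          x k                          ≈⟨ ∑-δ k x ⟨
          pairing (δ k) x              ≈⟨ represents-pairing (solution (δ k)) x ⟨
          pairing f (br w x)           ≈⟨ pairing-cong (λ _ → refl) (br-anti w x) ⟩
          pairing f (λ j → - br x w j) ≈⟨ pairing-neg f _ ⟩
          - pairing f (br x w)         ≈⟨ -‿cong (represents-pairing rep w) ⟩
          - pairing (λ _ → 0#) w       ≈⟨ -‿cong (∑-0 λ _ → zeroˡ _) ⟩
          - 0#                         ≈⟨ -0#≈0# ⟩
          0#                           ∎
          where
          w : Vect d
          w = u ⊙ cramer (form f) (δ k)

        represents-unique : ∀ {x y g} → Represents x g → Represents y g → x ≃ y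
        represents-unique {x} {y} {g} p q k = x-y≈0⇒x≈y (x k) (y k) (trans (sym (swap′ k)) (nondegenerate difference k))
          where
          x-y≈0⇒x≈y : ∀ a b → a - b ≈ 0# → a ≈ b
          x-y≈0⇒x≈y a b eq = trans (solve 2 (λ a b → a := (a :- b) :+ b) refl a b) (trans (+-congʳ eq) (+-identityˡ b))
          swap′ : (- 1# ⊙ y ⊕ x) ≃ (λ k → x k - y k)
          swap′ k = trans (+-congʳ (trans (sym (-‿distribˡ-* 1# _)) (-‿cong (*-identityˡ _)))) (+-comm _ _)
          difference : Represents (- 1# ⊙ y ⊕ x) (λ _ → 0#)
          difference b = begin
            pairing f (br (- 1# ⊙ y ⊕ x) (δ b))  ≈⟨ pairing-cong (λ _ → refl) (br-linear (- 1#) y x (δ b)) ⟩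
            pairing f (- 1# ⊙ br y (δ b) ⊕ br x (δ b))  ≈⟨ pairing-linear f (- 1#) _ _ ⟩
            - 1# * pairing f (br y (δ b)) + pairing f (br x (δ b))  ≈⟨ +-cong (*-congˡ (q b)) (p b) ⟩
            - 1# * g b + g b  ≈⟨ +-congʳ (trans (sym (-‿distribˡ-* 1# _)) (-‿cong (*-identityˡ _))) ⟩
            - g b + g b       ≈⟨ -‿inverseˡ (g b) ⟩
            0#                ∎

-- Transport of pairings and brackets between rings.

module RelatedBrackets {c ℓ r : Level} {R S : CommutativeRing c ℓ} (ρ : RingRelation R S r) where
  open RingRelation ρ
  open RelatedSums ρ
  private
    module R = CommutativeRing R
    module S = CommutativeRing S
    module DR = Determinant R
    module DS = Determinant S
    module FR = FrobeniusForm R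
    module FS = FrobeniusForm S

  ~-δ : ∀ {n} (i j : Fin n) → Sums.δ R i j ~ Sums.δ S i j
  ~-δ i j with i Fin.≟ j
  ... | yes _ = ~-1
  ... | no  _ = ~-0

  ~-pairing : ∀ {d} {f x : DR.Vect d} {g y : DS.Vect d} →
              (∀ k → f k ~ g k) → (∀ k → x k ~ y k) → FR.pairing f x ~ FS.pairing g y
  ~-pairing f~g x~y = ~-∑ λ k → ~-* (f~g k) (x~y k)

  ~-cramer : ∀ {n} {A : DR.Mat′ n n} {B : DS.Mat′ n n} {f : DR.Vect n} {g : DS.Vect n} →
             (∀ i j → A i j ~ B i j) → (∀ k → f k ~ g k) → ∀ k → DR.cramer A f k ~ DS.cramer B g k
  ~-cramer {A = A} {B} {f} {g} A~B f~g k = ~-neg (~-* (~-sgn (suc (toℕ k))) (~-det λ i j → related i (punchIn (suc k) j)))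
    where
    related : ∀ i j → (f i ◂ A i) j ~ (g i ◂ B i) j
    related i zero    = f~g i
    related i (suc j) = A~B i j

  open import Algebra.Properties.Semiring.Exp R.semiring using () renaming (_^_ to _^R_)
  open import Algebra.Properties.Semiring.Exp S.semiring using () renaming (_^_ to _^S_)

  ~-^ : ∀ {x y} n → x ~ y → (x ^R n) ~ (y ^S n)
  ~-^ zero    x~y = ~-1
  ~-^ (suc n) x~y = ~-* x~y (~-^ n x~y)

-- A bracket defined over every commutative ring at once, by the same integral
-- structure constants: it is respected by ring relations and by derivations.
record IntegralBracket (c ℓ : Level) (d : ℕ) : Setω where
  field
    bracket   : (R : CommutativeRing c ℓ) → (x y : Determinant.Vect R d) → Determinant.Vect R d
    isLie     : (R : CommutativeRing c ℓ) → FrobeniusForm.IsLieBracket R (bracket R)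
    ~-bracket : {R S : CommutativeRing c ℓ} {r : Level} (ρ : RingRelation R S r) → let open RingRelation ρ in
      ∀ {x y x′ y′} → (∀ k → x k ~ x′ k) → (∀ k → y k ~ y′ k) → ∀ k → bracket R x y k ~ bracket S x′ y′ k
    D-bracket : (R : CommutativeRing c ℓ) → let open CommutativeRing R in
      ∀ {D : Carrier → Carrier} → Derivation.IsDerivation R D → ∀ x y k →
      D (bracket R x y k) ≈ bracket R x (D ∘ y) k + bracket R (D ∘ x) y k

-- Constancy of the characteristic polynomial along a segment of functionals.

module SpectrumConstant {c ℓ : Level} {d : ℕ} (𝔤 : IntegralBracket c ℓ d) (R : CommutativeRing c ℓ) where
  open IntegralBracket 𝔤
  open CommutativeRing R hiding (zero)
  open IntegerCoefficients R using (nat; solve; con; _:=_; _:+_; _:*_; _:-_; :-_)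
  open Sums R
  open Determinant R
  open FrobeniusForm R
  open Bracket (isLie R)
  open PowerSeries R
  open import Algebra.Properties.Semiring.Exp semiring using (_^_)

  private
    S : CommutativeRing c ℓ
    S = powerSeriesRing
    module S = CommutativeRing S
    module ΣS = Sums S
    module DS = Determinant S
    module FS = FrobeniusForm S
    module LS = FS.Bracket (isLie S)
    module IS = IntegerCoefficients S
    open import Algebra.Properties.Semiring.Exp S.semiring using () renaming (_^_ to _^ₛ_)
    open Derivation.IsDerivation euler-isDerivation

    br : DS.Vect d → DS.Vect d → DS.Vect d
    br = bracket S
    D : DS.Vect d → DS.Vect d
    D x k = euler (x k)

    D-δ : ∀ (b k : Fin d) → euler (ΣS.δ b k) S.≈ S.0#
    D-δ b k with b Fin.≟ k
    ... | yes _ = D-1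
    ... | no  _ = D-0

    D-pairing : ∀ f x → euler (FS.pairing f x) S.≈ FS.pairing f (D x) S.+ FS.pairing (D f) x
    D-pairing f x = S.trans (D-∑ _) (S.trans (ΣS.∑-cong λ k → D-* _ _) (ΣS.∑-+ _ _))

    D-br-δ : ∀ x b k → euler (br x (ΣS.δ b) k) S.≈ br (D x) (ΣS.δ b) k
    D-br-δ x b k = S.trans (D-bracket S euler-isDerivation x (ΣS.δ b) k)
      (S.trans (S.+-congʳ {br (D x) (ΣS.δ b) k} (LS.br-0ʳ x (D-δ b) k)) (S.+-identityˡ _))

  module _ (f : DS.Vect d) (u : S.Carrier) (unit : DS.det (LS.form f) S.* u S.≈ S.1#)
           {F : DS.Vect d} (principal : LS.Represents f F f) where
    open import Relation.Binary.Reasoning.Setoid S.setoid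

    private
      Z : DS.Vect d
      Z = u FS.⊙ DS.cramer (LS.form f) (D f)

      Z-represents : LS.Represents f Z (D f)
      Z-represents = LS.solution f u unit (D f)

    -- Both sides represent the functional D f - f([Z, [F, -]]): the left one by differentiating
    -- f([F, e_b]) = f(e_b), the right one by the Jacobi identity. Nondegeneracy identifies them.
    D-principal : D F FS.≃ br F Z
    D-principal = LS.represents-unique f u unit {D F} {br F Z} lhs rhs
      where
      g : DS.Vect d
      g b = D f b S.- FS.pairing f (br Z (br F (ΣS.δ b)))
      lhs : LS.Represents f (D F) g
      lhs b = begin
        FS.pairing f (br (D F) (ΣS.δ b))
          ≈⟨ FS.pairing-cong {f = f} (λ _ → S.refl) (D-br-δ F b) ⟨
        FS.pairing f (D (br F (ΣS.δ b)))
          ≈⟨ IS.solve 2 (λ x y → x IS.:= (x IS.:+ y) IS.:- y) S.refl (FS.pairing f (D (br F (ΣS.δ b)))) (FS.pairing (D f) (br F (ΣS.δ b))) ⟩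
        FS.pairing f (D (br F (ΣS.δ b))) S.+ FS.pairing (D f) (br F (ΣS.δ b)) S.- FS.pairing (D f) (br F (ΣS.δ b))
          ≈⟨ S.+-cong (S.trans (S.sym (D-pairing f (br F (ΣS.δ b)))) (D-cong (principal b)))
               (S.-‿cong (S.sym (LS.represents-pairing f {Z} {D f} Z-represents (br F (ΣS.δ b))))) ⟩
        g b ∎
      rhs : LS.Represents f (br F Z) g
      rhs b = begin
        FS.pairing f (br (br F Z) (ΣS.δ b))
          ≈⟨ FS.pairing-cong {f = f} (λ _ → S.refl) (FS.IsLieBracket.jacobi (isLie S) F Z (ΣS.δ b)) ⟩
        FS.pairing f (λ k → br F (br Z (ΣS.δ b)) k S.- br Z (br F (ΣS.δ b)) k)
          ≈⟨ FS.pairing-- f _ _ ⟩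
        FS.pairing f (br F (br Z (ΣS.δ b))) S.- FS.pairing f (br Z (br F (ΣS.δ b)))
          ≈⟨ S.+-congʳ (S.trans (LS.represents-pairing f {F} {f} principal (br Z (ΣS.δ b))) (Z-represents b)) ⟩
        g b ∎

    -- D (t - ad F) = - ad [F, Z] = [t - ad F, ad Z], which is the hypothesis of `D-det≈0` with W =
    -- ad Z.
    D-charDet≈0 : ∀ t → euler t S.≈ S.0# → euler (DS.det (LS.charMatrix t F)) S.≈ S.0#
    D-charDet≈0 t Dt≈0 = Derivation.D-det≈0 S euler-isDerivation (LS.charMatrix t F) (LS.ad Z) λ i j → begin
      euler (t S.* ΣS.δ i j S.- LS.ad F i j)
        ≈⟨ D-- (t S.* ΣS.δ i j) (LS.ad F i j) ⟩
      euler (t S.* ΣS.δ i j) S.- euler (LS.ad F i j)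
        ≈⟨ S.+-cong (S.trans (D-* t (ΣS.δ i j)) (S.trans (S.+-cong (S.*-congˡ {t} (D-δ i j)) (S.*-congʳ {ΣS.δ i j} Dt≈0))
             (S.trans (S.+-cong (S.zeroʳ t) (S.zeroˡ (ΣS.δ i j))) (S.+-identityˡ S.0#))))
             (S.-‿cong (S.trans (D-br-δ F j i) (S.trans (FS.IsLieBracket.br-cong (isLie S) D-principal (λ _ → S.refl) i)
               (LS.ad-br F Z i j)))) ⟩
      S.0# S.- ((LS.ad F DS.⊡ LS.ad Z) i j S.- (LS.ad Z DS.⊡ LS.ad F) i j)
        ≈⟨ IS.solve 3 (λ p q z → IS.con (+ 0) IS.:- (p IS.:- q) IS.:= (z IS.:- p) IS.:- (z IS.:- q)) S.refl
             ((LS.ad F DS.⊡ LS.ad Z) i j) ((LS.ad Z DS.⊡ LS.ad F) i j) (t S.* LS.ad Z i j) ⟩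
      (t S.* LS.ad Z i j S.- (LS.ad F DS.⊡ LS.ad Z) i j) S.- (t S.* LS.ad Z i j S.- (LS.ad Z DS.⊡ LS.ad F) i j)
        ≈⟨ S.+-cong (left i j) (S.-‿cong (right i j)) ⟨
      (LS.charMatrix t F DS.⊡ LS.ad Z) i j S.- (LS.ad Z DS.⊡ LS.charMatrix t F) i j ∎
      where
      left : ∀ i j → (LS.charMatrix t F DS.⊡ LS.ad Z) i j S.≈ t S.* LS.ad Z i j S.- (LS.ad F DS.⊡ LS.ad Z) i j
      left i j = begin
        ΣS.∑ (λ l → (t S.* ΣS.δ i l S.- LS.ad F i l) S.* LS.ad Z l j)
          ≈⟨ ΣS.∑-cong (λ l → IS.solve 4 (λ t δ a z → (t IS.:* δ IS.:- a) IS.:* z IS.:= t IS.:* (δ IS.:* z) IS.:- a IS.:* z)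
               S.refl t (ΣS.δ i l) (LS.ad F i l) (LS.ad Z l j)) ⟩
        ΣS.∑ (λ l → t S.* (ΣS.δ i l S.* LS.ad Z l j) S.- LS.ad F i l S.* LS.ad Z l j)
          ≈⟨ ΣS.∑-- _ _ ⟩
        ΣS.∑ (λ l → t S.* (ΣS.δ i l S.* LS.ad Z l j)) S.- (LS.ad F DS.⊡ LS.ad Z) i j
          ≈⟨ S.+-congʳ (S.trans (S.sym (ΣS.*-∑ t _)) (S.*-congˡ {t} (ΣS.∑-δ i (λ l → LS.ad Z l j)))) ⟩
        t S.* LS.ad Z i j S.- (LS.ad F DS.⊡ LS.ad Z) i j ∎
      right : ∀ i j → (LS.ad Z DS.⊡ LS.charMatrix t F) i j S.≈ t S.* LS.ad Z i j S.- (LS.ad Z DS.⊡ LS.ad F) i j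
      right i j = begin
        ΣS.∑ (λ l → LS.ad Z i l S.* (t S.* ΣS.δ l j S.- LS.ad F l j))
          ≈⟨ ΣS.∑-cong (λ l → IS.solve 4 (λ t δ a z → z IS.:* (t IS.:* δ IS.:- a) IS.:= t IS.:* (z IS.:* δ) IS.:- z IS.:* a)
               S.refl t (ΣS.δ l j) (LS.ad F l j) (LS.ad Z i l)) ⟩
        ΣS.∑ (λ l → t S.* (LS.ad Z i l S.* ΣS.δ l j) S.- LS.ad Z i l S.* LS.ad F l j)
          ≈⟨ ΣS.∑-- _ _ ⟩
        ΣS.∑ (λ l → t S.* (LS.ad Z i l S.* ΣS.δ l j)) S.- (LS.ad Z DS.⊡ LS.ad F) i j
          ≈⟨ S.+-congʳ (S.trans (S.sym (ΣS.*-∑ t _)) (S.*-congˡ {t}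
               (S.sym (FS.linear-δ (λ x → x j) (λ p → p j) (λ a x y → S.refl) (LS.ad Z i))))) ⟩
        t S.* LS.ad Z i j S.- (LS.ad Z DS.⊡ LS.ad F) i j ∎

  module _ {f₀ f₁ F₀ F₁ : Vect d} {u₀ u₁ : Carrier}
           (unit₀ : det (form f₀) * u₀ ≈ 1#) (unit₁ : det (form f₁) * u₁ ≈ 1#)
           (principal₀ : Represents f₀ F₀ f₀) (principal₁ : Represents f₁ F₁ f₁)
           (torsionFree : ∀ n x → nat (suc n) * x ≈ 0# → x ≈ 0#) where

    private
      fₛ : DS.Vect d
      fₛ k n = const (f₀ k) n + shift (const (f₁ k - f₀ k)) n

      fₛ-0 : ∀ k → fₛ k 0 ≈ f₀ k
      fₛ-0 k = +-identityʳ _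

      fₛ-1 : ∀ k → fₛ k ↝ f₁ k
      fₛ-1 k = ↝-resp (λ _ → refl) (solve 2 (λ a b → a :+ (b :- a) := b) refl (f₀ k) (f₁ k))
        (↝-+ (↝-const (f₀ k)) (↝-shift (↝-const (f₁ k - f₀ k))))

      module At0 where
        open RelatedSums constantTerm public
        open RelatedBrackets constantTerm public
        open RingRelation constantTerm public
      module At1 where
        open RelatedSums evaluation public
        open RelatedBrackets evaluation public
        open RingRelation evaluation public

      δₛ vₛ : S.Carrier
      δₛ = DS.det (LS.form fₛ)
      -- The determinant of the form is invertible as a series because its constant term, the
      -- determinant at `f₀`, is a unit.
      vₛ = inverse δₛ u₀

      δₛ-0 : δₛ 0 ≈ det (form f₀)
      δₛ-0 = At0.~-det λ i j → At0.~-pairing {f = fₛ} fₛ-0 (~-bracket constantTerm (At0.~-δ j) (At0.~-δ i))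

      form-1 : ∀ i j → LS.form fₛ i j ↝ form f₁ i j
      form-1 i j = At1.~-pairing fₛ-1 (~-bracket evaluation (At1.~-δ j) (At1.~-δ i))

      δₛ-1 : δₛ ↝ det (form f₁)
      δₛ-1 = At1.~-det form-1

      δₛ-unit : δₛ S.* vₛ S.≈ S.1#
      δₛ-unit = *ₛ-inverse δₛ u₀ (trans (*-congʳ δₛ-0) unit₀)

      X Fₛ : DS.Vect d
      -- The numerator of the principal element: unlike `Fₛ` it is polynomial in s and can be
      -- evaluated at 1, where it becomes det (form f₁) times `F₁`.
      X  = DS.cramer (LS.form fₛ) fₛ
      Fₛ = vₛ FS.⊙ X

      Fₛ-principal : LS.Represents fₛ Fₛ fₛ
      Fₛ-principal = LS.solution fₛ vₛ δₛ-unit fₛ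

      Fₛ-0 : ∀ k → Fₛ k 0 ≈ F₀ k
      Fₛ-0 = represents-unique f₀ u₀ unit₀
        (λ b → trans (sym (At0.~-pairing {f = fₛ} fₛ-0 (~-bracket constantTerm {x = Fₛ} (λ k → refl) (At0.~-δ b))))
                     (trans (Fₛ-principal b 0) (fₛ-0 b)))
        principal₀

      X-1 : ∀ k → X k ↝ det (form f₁) * F₁ k
      X-1 k = ↝-resp (λ _ → refl)
        (represents-unique f₁ u₁ unit₁ (cramer-represents f₁ f₁) (represents-⊙ f₁ (det (form f₁)) principal₁) k)
        (At1.~-cramer form-1 fₛ-1 k)

    -- The polynomial det (t δₛ - ad X) equals δₛ^d det (t - ad Fₛ), so it has two values at 1: one
    -- computed from its entries, the other from the constancy of the second factor. They agree by
    -- `↝-unique`, and det (form f₁)^d cancels since it is a unit.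
    det-charMatrix-constant : ∀ t → det (charMatrix t F₁) ≈ det (charMatrix t F₀)
    det-charMatrix-constant t = begin
      det (charMatrix t F₁)                      ≈⟨ cancel (det (charMatrix t F₁)) ⟨
      u₁ ^ d * (det (form f₁) ^ d * det (charMatrix t F₁))  ≈⟨ *-congˡ (↝-unique scaled-1 scaled-const) ⟩
      u₁ ^ d * (det (form f₁) ^ d * det (charMatrix t F₀))  ≈⟨ cancel (det (charMatrix t F₀)) ⟩
      det (charMatrix t F₀)                      ∎
      where
      open import Relation.Binary.Reasoning.Setoid setoid
      open import Algebra.Properties.CommutativeSemiring.Exp commutativeSemiring using (^-distrib-*; ^-congˡ)
      cₛ : S.Carrier
      cₛ = DS.det (LS.charMatrix (const t) Fₛ)
      Dt≈0 : euler (const t) S.≈ S.0#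
      Dt≈0 zero    = zeroˡ t
      Dt≈0 (suc n) = zeroʳ _
      cₛ-constant : cₛ S.≈ const (det (charMatrix t F₀))
      cₛ-constant zero = At0.~-det {A = LS.charMatrix (const t) Fₛ} λ i j → +-cong
        (*-congˡ (At0.~-δ i j)) (-‿cong (~-bracket constantTerm {x = Fₛ} Fₛ-0 (At0.~-δ j) i))
      cₛ-constant (suc n) =
        euler≈0⇒const torsionFree cₛ (D-charDet≈0 fₛ vₛ δₛ-unit Fₛ-principal (const t) Dt≈0) (suc n)
      scaled-const : δₛ ^ₛ d S.* cₛ ↝ det (form f₁) ^ d * det (charMatrix t F₀)
      scaled-const = ↝-resp (S.*-congˡ {δₛ ^ₛ d} (S.sym cₛ-constant)) refl (↝-* (At1.~-^ d δₛ-1) (↝-const _))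
      ad-X : ∀ i j → LS.ad X i j S.≈ δₛ S.* LS.ad Fₛ i j
      ad-X i j = S.trans (FS.IsLieBracket.br-cong (isLie S) X≃δF (λ _ → S.refl) i) (LS.br-⊙ˡ δₛ Fₛ (ΣS.δ j) i)
        where
        X≃δF : X FS.≃ (δₛ FS.⊙ Fₛ)
        X≃δF k = S.trans (S.sym (S.*-identityˡ (X k))) (S.trans (S.*-congʳ {X k} (S.sym δₛ-unit)) (S.*-assoc δₛ vₛ (X k)))
      scaled-1 : δₛ ^ₛ d S.* cₛ ↝ det (form f₁) ^ d * det (charMatrix t F₁)
      scaled-1 = ↝-resp
        (S.trans (DS.det-cong {A = λ i j → const t S.* δₛ S.* ΣS.δ i j S.- LS.ad X i j} λ i j →
            S.trans (S.+-congˡ {const t S.* δₛ S.* ΣS.δ i j} (S.-‿cong (ad-X i j)))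
              (IS.solve 4 (λ t u e a → t IS.:* u IS.:* e IS.:- u IS.:* a IS.:= u IS.:* (t IS.:* e IS.:- a)) S.refl
                (const t) δₛ (ΣS.δ i j) (LS.ad Fₛ i j)))
          (DS.det-scale δₛ (LS.charMatrix (const t) Fₛ)))
        (trans (det-cong λ i j → trans
            (+-congˡ (-‿cong (br-⊙ˡ (det (form f₁)) F₁ (δ j) i)))
            (solve 4 (λ t u e a → t :* u :* e :- u :* a := u :* (t :* e :- a)) refl t (det (form f₁)) (δ i j) (ad F₁ i j)))
          (det-scale (det (form f₁)) (charMatrix t F₁)))
        (At1.~-det λ i j → At1.~-+ (At1.~-* (At1.~-* (↝-const t) δₛ-1) (At1.~-δ i j))
          (At1.~-neg (~-bracket evaluation X-1 (At1.~-δ j) i)))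
      cancel : ∀ x → u₁ ^ d * (det (form f₁) ^ d * x) ≈ x
      cancel x = trans (sym (*-assoc _ _ _)) (trans (*-congʳ (trans (sym (^-distrib-* u₁ (det (form f₁)) d))
        (trans (^-congˡ d (trans (*-comm _ _) unit₁)) (1^ d)))) (*-identityˡ x))
        where
        1^ : ∀ n → 1# ^ n ≈ 1#
        1^ zero    = refl
        1^ (suc n) = trans (*-identityˡ _) (1^ n)

-- Labels of the basis and sums over them.

lookup-injective : ∀ {A : Set} {xs : List A} → Unique xs → ∀ {i j} → lookup xs i ≡ lookup xs j → i ≡ j
lookup-injective (x∉xs ∷ u) {zero}  {zero}  eq = ≡.refl
lookup-injective (x∉xs ∷ u) {zero}  {suc j} eq = ⊥-elim (All.lookup x∉xs (∈-lookup j) eq)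
lookup-injective (x∉xs ∷ u) {suc i} {zero}  eq = ⊥-elim (All.lookup x∉xs (∈-lookup i) (≡.sym eq))
lookup-injective (x∉xs ∷ u) {suc i} {suc j} eq = ≡.cong suc (lookup-injective u eq)

module Labels (m : ℕ) where
  N : ℕ
  N = sizeN m

  isOff : Fin N → Fin N → Bool
  isOff i j = not (toℕ i ℕ.≡ᵇ toℕ j) ∧ allowedᵇ m i j

  isCart : Fin N → Bool
  isCart i = not (toℕ i ℕ.≡ᵇ 0)

  offs : Fin N → List (Label N)
  offs i = map (off i) (filterᵇ (isOff i) (allFin N))

  row col : Label N → Fin N
  row (off i j) = i
  row (cart i)  = i
  col (off i j) = j
  col (cart i)  = i

  Valid : Label N → Set
  Valid (off i j) = T (isOff i j)
  Valid (cart i)  = T (isCart i)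

  valid : ∀ a → Valid (labelAt m a)
  valid a = All.lookup all (∈-lookup a)
    where
    all : All Valid (labels m)
    all = AllP.++⁺
      (AllP.concat⁺ (AllP.map⁺ (All.universal
        (λ i → AllP.map⁺ (AllP.all-filter (T? ∘ isOff i) (allFin N))) (allFin N))))
      (AllP.map⁺ (AllP.all-filter (T? ∘ isCart) (allFin N)))

  -- Makes different indices carry different labels, so that coordinates and basis matrices are dual
  -- to each other in `coords-mat`.
  labelAt-injective : ∀ {a b} → labelAt m a ≡ labelAt m b → a ≡ b
  labelAt-injective = lookup-injective (UniqueP.++⁺
    (UniqueP.concat⁺
      (AllP.map⁺ (All.universal (λ i → UniqueP.map⁺ (λ { ≡.refl → ≡.refl })
        (UniqueP.filter⁺ (T? ∘ isOff i) (UniqueP.allFin⁺ N))) (allFin N)))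
      (AllPairsP.map⁺ (AllPairs.map disjoint (UniqueP.allFin⁺ N))))
    (UniqueP.map⁺ (λ { ≡.refl → ≡.refl }) (UniqueP.filter⁺ (T? ∘ isCart) (UniqueP.allFin⁺ N)))
    λ { (p , q) → different p q })
    where
    disjoint : ∀ {i j} → i ≢ j → ∀ {l} → ¬ (l ∈ offs i × l ∈ offs j)
    disjoint i≢j (p , q) with ∈-map⁻ _ p | ∈-map⁻ _ q
    ... | _ , _ , ≡.refl | _ , _ , ≡.refl = i≢j ≡.refl
    different : ∀ {l} → l ∈ concatMap offs (allFin N) → ¬ (l ∈ map cart (filterᵇ isCart (allFin N)))
    different {cart i}  p q = All.lookup noCart p i ≡.refl
      where
      noCart : All (λ l → ∀ i → l ≢ cart i) (concatMap offs (allFin N))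
      noCart = AllP.concat⁺ (AllP.map⁺ (All.universal
        (λ i → AllP.map⁺ (All.universal (λ j k ()) _)) (allFin N)))
    different {off i j} p q with ∈-map⁻ _ q
    ... | _ , _ , ()

module ListSum {c ℓ : Level} (M : CommutativeMonoid c ℓ) where
  open CommutativeMonoid M
  open import Algebra.Properties.Monoid.Sum monoid using (sum; sum-cong-≋)
  open import Algebra.Properties.CommutativeSemigroup commutativeSemigroup using (x∙yz≈y∙xz)

  -- Stated for any commutative monoid because three are used: addition for expansions over the
  -- basis, multiplication for characteristic polynomials, and lists up to permutation for multisets
  -- of weights.
  listSum : ∀ {a} {A : Set a} → (A → Carrier) → List A → Carrier
  listSum f = List.foldr (λ x s → f x ∙ s) ε

  module _ {a} {A : Set a} (f : A → Carrier) where
    sum-lookup : ∀ xs → sum (f ∘ lookup xs) ≈ listSum f xs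
    sum-lookup []       = refl
    sum-lookup (x ∷ xs) = ∙-congˡ (sum-lookup xs)

    listSum-cong : ∀ {g : A → Carrier} → (∀ x → f x ≈ g x) → ∀ xs → listSum f xs ≈ listSum g xs
    listSum-cong f≈g []       = refl
    listSum-cong f≈g (x ∷ xs) = ∙-cong (f≈g x) (listSum-cong f≈g xs)

    listSum-++ : ∀ xs ys → listSum f (xs ++ ys) ≈ listSum f xs ∙ listSum f ys
    listSum-++ []       ys = sym (identityˡ _)
    listSum-++ (x ∷ xs) ys = trans (∙-congˡ (listSum-++ xs ys)) (sym (assoc _ _ _))

    listSum-tabulate : ∀ {n} (g : Fin n → A) → listSum f (tabulate g) ≈ sum (f ∘ g)
    listSum-tabulate {zero}  g = refl
    listSum-tabulate {suc n} g = ∙-congˡ (listSum-tabulate (g ∘ suc))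

    listSum-filter : ∀ p xs → listSum f (filterᵇ p xs) ≈ listSum (λ x → if p x then f x else ε) xs
    listSum-filter p []       = refl
    listSum-filter p (x ∷ xs) with p x
    ... | true  = ∙-congˡ (listSum-filter p xs)
    ... | false = trans (listSum-filter p xs) (sym (identityˡ _))

    module _ {b} {B : Set b} where
      listSum-map : ∀ (g : B → A) xs → listSum f (map g xs) ≈ listSum (f ∘ g) xs
      listSum-map g []       = refl
      listSum-map g (x ∷ xs) = ∙-congˡ (listSum-map g xs)

      listSum-concatMap : ∀ (g : B → List A) xs → listSum f (concatMap g xs) ≈ listSum (listSum f ∘ g) xs
      listSum-concatMap g []       = refl
      listSum-concatMap g (x ∷ xs) = trans (listSum-++ (g x) _) (∙-congˡ (listSum-concatMap g xs))

  listSum-↭ : ∀ {a} {A : Set a} (f : A → Carrier) {xs ys} → xs ↭ ys → listSum f xs ≈ listSum f ys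
  listSum-↭ f Perm.refl         = refl
  listSum-↭ f (Perm.prep x p)   = ∙-congˡ (listSum-↭ f p)
  listSum-↭ f (Perm.swap x y p) = trans (∙-congˡ (∙-congˡ (listSum-↭ f p))) (x∙yz≈y∙xz _ _ _)
  listSum-↭ f (Perm.trans p q)  = trans (listSum-↭ f p) (listSum-↭ f q)

  module _ (m : ℕ) (f : Label (sizeN m) → Carrier) where
    open Labels m
    open import Relation.Binary.Reasoning.Setoid setoid

    sum-labels : sum (f ∘ labelAt m) ≈
      sum (λ i → sum (λ j → if isOff i j then f (off i j) else ε)) ∙ sum (λ i → if isCart i then f (cart i) else ε)
    sum-labels = begin
      sum (f ∘ labelAt m)
        ≈⟨ sum-lookup f (labels m) ⟩
      listSum f (labels m)
        ≈⟨ listSum-++ f (concatMap offs (allFin N)) _ ⟩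
      listSum f (concatMap offs (allFin N)) ∙ listSum f (map cart (filterᵇ isCart (allFin N)))
        ≈⟨ ∙-cong (listSum-concatMap f offs (allFin N)) (listSum-map f cart (filterᵇ isCart (allFin N))) ⟩
      listSum (listSum f ∘ offs) (allFin N) ∙ listSum (f ∘ cart) (filterᵇ isCart (allFin N))
        ≈⟨ ∙-cong (listSum-tabulate (listSum f ∘ offs) {N} id) (filtered (f ∘ cart) isCart) ⟩
      sum (listSum f ∘ offs) ∙ sum (λ i → if isCart i then f (cart i) else ε)
        ≈⟨ ∙-congʳ (sum-cong-≋ λ i → trans (listSum-map f (off i) (filterᵇ (isOff i) (allFin N)))
             (filtered (f ∘ off i) (isOff i))) ⟩
      sum (λ i → sum (λ j → if isOff i j then f (off i j) else ε)) ∙ sum (λ i → if isCart i then f (cart i) else ε) ∎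
      where
      filtered : ∀ (g : Fin N → Carrier) p →
        listSum g (filterᵇ p (allFin N)) ≈ sum (λ i → if p i then g i else ε)
      filtered g p = trans (listSum-filter g p (allFin N)) (listSum-tabulate (λ i → if p i then g i else ε) {N} id)

≡ᵇ-refl : ∀ a → (a ℕ.≡ᵇ a) ≡ true
≡ᵇ-refl zero    = ≡.refl
≡ᵇ-refl (suc a) = ≡ᵇ-refl a

≡ᵇ-sound : ∀ {a b} → (a ℕ.≡ᵇ b) ≡ true → a ≡ b
≡ᵇ-sound {a} {b} eq = ℕP.≡ᵇ⇒≡ a b (≡.subst T (≡.sym eq) tt)

≢⇒≡ᵇ-false : ∀ {a b} → a ≢ b → (a ℕ.≡ᵇ b) ≡ false
≢⇒≡ᵇ-false {a} {b} a≢b with a ℕ.≡ᵇ b in eq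
... | true  = ⊥-elim (a≢b (≡ᵇ-sound eq))
... | false = ≡.refl

-- The seaweed as a module with integral basis over any commutative ring.

module Seaweed {c ℓ : Level} (m : ℕ) (R : CommutativeRing c ℓ) where
  open CommutativeRing R hiding (zero)
  open Sums R
  open Determinant R
  open FrobeniusForm R
  open Labels m
  open import Algebra.Properties.Ring ring
  open import Relation.Binary.Reasoning.Setoid setoid

  d : ℕ
  d = dimG m

  Square : Set c
  Square = Mat′ N N

  trace : Square → Carrier
  trace X = ∑[ i ] X i i

  Member : Square → Set ℓ
  Member X = trace X ≈ 0# × (∀ i j → allowedᵇ m i j ≡ false → X i j ≈ 0#)

  unit : ℕ → ℕ → Square
  unit r s i j = if (toℕ i ℕ.≡ᵇ r) ∧ (toℕ j ℕ.≡ᵇ s) then 1# else 0#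

  basis : Label N → Square
  basis (off i j) = unit (toℕ i) (toℕ j)
  basis (cart i)  = λ p q → unit (toℕ i) (toℕ i) p q - unit 0 0 p q

  coords : Square → Vect d
  coords X a = X (row (labelAt m a)) (col (labelAt m a))

  mat : Vect d → Square
  mat x i j = ∑[ a ] (x a * basis (labelAt m a) i j)

  comm : Square → Square → Square
  comm X Y i j = (X ⊡ Y) i j - (Y ⊡ X) i j

  -- Defined through matrices, so that the Lie identities come from matrix algebra; in the given
  -- basis it involves only integers that are the same for every ring.
  bracket : Vect d → Vect d → Vect d
  bracket x y = coords (comm (mat x) (mat y))

  unit-1 : ∀ i j → unit (toℕ i) (toℕ j) i j ≡ 1#
  unit-1 i j rewrite ≡ᵇ-refl (toℕ i) | ≡ᵇ-refl (toℕ j) = ≡.refl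

  unit-row : ∀ {i p} r q → toℕ p ≢ i → unit i r p q ≡ 0#
  unit-row r q p≢i rewrite ≢⇒≡ᵇ-false p≢i = ≡.refl

  unit-col : ∀ {i p} r q → toℕ p ≢ i → unit r i q p ≡ 0#
  unit-col {i} {p} r q p≢i rewrite ≢⇒≡ᵇ-false p≢i with toℕ q ℕ.≡ᵇ r
  ... | true  = ≡.refl
  ... | false = ≡.refl

  unit-off : ∀ r {p q} → p ≢ q → unit r r p q ≡ 0#
  unit-off r {p} {q} p≢q with toℕ p ℕ.≡ᵇ r in eq₁ | toℕ q ℕ.≡ᵇ r in eq₂
  ... | false | _     = ≡.refl
  ... | true  | false = ≡.refl
  ... | true  | true  = ⊥-elim (p≢q (Finₚ.toℕ-injective (≡.trans (≡ᵇ-sound eq₁) (≡.sym (≡ᵇ-sound eq₂)))))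

  unit-diag : ∀ {i j} → i ≢ j → ∀ p → unit (toℕ i) (toℕ j) p p ≡ 0#
  unit-diag {i} {j} i≢j p with p Fin.≟ i
  ... | no  p≢i    = unit-row _ p (p≢i ∘ Finₚ.toℕ-injective)
  ... | yes ≡.refl = unit-col {p = p} _ p (i≢j ∘ Finₚ.toℕ-injective)

  isOff⇒≢ : ∀ {i j} → T (isOff i j) → i ≢ j
  isOff⇒≢ {i} v ≡.refl rewrite ≡ᵇ-refl (toℕ i) = v

  isOff⇒allowed : ∀ {i j} → T (isOff i j) → allowedᵇ m i j ≢ false
  isOff⇒allowed {i} {j} v eq rewrite eq with toℕ i ℕ.≡ᵇ toℕ j
  ... | true  = v
  ... | false = v

  isCart⇒≢0 : ∀ {i} → T (isCart i) → 0 ≢ toℕ i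
  isCart⇒≢0 {i} v 0≡i rewrite ≡.sym 0≡i = v

  ∑-labels : ∀ (f : Label N → Carrier) → ∑ (f ∘ labelAt m) ≈
    ∑[ i ] ∑[ j ] (if isOff i j then f (off i j) else 0#) + ∑[ i ] (if isCart i then f (cart i) else 0#)
  ∑-labels f = begin
    ∑ (f ∘ labelAt m)
      ≡⟨ ∑≡sum _ ⟩
    LS.sum (f ∘ labelAt m)
      ≈⟨ LS.sum-labels m f ⟩
    LS.sum (λ i → LS.sum (λ j → if isOff i j then f (off i j) else 0#)) + LS.sum (λ i → if isCart i then f (cart i) else 0#)
      ≡⟨ ≡.cong₂ _+_ (≡.trans (∑≡sum (λ i → ∑ (offTerm i))) (LS.sum-cong-≗ {N} {λ i → ∑ (offTerm i)} λ i → ∑≡sum (offTerm i)))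
           (∑≡sum (λ i → if isCart i then f (cart i) else 0#)) ⟨
    ∑[ i ] ∑[ j ] (if isOff i j then f (off i j) else 0#) + ∑[ i ] (if isCart i then f (cart i) else 0#) ∎
    where
    offTerm : Fin N → Fin N → Carrier
    offTerm i j = if isOff i j then f (off i j) else 0#
    module LS where
      open ListSum +-commutativeMonoid public
      open import Algebra.Properties.Monoid.Sum +-monoid public using (sum; sum-cong-≗)

  -- An off-diagonal entry comes from its own unit matrix alone, and a diagonal entry other than the
  -- first from its own Cartan element. The first diagonal entry collects minus all the others,
  -- which is correct because the trace is zero.
  mat-coords : ∀ {X} → Member X → mat (coords X) ≋ X
  mat-coords {X} (trace≈0 , zeros) p q = begin
    mat (coords X) p q
      ≈⟨ ∑-labels (λ l → X (row l) (col l) * basis l p q) ⟩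
    ∑[ i ] ∑[ j ] (if isOff i j then X i j * unit (toℕ i) (toℕ j) p q else 0#) + ∑ cartTerm
      ≈⟨ +-congʳ (trans (∑-single _ p λ i p≢i → ∑-0 λ j → vanish i j (inj₁ p≢i)) (∑-single _ q λ j q≢j → vanish p j (inj₂ q≢j))) ⟩
    (if isOff p q then X p q * unit (toℕ p) (toℕ q) p q else 0#) + ∑ cartTerm
      ≈⟨ result (p Fin.≟ q) ⟩
    X p q ∎
    where
    cartTerm : Fin N → Carrier
    cartTerm i = if isCart i then X i i * (unit (toℕ i) (toℕ i) p q - unit 0 0 p q) else 0#
    vanish : ∀ i j → p ≢ i ⊎ q ≢ j → (if isOff i j then X i j * unit (toℕ i) (toℕ j) p q else 0#) ≈ 0#
    vanish i j ne with isOff i j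
    ... | false = refl
    ... | true  = trans (*-congˡ (reflexive (zero-unit ne))) (zeroʳ _)
      where
      zero-unit : p ≢ i ⊎ q ≢ j → unit (toℕ i) (toℕ j) p q ≡ 0#
      zero-unit (inj₁ p≢i) = unit-row _ q (p≢i ∘ Finₚ.toℕ-injective)
      zero-unit (inj₂ q≢j) = unit-col {p = q} _ p (q≢j ∘ Finₚ.toℕ-injective)
    diagonal : p ≡ q → ∑ cartTerm ≈ X p q
    diagonal ≡.refl with toℕ p ℕ.≡ᵇ 0 in eq
    ... | false = trans (∑-cong term) (∑-δ p (λ i → X i i))
      where
      term : ∀ i → (if isCart i then X i i * (unit (toℕ i) (toℕ i) p p - 0#) else 0#) ≈ δ p i * X i i
      term i with p Fin.≟ i
      ... | yes ≡.refl rewrite eq | unit-1 p p =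
        trans (*-congˡ (trans (+-congˡ -0#≈0#) (+-identityʳ 1#))) (*-comm _ _)
      ... | no p≢i rewrite unit-row (toℕ i) p (p≢i ∘ Finₚ.toℕ-injective) with isCart i
      ...   | true  = trans (*-congˡ (-‿inverseʳ 0#)) (trans (zeroʳ _) (sym (zeroˡ _)))
      ...   | false = sym (zeroˡ _)
    -- At the origin every Cartan element contributes minus its coordinate. The absent index 0 is
    -- put in as X₀₀ - X₀₀, and the sum becomes X₀₀ minus the trace.
    ... | true  = begin
      ∑ (λ i → if isCart i then X i i * (unit (toℕ i) (toℕ i) p p - 1#) else 0#)
                                          ≈⟨ ∑-cong term ⟩
      ∑[ i ] (δ p i * X i i - X i i)      ≈⟨ ∑-- _ _ ⟩
      ∑[ i ] (δ p i * X i i) - trace X    ≈⟨ +-cong (∑-δ p (λ i → X i i)) (-‿cong trace≈0) ⟩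
      X p p - 0#                          ≈⟨ trans (+-congˡ -0#≈0#) (+-identityʳ _) ⟩
      X p p                               ∎
      where
      term : ∀ i → (if isCart i then X i i * (unit (toℕ i) (toℕ i) p p - 1#) else 0#) ≈ δ p i * X i i - X i i
      term i with p Fin.≟ i
      ... | yes ≡.refl rewrite eq = trans (sym (-‿inverseʳ _)) (+-congʳ (sym (*-identityˡ _)))
      ... | no p≢i rewrite unit-row (toℕ i) p (p≢i ∘ Finₚ.toℕ-injective) with toℕ i ℕ.≡ᵇ 0 in eq′
      ...   | false = trans (*-congˡ (+-identityˡ _)) (trans (sym (-‿distribʳ-* _ _))
                        (trans (-‿cong (*-identityʳ _)) (trans (sym (+-identityˡ _)) (+-congʳ (sym (zeroˡ _))))))
      ...   | true  = ⊥-elim (p≢i (Finₚ.toℕ-injective (≡.trans (≡ᵇ-sound eq) (≡.sym (≡ᵇ-sound eq′)))))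
    result : Dec (p ≡ q) →
      (if isOff p q then X p q * unit (toℕ p) (toℕ q) p q else 0#) + ∑ cartTerm ≈ X p q
    result (yes p≡q) = trans (+-cong (off≈0 p≡q) (diagonal p≡q)) (+-identityˡ _)
      where
      off≈0 : p ≡ q → (if isOff p q then X p q * unit (toℕ p) (toℕ q) p q else 0#) ≈ 0#
      off≈0 ≡.refl rewrite ≡ᵇ-refl (toℕ p) = refl
    result (no p≢q) = trans (+-cong off≈X (∑-0 cart≈0)) (+-identityʳ _)
      where
      off≈X : (if isOff p q then X p q * unit (toℕ p) (toℕ q) p q else 0#) ≈ X p q
      off≈X rewrite ≢⇒≡ᵇ-false (p≢q ∘ Finₚ.toℕ-injective) | unit-1 p q with allowedᵇ m p q in eq
      ... | true  = *-identityʳ _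
      ... | false = sym (zeros p q eq)
      cart≈0 : ∀ i → cartTerm i ≈ 0#
      cart≈0 i rewrite unit-off (toℕ i) p≢q | unit-off 0 p≢q with isCart i
      ... | true  = trans (*-congˡ (-‿inverseʳ 0#)) (zeroʳ _)
      ... | false = refl

  coord-same : ∀ l → Valid l → basis l (row l) (col l) ≈ 1#
  coord-same (off i j) v = reflexive (unit-1 i j)
  coord-same (cart i)  v = begin
    unit (toℕ i) (toℕ i) i i - unit 0 0 i i
      ≈⟨ +-cong (reflexive (unit-1 i i)) (-‿cong (reflexive (unit-row {p = i} 0 i (isCart⇒≢0 {i} v ∘ ≡.sym)))) ⟩
    1# - 0#  ≈⟨ trans (+-congˡ -0#≈0#) (+-identityʳ 1#) ⟩
    1#       ∎

  -- For two Cartan labels this rests on the choice of coordinates: the entry at the origin, which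
  -- all Cartan elements share, is never read.
  coord-other : ∀ l l′ → Valid l → Valid l′ → l ≢ l′ → basis l′ (row l) (col l) ≈ 0#
  coord-other (off i j) (off p q) v w l≢l′ with i Fin.≟ p
  ... | no i≢p     = reflexive (unit-row _ j (i≢p ∘ Finₚ.toℕ-injective))
  ... | yes ≡.refl = reflexive (unit-col {p = j} _ i (λ j≡q → l≢l′ (≡.cong (off i) (Finₚ.toℕ-injective j≡q))))
  coord-other (off i j) (cart p)  v w l≢l′ = trans
    (+-cong (reflexive (unit-off (toℕ p) (isOff⇒≢ {i} {j} v))) (-‿cong (reflexive (unit-off 0 (isOff⇒≢ {i} {j} v))))) (-‿inverseʳ 0#)
  coord-other (cart i)  (off p q) v w l≢l′ = reflexive (unit-diag (isOff⇒≢ {p} {q} w) i)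
  coord-other (cart i)  (cart p)  v w l≢l′ = trans
    (+-cong (reflexive (unit-row _ i (l≢l′ ∘ ≡.cong cart ∘ Finₚ.toℕ-injective)))
            (-‿cong (reflexive (unit-row {p = i} 0 i (isCart⇒≢0 {i} v ∘ ≡.sym))))) (-‿inverseʳ 0#)

  coords-mat : ∀ x → coords (mat x) ≃ x
  coords-mat x b = trans
    (∑-single _ b λ a b≢a → trans (*-congˡ (coord-other (labelAt m b) (labelAt m a) (valid b) (valid a) (b≢a ∘ labelAt-injective))) (zeroʳ _))
    (trans (*-congˡ (coord-same (labelAt m b) (valid b))) (*-identityʳ _))

  trace-basis : ∀ l → Valid l → trace (basis l) ≈ 0#
  trace-basis (off i j) v = ∑-0 λ p → reflexive (unit-diag (isOff⇒≢ {i} {j} v) p)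
  trace-basis (cart i)  v = begin
    ∑[ p ] (unit (toℕ i) (toℕ i) p p - unit 0 0 p p)    ≈⟨ ∑-- _ _ ⟩
    trace (unit (toℕ i) (toℕ i)) - trace (unit 0 0)     ≈⟨ +-cong (trace-unit i) (-‿cong (first i)) ⟩
    1# - 1#                                             ≈⟨ -‿inverseʳ 1# ⟩
    0#                                                  ∎
    where
    trace-unit : ∀ i → trace (unit (toℕ i) (toℕ i)) ≈ 1#
    trace-unit i = trans (∑-single _ i λ p i≢p → reflexive (unit-row _ p (i≢p ∘ ≡.sym ∘ Finₚ.toℕ-injective))) (reflexive (unit-1 i i))
    origin : ∀ {n} → Fin n → Σ (Fin n) λ z → toℕ z ≡ 0
    origin {suc n} _ = zero , ≡.refl
    first : Fin N → trace (unit 0 0) ≈ 1#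
    first i with origin i
    ... | z , eq = ≡.subst (λ r → trace (unit r r) ≈ 1#) eq (trace-unit z)

  zeros-basis : ∀ l → Valid l → ∀ p q → allowedᵇ m p q ≡ false → basis l p q ≈ 0#
  zeros-basis (off i j) v p q forbidden with p Fin.≟ i | q Fin.≟ j
  ... | no p≢i     | _          = reflexive (unit-row _ q (p≢i ∘ Finₚ.toℕ-injective))
  ... | yes ≡.refl | no q≢j     = reflexive (unit-col {p = q} _ p (q≢j ∘ Finₚ.toℕ-injective))
  ... | yes ≡.refl | yes ≡.refl = ⊥-elim (isOff⇒allowed {i} {j} v forbidden)
  zeros-basis (cart i)  v p q forbidden = trans
    (+-cong (reflexive (unit-off (toℕ i) p≢q)) (-‿cong (reflexive (unit-off 0 p≢q)))) (-‿inverseʳ 0#)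
    where
    diag-allowed : ∀ a → not ((2 ℕ.* m ℕ.<ᵇ a) ∧ (a ℕ.<ᵇ 2 ℕ.* m ℕ.+ 1)) ≡ true
    diag-allowed a with 2 ℕ.* m ℕ.<ᵇ a in eq₁ | a ℕ.<ᵇ 2 ℕ.* m ℕ.+ 1 in eq₂
    ... | false | _     = ≡.refl
    ... | true  | false = ≡.refl
    ... | true  | true  = ⊥-elim (ℕP.<⇒≱ (ℕP.<ᵇ⇒< _ _ (≡.subst T (≡.sym eq₁) tt))
      (ℕP.m<1+n⇒m≤n (≡.subst (a ℕ.<_) (ℕP.+-comm _ 1) (ℕP.<ᵇ⇒< _ _ (≡.subst T (≡.sym eq₂) tt)))))
    true≢false : true ≢ false
    true≢false ()
    p≢q : p ≢ q
    p≢q ≡.refl = true≢false (≡.trans (≡.sym (diag-allowed (toℕ p))) forbidden)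

  mat-member : ∀ x → Member (mat x)
  mat-member x =
    trans (∑-swap _) (∑-0 λ a → trans (sym (*-∑ (x a) _)) (trans (*-congˡ (trace-basis (labelAt m a) (valid a))) (zeroʳ _))) ,
    λ p q forbidden → ∑-0 λ a → trans (*-congˡ (zeros-basis (labelAt m a) (valid a) p q forbidden)) (zeroʳ _)

  -- If the row lies beyond V₁ and the column within, each intermediate index lies on one of the two
  -- sides, so one of the factors is already a forbidden entry.
  ⊡-zeros : ∀ {X Y} → Member X → Member Y → ∀ p q → allowedᵇ m p q ≡ false → (X ⊡ Y) p q ≈ 0#
  ⊡-zeros {X} {Y} (_ , zX) (_ , zY) p q forbidden = ∑-0 λ l → either l (split (toℕ p) (toℕ q) (toℕ l) forbidden)
    where
    either : ∀ l → allowedᵇ m p l ≡ false ⊎ allowedᵇ m l q ≡ false → X p l * Y l q ≈ 0#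
    either l (inj₁ z) = trans (*-congʳ (zX p l z)) (zeroˡ _)
    either l (inj₂ z) = trans (*-congˡ (zY l q z)) (zeroʳ _)
    split : ∀ a b x → not ((2 ℕ.* m ℕ.<ᵇ a) ∧ (b ℕ.<ᵇ 2 ℕ.* m ℕ.+ 1)) ≡ false →
      not ((2 ℕ.* m ℕ.<ᵇ a) ∧ (x ℕ.<ᵇ 2 ℕ.* m ℕ.+ 1)) ≡ false ⊎ not ((2 ℕ.* m ℕ.<ᵇ x) ∧ (b ℕ.<ᵇ 2 ℕ.* m ℕ.+ 1)) ≡ false
    split a b x eq with 2 ℕ.* m ℕ.<ᵇ a | b ℕ.<ᵇ 2 ℕ.* m ℕ.+ 1 | x ℕ.<ᵇ 2 ℕ.* m ℕ.+ 1 in eq₁ | 2 ℕ.* m ℕ.<ᵇ x in eq₂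
    ... | true | true | true  | _     = inj₁ ≡.refl
    ... | true | true | false | true  = inj₂ ≡.refl
    ... | true | true | false | false = ⊥-elim (≡.subst T eq₁ (ℕP.<⇒<ᵇ (≡.subst (x ℕ.<_) (ℕP.+-comm 1 _)
      (ℕ.s≤s (ℕP.≮⇒≥ λ lt → ≡.subst T eq₂ (ℕP.<⇒<ᵇ lt))))))

  comm-member : ∀ {X Y} → Member X → Member Y → Member (comm X Y)
  comm-member {X} {Y} mX mY =
    trans (∑-- _ _) (trans (+-congˡ (-‿cong (trans (∑-swap _) (∑-cong λ i → ∑-cong λ j → *-comm _ _)))) (-‿inverseʳ _)) ,
    λ p q forbidden → trans (+-cong (⊡-zeros mX mY p q forbidden) (-‿cong (⊡-zeros mY mX p q forbidden))) (-‿inverseʳ 0#)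

-- Lie identities, derivations and ring relations for the seaweed.

module SeaweedBracket {c ℓ : Level} (m : ℕ) (R : CommutativeRing c ℓ) where
  open CommutativeRing R hiding (zero)
  open IntegerCoefficients R using (solve; _:=_; _:+_; _:*_; _:-_)
  open Sums R
  open Determinant R
  open FrobeniusForm R
  open Labels m
  open Seaweed m R
  open import Algebra.Properties.Ring ring
  open import Relation.Binary.Reasoning.Setoid setoid

  ⊡-cong : ∀ {X X′ Y Y′ : Square} → X ≋ X′ → Y ≋ Y′ → X ⊡ Y ≋ X′ ⊡ Y′
  ⊡-cong X≋X′ Y≋Y′ i j = ∑-cong λ l → *-cong (X≋X′ i l) (Y≋Y′ l j)

  comm-cong : ∀ {X X′ Y Y′ : Square} → X ≋ X′ → Y ≋ Y′ → comm X Y ≋ comm X′ Y′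
  comm-cong X≋X′ Y≋Y′ i j = +-cong (⊡-cong X≋X′ Y≋Y′ i j) (-‿cong (⊡-cong Y≋Y′ X≋X′ i j))

  ⊡-linearˡ : ∀ a (X Y Z : Square) i j → ((λ p q → a * X p q + Y p q) ⊡ Z) i j ≈ a * (X ⊡ Z) i j + (Y ⊡ Z) i j
  ⊡-linearˡ a X Y Z i j = begin
    ∑[ l ] ((a * X i l + Y i l) * Z l j)
      ≈⟨ ∑-cong (λ l → solve 4 (λ a x y z → (a :* x :+ y) :* z := a :* (x :* z) :+ y :* z) refl a (X i l) (Y i l) (Z l j)) ⟩
    ∑[ l ] (a * (X i l * Z l j) + Y i l * Z l j)
      ≈⟨ ∑-+ (λ l → a * (X i l * Z l j)) _ ⟩
    ∑[ l ] (a * (X i l * Z l j)) + (Y ⊡ Z) i j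
      ≈⟨ +-congʳ (*-∑ a (λ l → X i l * Z l j)) ⟨
    a * (X ⊡ Z) i j + (Y ⊡ Z) i j ∎

  ⊡-linearʳ : ∀ a (X Y Z : Square) i j → (Z ⊡ (λ p q → a * X p q + Y p q)) i j ≈ a * (Z ⊡ X) i j + (Z ⊡ Y) i j
  ⊡-linearʳ a X Y Z i j = begin
    ∑[ l ] (Z i l * (a * X l j + Y l j))
      ≈⟨ ∑-cong (λ l → solve 4 (λ a x y z → z :* (a :* x :+ y) := a :* (z :* x) :+ z :* y) refl a (X l j) (Y l j) (Z i l)) ⟩
    ∑[ l ] (a * (Z i l * X l j) + Z i l * Y l j)
      ≈⟨ ∑-+ (λ l → a * (Z i l * X l j)) _ ⟩
    ∑[ l ] (a * (Z i l * X l j)) + (Z ⊡ Y) i j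
      ≈⟨ +-congʳ (*-∑ a (λ l → Z i l * X l j)) ⟨
    a * (Z ⊡ X) i j + (Z ⊡ Y) i j ∎

  comm-linear : ∀ a (X Y Z : Square) i j → comm (λ p q → a * X p q + Y p q) Z i j ≈ a * comm X Z i j + comm Y Z i j
  comm-linear a X Y Z i j = trans (+-cong (⊡-linearˡ a X Y Z i j) (-‿cong (⊡-linearʳ a X Y Z i j)))
    (solve 5 (λ a p q r s → (a :* p :+ q) :- (a :* r :+ s) := a :* (p :- r) :+ (q :- s)) refl a
      ((X ⊡ Z) i j) ((Y ⊡ Z) i j) ((Z ⊡ X) i j) ((Z ⊡ Y) i j))

  ⊡-assoc : ∀ (X Y Z : Square) → (X ⊡ Y) ⊡ Z ≋ X ⊡ (Y ⊡ Z)
  ⊡-assoc X Y Z i j = begin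
    ∑[ l ] (∑[ k ] (X i k * Y k l) * Z l j)      ≈⟨ ∑-cong (λ l → trans (∑-* (Z l j) (λ k → X i k * Y k l)) (∑-cong λ k → *-assoc _ _ _)) ⟩
    ∑[ l ] ∑[ k ] (X i k * (Y k l * Z l j))      ≈⟨ ∑-swap _ ⟩
    ∑[ k ] ∑[ l ] (X i k * (Y k l * Z l j))      ≈⟨ ∑-cong (λ k → *-∑ (X i k) (λ l → Y k l * Z l j)) ⟨
    ∑[ k ] (X i k * ∑[ l ] (Y k l * Z l j))      ∎

  ⊡-subˡ : ∀ (X Y Z : Square) i j → ((λ p q → X p q - Y p q) ⊡ Z) i j ≈ (X ⊡ Z) i j - (Y ⊡ Z) i j
  ⊡-subˡ X Y Z i j = trans (∑-cong λ l → trans (distribʳ _ _ _) (+-congˡ (sym (-‿distribˡ-* _ _)))) (∑-- _ _)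

  ⊡-subʳ : ∀ (X Y Z : Square) i j → (Z ⊡ (λ p q → X p q - Y p q)) i j ≈ (Z ⊡ X) i j - (Z ⊡ Y) i j
  ⊡-subʳ X Y Z i j = trans (∑-cong λ l → trans (distribˡ _ _ _) (+-congˡ (sym (-‿distribʳ-* _ _)))) (∑-- _ _)

  comm-jacobi : ∀ (X Y Z : Square) i j → comm (comm X Y) Z i j ≈ comm X (comm Y Z) i j - comm Y (comm X Z) i j
  comm-jacobi X Y Z i j = begin
    (comm X Y ⊡ Z) i j - (Z ⊡ comm X Y) i j
      ≈⟨ +-cong (⊡-subˡ (X ⊡ Y) (Y ⊡ X) Z i j) (-‿cong (⊡-subʳ (X ⊡ Y) (Y ⊡ X) Z i j)) ⟩
    (((X ⊡ Y) ⊡ Z) i j - ((Y ⊡ X) ⊡ Z) i j) - ((Z ⊡ (X ⊡ Y)) i j - (Z ⊡ (Y ⊡ X)) i j)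
      ≈⟨ +-congʳ (+-cong (⊡-assoc X Y Z i j) (-‿cong (⊡-assoc Y X Z i j))) ⟩
    ((X ⊡ (Y ⊡ Z)) i j - (Y ⊡ (X ⊡ Z)) i j) - ((Z ⊡ (X ⊡ Y)) i j - (Z ⊡ (Y ⊡ X)) i j)
      ≈⟨ solve 6 (λ xyz yxz zxy zyx xzy yzx →
           (xyz :- yxz) :- (zxy :- zyx) := ((xyz :- xzy) :- (yzx :- zyx)) :- ((yxz :- yzx) :- (xzy :- zxy))) refl
           ((X ⊡ (Y ⊡ Z)) i j) ((Y ⊡ (X ⊡ Z)) i j) ((Z ⊡ (X ⊡ Y)) i j) ((Z ⊡ (Y ⊡ X)) i j)
           ((X ⊡ (Z ⊡ Y)) i j) ((Y ⊡ (Z ⊡ X)) i j) ⟩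
    (((X ⊡ (Y ⊡ Z)) i j - (X ⊡ (Z ⊡ Y)) i j) - ((Y ⊡ (Z ⊡ X)) i j - (Z ⊡ (Y ⊡ X)) i j)) -
    (((Y ⊡ (X ⊡ Z)) i j - (Y ⊡ (Z ⊡ X)) i j) - ((X ⊡ (Z ⊡ Y)) i j - (Z ⊡ (X ⊡ Y)) i j))
      ≈⟨ +-cong (outer X Y Z) (-‿cong (outer Y X Z)) ⟨
    comm X (comm Y Z) i j - comm Y (comm X Z) i j ∎
    where
    outer : ∀ X Y Z → comm X (comm Y Z) i j ≈
      ((X ⊡ (Y ⊡ Z)) i j - (X ⊡ (Z ⊡ Y)) i j) - ((Y ⊡ (Z ⊡ X)) i j - (Z ⊡ (Y ⊡ X)) i j)
    outer X Y Z = +-cong (⊡-subʳ (Y ⊡ Z) (Z ⊡ Y) X i j) (-‿cong (trans (⊡-subˡ (Y ⊡ Z) (Z ⊡ Y) X i j)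
      (+-cong (⊡-assoc Y Z X i j) (-‿cong (⊡-assoc Z Y X i j)))))

  mat-cong : ∀ {x y} → x ≃ y → mat x ≋ mat y
  mat-cong x≃y i j = ∑-cong λ a → *-congʳ (x≃y a)

  mat-linear : ∀ a x y → mat (a ⊙ x ⊕ y) ≋ (λ i j → a * mat x i j + mat y i j)
  mat-linear a x y i j = begin
    ∑[ k ] ((a * x k + y k) * basis (labelAt m k) i j)
      ≈⟨ ∑-cong (λ k → solve 4 (λ a x y z → (a :* x :+ y) :* z := a :* (x :* z) :+ y :* z) refl a (x k) (y k) (basis (labelAt m k) i j)) ⟩
    ∑[ k ] (a * (x k * basis (labelAt m k) i j) + y k * basis (labelAt m k) i j)
      ≈⟨ ∑-+ (λ k → a * (x k * basis (labelAt m k) i j)) _ ⟩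
    ∑[ k ] (a * (x k * basis (labelAt m k) i j)) + mat y i j
      ≈⟨ +-congʳ (*-∑ a (λ k → x k * basis (labelAt m k) i j)) ⟨
    a * mat x i j + mat y i j ∎

  -- Closure under commutators: nothing is lost by passing to coordinates, so brackets can be
  -- nested.
  mat-bracket : ∀ x y → mat (bracket x y) ≋ comm (mat x) (mat y)
  mat-bracket x y = mat-coords (comm-member (mat-member x) (mat-member y))

  bracket-isLie : IsLieBracket bracket
  bracket-isLie = record
    { br-cong   = λ x≃x′ y≃y′ k → comm-cong (mat-cong x≃x′) (mat-cong y≃y′) _ _
    ; br-linear = λ a x y z k → trans (comm-cong {Y = mat z} (mat-linear a x y) (λ _ _ → refl) _ _) (comm-linear a (mat x) (mat y) (mat z) _ _)
    ; br-anti   = λ x y k → sym (⁻¹-anti-homo-// _ _)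
    ; jacobi    = λ x y z k → begin
        bracket (bracket x y) z k
          ≈⟨ comm-cong {Y = mat z} (mat-bracket x y) (λ _ _ → refl) _ _ ⟩
        coords (comm (comm (mat x) (mat y)) (mat z)) k
          ≈⟨ comm-jacobi (mat x) (mat y) (mat z) _ _ ⟩
        coords (comm (mat x) (comm (mat y) (mat z))) k - coords (comm (mat y) (comm (mat x) (mat z))) k
          ≈⟨ +-cong (comm-cong {X = mat x} (λ _ _ → refl) (mat-bracket y z) _ _)
                    (-‿cong (comm-cong {X = mat y} (λ _ _ → refl) (mat-bracket x z) _ _)) ⟨
        bracket x (bracket y z) k - bracket y (bracket x z) k ∎
    }

  module _ {D : Carrier → Carrier} (der : Derivation.IsDerivation R D) where
    open Derivation.IsDerivation der

    D-bool : ∀ b → D (if b then 1# else 0#) ≈ 0#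
    D-bool true  = D-1
    D-bool false = D-0

    D-basis : ∀ l i j → D (basis l i j) ≈ 0#
    D-basis (off p q) i j = D-bool ((toℕ i ℕ.≡ᵇ toℕ p) ∧ (toℕ j ℕ.≡ᵇ toℕ q))
    D-basis (cart p)  i j = trans (D-- _ _)
      (trans (+-cong (D-bool ((toℕ i ℕ.≡ᵇ toℕ p) ∧ (toℕ j ℕ.≡ᵇ toℕ p))) (-‿cong (D-bool ((toℕ i ℕ.≡ᵇ 0) ∧ (toℕ j ℕ.≡ᵇ 0)))))
             (-‿inverseʳ 0#))

    D-mat : ∀ x i j → D (mat x i j) ≈ mat (D ∘ x) i j
    D-mat x i j = trans (D-∑ _) (∑-cong λ a → trans (D-* _ _)
      (trans (+-congʳ (trans (*-congˡ (D-basis (labelAt m a) i j)) (zeroʳ _))) (+-identityˡ _)))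

    D-⊡ : ∀ x y i j → D ((mat x ⊡ mat y) i j) ≈ (mat x ⊡ mat (D ∘ y)) i j + (mat (D ∘ x) ⊡ mat y) i j
    D-⊡ x y i j = trans (D-∑ _) (trans
      (∑-cong λ l → trans (D-* _ _) (+-cong (*-congˡ (D-mat y l j)) (*-congʳ (D-mat x i l)))) (∑-+ _ _))

    D-bracket : ∀ x y k → D (bracket x y k) ≈ bracket x (D ∘ y) k + bracket (D ∘ x) y k
    D-bracket x y k = trans (D-- _ _) (trans (+-cong (D-⊡ x y _ _) (-‿cong (D-⊡ y x _ _)))
      (solve 4 (λ p q r s → (p :+ q) :- (r :+ s) := (p :- s) :+ (q :- r)) refl _ _ _ _))

module RelatedSeaweeds {c ℓ r : Level} (m : ℕ) {R S : CommutativeRing c ℓ} (ρ : RingRelation R S r) where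
  open RingRelation ρ
  open RelatedSums ρ
  private
    module WR = Seaweed m R
    module WS = Seaweed m S

  ~-bool : ∀ b → (if b then CommutativeRing.1# R else CommutativeRing.0# R) ~ (if b then CommutativeRing.1# S else CommutativeRing.0# S)
  ~-bool true  = ~-1
  ~-bool false = ~-0

  ~-basis : ∀ l i j → WR.basis l i j ~ WS.basis l i j
  ~-basis (off p q) i j = ~-bool ((toℕ i ℕ.≡ᵇ toℕ p) ∧ (toℕ j ℕ.≡ᵇ toℕ q))
  ~-basis (cart p)  i j = ~-+ (~-bool ((toℕ i ℕ.≡ᵇ toℕ p) ∧ (toℕ j ℕ.≡ᵇ toℕ p)))
    (~-neg (~-bool ((toℕ i ℕ.≡ᵇ 0) ∧ (toℕ j ℕ.≡ᵇ 0))))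

  ~-mat : ∀ {x x′} → (∀ k → x k ~ x′ k) → ∀ i j → WR.mat x i j ~ WS.mat x′ i j
  ~-mat x~x′ i j = ~-∑ λ a → ~-* (x~x′ a) (~-basis (labelAt m a) i j)

  ~-bracket : ∀ {x y x′ y′} → (∀ k → x k ~ x′ k) → (∀ k → y k ~ y′ k) → ∀ k → WR.bracket x y k ~ WS.bracket x′ y′ k
  ~-bracket x~x′ y~y′ k = ~-+ (~-∑ λ l → ~-* (~-mat x~x′ _ l) (~-mat y~y′ l _))
    (~-neg (~-∑ λ l → ~-* (~-mat y~y′ _ l) (~-mat x~x′ l _)))

seaweed : ∀ {c ℓ} m → IntegralBracket c ℓ (dimG m)
seaweed m = record
  { bracket   = Seaweed.bracket m
  ; isLie     = SeaweedBracket.bracket-isLie m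
  ; ~-bracket = RelatedSeaweeds.~-bracket m
  ; D-bracket = SeaweedBracket.D-bracket m }

-- Matrices constant along diagonals in steps of two.

-- The block of a matrix in the kernel of the Frobenius form that acts on V₁,
-- extended by zero to the right; s is the scalar in the defining equations.
module ScalarBlock {c ℓ : Level} (R : CommutativeRing c ℓ) where
  open CommutativeRing R hiding (zero)
  open IntegerCoefficients R using (nat; solve; con; _:=_; _:+_; _:*_; _:-_; :-_)
  open import Algebra.Properties.Ring ring
  open import Relation.Binary.Reasoning.Setoid setoid

  -- The last index 2m of the basis v₀, ..., v_{2m} of V₁, where k = m - 1; this is not the k = 2m -
  -- 1 of the theorem.
  bound : ℕ → ℕ
  bound k = suc (suc (k ℕ.+ k))

  module _ (k : ℕ) (torsionFree : ∀ n x → nat (suc n) * x ≈ 0# → x ≈ 0#)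
    (x : ℕ → ℕ → Carrier) (s : Carrier)
    (shift-off  : ∀ i p → 2 ℕ.+ i ℕ.≤ bound k → p ℕ.≤ bound k → p ≢ 2 ℕ.+ i → x (2 ℕ.+ i) (2 ℕ.+ p) ≈ x i p)
    (shift-diag : ∀ i → 2 ℕ.+ i ℕ.≤ bound k → x (2 ℕ.+ i) (4 ℕ.+ i) ≈ x i (2 ℕ.+ i) - (s + s))
    (outside : ∀ i p → bound k ℕ.< p → x i p ≈ 0#)
    (column₀ : ∀ i → 2 ℕ.+ i ℕ.≤ bound k → x (2 ℕ.+ i) 0 ≈ 0#)
    (column₁ : ∀ i → 2 ℕ.+ i ℕ.≤ bound k → x (2 ℕ.+ i) 1 ≈ 0#)
    (eq₀₀ : x 1 0 - x 0 2 ≈ s) (eq₁₀ : x 1 2 ≈ 0#)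
    (eq₀₁ : x 1 1 ≈ x 0 3 + x 0 0) (eq₁₁ : - x 1 3 - x 1 0 ≈ s)
    where

    private
      L : ℕ
      L = bound k

      double-suc : ∀ i r → i ℕ.+ (suc r ℕ.+ suc r) ≡ 2 ℕ.+ i ℕ.+ (r ℕ.+ r)
      double-suc i r = ≡.trans (≡.cong (i ℕ.+_) (≡.cong suc (ℕP.+-suc r r)))
        (≡.trans (ℕP.+-suc i _) (≡.cong suc (ℕP.+-suc i _)))

      -- Following the second superdiagonal, the entries lose 2s at each step and are zero once the
      -- column is outside; so the starting entry counts the steps.
      chain : ∀ r i {e} → i ℕ.+ (r ℕ.+ r) ≡ e → e ℕ.≤ L → L ℕ.< 2 ℕ.+ e → x i (2 ℕ.+ i) ≈ nat r * (s + s)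
      chain zero    i eq e≤L L<2+e =
        trans (outside i (2 ℕ.+ i) (≡.subst (λ a → L ℕ.< 2 ℕ.+ a) (≡.trans (≡.sym eq) (ℕP.+-identityʳ i)) L<2+e)) (sym (zeroˡ _))
      chain (suc r) i {e} eq e≤L L<2+e = begin
        x i (2 ℕ.+ i)                          ≈⟨ solve 2 (λ a b → a := (a :- b) :+ b) refl (x i (2 ℕ.+ i)) (s + s) ⟩
        (x i (2 ℕ.+ i) - (s + s)) + (s + s)    ≈⟨ +-congʳ (shift-diag i (ℕP.≤-trans (ℕP.m≤m+n (2 ℕ.+ i) (r ℕ.+ r)) (≡.subst (ℕ._≤ L) eq′ e≤L))) ⟨
        x (2 ℕ.+ i) (4 ℕ.+ i) + (s + s)        ≈⟨ +-congʳ (chain r (2 ℕ.+ i) (≡.sym eq′) e≤L L<2+e) ⟩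
        nat r * (s + s) + (s + s)              ≈⟨ +-comm _ _ ⟩
        (s + s) + nat r * (s + s)              ≈⟨ +-congʳ (*-identityˡ _) ⟨
        1# * (s + s) + nat r * (s + s)         ≈⟨ distribʳ _ _ _ ⟨
        nat (suc r) * (s + s)                  ∎
        where
        eq′ : e ≡ 2 ℕ.+ i ℕ.+ (r ℕ.+ r)
        eq′ = ≡.trans (≡.sym eq) (double-suc i r)

      half : suc k ℕ.+ suc k ≡ L
      half = ≡.cong suc (ℕP.+-suc k k)

    -- Adding `eq₀₀` and `eq₁₁` eliminates x 1 0 and leaves - x 0 2 - x 1 3 = 2s. The chains from
    -- rows 0 and 1 have k + 1 and k steps of 2s, whence (4k + 4) s = 0.
    scalar≈0 : s ≈ 0#
    scalar≈0 = torsionFree (3 ℕ.+ (4 ℕ.* k)) s (begin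
      nat (4 ℕ.+ 4 ℕ.* k) * s
        ≈⟨ *-congʳ (trans (IC.int-+ (+ 4) (+ (4 ℕ.* k))) (+-congˡ (trans (reflexive (≡.cong IC.int (ℤP.pos-* 4 k))) (IC.int-* (+ 4) (+ k))))) ⟩
      (nat 4 + nat 4 * nat k) * s
        ≈⟨ solve 4 (λ u κ x10 s → (con (+ 4) :+ con (+ 4) :* κ) :* s := (s :- (:- (κ :* (s :+ s)) :- x10)) :+ (s :- (x10 :- (con (+ 1) :+ κ) :* (s :+ s)))) refl 1# (nat k) (x 1 0) s ⟩
      (s - (- (nat k * (s + s)) - x 1 0)) + (s - (x 1 0 - (nat 1 + nat k) * (s + s)))
        ≈⟨ +-cong (+-congˡ (-‿cong (trans (+-congʳ (-‿cong (sym x₁₃))) eq₁₁)))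
             (+-congˡ (-‿cong (trans (+-congˡ (-‿cong (trans (*-congʳ (+-congʳ (+-identityʳ 1#))) (sym x₀₂)))) eq₀₀))) ⟩
      (s - s) + (s - s)
        ≈⟨ trans (+-cong (-‿inverseʳ s) (-‿inverseʳ s)) (+-identityˡ 0#) ⟩
      0# ∎)
      where
      module IC = IntegerCoefficients R
      x₀₂ : x 0 2 ≈ nat (suc k) * (s + s)
      x₀₂ = chain (suc k) 0 half ℕP.≤-refl (ℕP.m<n+m L {2} (ℕ.s≤s ℕ.z≤n))
      x₁₃ : x 1 3 ≈ nat k * (s + s)
      x₁₃ = chain k 1 ≡.refl (ℕP.n≤1+n _) ℕP.≤-refl

    private
      shift : ∀ i p → 2 ℕ.+ i ℕ.≤ L → p ℕ.≤ L → x (2 ℕ.+ i) (2 ℕ.+ p) ≈ x i p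
      shift i p i≤ p≤ with p ℕ.≟ 2 ℕ.+ i
      ... | no p≢      = shift-off i p i≤ p≤ p≢
      ... | yes ≡.refl = trans (shift-diag i i≤) (trans (+-congˡ (trans (-‿cong (trans (+-cong scalar≈0 scalar≈0)
                           (+-identityˡ 0#))) -0#≈0#)) (+-identityʳ _))

      -- With s = 0, moving down the diagonal preserves the entry until its column leaves the block;
      -- the column stays ahead of the row by at least two, so the row bound of `shift` holds. The
      -- fuel bounds the number of moves.
      upper : ∀ fuel i j → L ℕ.< fuel ℕ.+ j → 2 ℕ.+ i ℕ.≤ j → x i j ≈ 0#
      upper zero       i j L<j i<j = outside i j L<j
      upper (suc fuel) i j L<j i<j with j ℕ.≤? L
      ... | no  j≰L = outside i j (ℕP.≰⇒> j≰L)
      ... | yes j≤L = trans (sym (shift i j (ℕP.≤-trans i<j j≤L) j≤L))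
        (upper fuel (2 ℕ.+ i) (2 ℕ.+ j)
          (ℕP.<-≤-trans L<j (≡.subst (suc fuel ℕ.+ j ℕ.≤_) (≡.sym (≡.trans (ℕP.+-suc fuel (suc j)) (≡.cong suc (ℕP.+-suc fuel j)))) (ℕP.n≤1+n _)))
          (ℕ.s≤s (ℕ.s≤s i<j)))

      -- From an even row, steps of two end in row L, whose next column is outside. From an odd row
      -- they end inside the block, which is why `eq₁₀` is needed for row 1.
      upper₁ : ∀ r i → i ℕ.+ (r ℕ.+ r) ≡ L → x i (suc i) ≈ 0#
      upper₁ zero    i eq = outside i (suc i) (ℕ.s≤s (ℕP.≤-reflexive (≡.trans (≡.sym eq) (ℕP.+-identityʳ i))))
      upper₁ (suc r) i eq = trans (sym (shift i (suc i) i≤ (ℕP.≤-trans (ℕP.n≤1+n _) i≤))) (upper₁ r (2 ℕ.+ i) eq′)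
        where
        eq′ : 2 ℕ.+ i ℕ.+ (r ℕ.+ r) ≡ L
        eq′ = ≡.trans (≡.sym (double-suc i r)) eq
        i≤ : 2 ℕ.+ i ℕ.≤ L
        i≤ = ≡.subst (2 ℕ.+ i ℕ.≤_) eq′ (ℕP.m≤m+n _ _)

    -- Steps of two reduce every entry to the first two rows or the first two columns, where the
    -- individual equations decide.
    scalar : ∀ i j → i ℕ.≤ L → j ℕ.≤ L → x i j ≈ (if i ℕ.≡ᵇ j then x 0 0 else 0#)
    scalar zero zero _ _ = refl
    scalar zero (suc zero) _ _ = upper₁ (suc k) 0 half
    scalar zero (suc (suc j)) _ _ = upper (suc L) 0 (2 ℕ.+ j) (ℕ.s≤s (ℕP.m≤m+n L _)) (ℕ.s≤s (ℕ.s≤s ℕ.z≤n))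
    scalar (suc zero) zero _ _ = begin
      x 1 0                  ≈⟨ solve 2 (λ a b → a := (a :- b) :+ b) refl (x 1 0) (x 0 2) ⟩
      (x 1 0 - x 0 2) + x 0 2 ≈⟨ +-cong (trans eq₀₀ scalar≈0) (upper (suc L) 0 2 (ℕ.s≤s (ℕP.m≤m+n L _)) ℕP.≤-refl) ⟩
      0# + 0#                ≈⟨ +-identityˡ 0# ⟩
      0#                     ∎
    scalar (suc zero) (suc zero) _ _ =
      trans eq₀₁ (trans (+-congʳ (upper (suc L) 0 3 (ℕ.s≤s (ℕP.m≤m+n L _)) (ℕ.s≤s (ℕ.s≤s ℕ.z≤n)))) (+-identityˡ _))
    scalar (suc zero) (suc (suc zero)) _ _ = eq₁₀
    scalar (suc zero) (suc (suc (suc j))) _ _ =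
      upper (suc L) 1 (3 ℕ.+ j) (ℕ.s≤s (ℕP.m≤m+n L _)) (ℕ.s≤s (ℕ.s≤s (ℕ.s≤s ℕ.z≤n)))
    scalar (suc (suc i)) zero i≤ _ = column₀ i i≤
    scalar (suc (suc i)) (suc zero) i≤ _ = column₁ i i≤
    scalar (suc (suc i)) (suc (suc j)) i≤ j≤ =
      trans (shift i j i≤ j′≤) (scalar i j (ℕP.≤-trans (ℕP.m≤n+m i 2) i≤) j′≤)
      where
      j′≤ : j ℕ.≤ L
      j′≤ = ℕP.≤-trans (ℕP.m≤n+m j 2) j≤

-- From the definitions of the theorem to coordinates.

module OverField {c ℓ : Level} (K : Field c ℓ) (charZero : CharZero K) (m : ℕ) where
  open Field K hiding (zero)
  open IntegerCoefficients commutativeRing using (nat; int)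
  open Sums commutativeRing
  open Determinant commutativeRing
  open FrobeniusForm commutativeRing
  open Labels m
  open Seaweed m commutativeRing
  open SeaweedBracket m commutativeRing
  open Bracket bracket-isLie
  open IsLieBracket bracket-isLie
  open import Algebra.Properties.Ring ring
  open import Relation.Binary.Reasoning.Setoid setoid

  sumF≈∑ : ∀ {n} (f : Fin n → Carrier) → sumF K f ≈ ∑ f
  sumF≈∑ {zero}  f = sym (∑-nil f)
  sumF≈∑ {suc n} f = trans (+-congˡ (sumF≈∑ (f ∘ suc))) (sym (∑-suc f))

  natK≡nat : ∀ n → natK K n ≡ nat n
  natK≡nat zero    = ≡.refl
  natK≡nat (suc n) = ≡.cong (λ x → 1# + x) (natK≡nat n)

  intK≡int : ∀ i → intK K i ≡ int i
  intK≡int (+ n)    = natK≡nat n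
  intK≡int -[1+ n ] = ≡.cong -_ (natK≡nat (suc n))

  torsionFree : ∀ n x → nat (suc n) * x ≈ 0# → x ≈ 0#
  torsionFree n x nx≈0 with inverse (nat (suc n)) (λ eq → charZero n (trans (reflexive (natK≡nat (suc n))) eq))
  ... | u , unit = begin
    x                    ≈⟨ *-identityˡ x ⟨
    1# * x               ≈⟨ *-congʳ (trans (*-comm _ _) unit) ⟨
    u * nat (suc n) * x  ≈⟨ *-assoc _ _ _ ⟩
    u * (nat (suc n) * x) ≈⟨ trans (*-congˡ nx≈0) (zeroʳ u) ⟩
    0#                   ∎

  ⟦⟧≈comm : ∀ (X Y : Square) → Defs.⟦_,_⟧ K X Y ≋ comm X Y
  ⟦⟧≈comm X Y i j = +-cong (sumF≈∑ _) (-‿cong (sumF≈∑ _))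

  member : ∀ {X} → InG K m X → Member X
  member (trace≈0 , zeros) = trans (sym (sumF≈∑ _)) trace≈0 , zeros

  inG : ∀ {X} → Member X → InG K m X
  inG (trace≈0 , zeros) = trans (sumF≈∑ _) trace≈0 , zeros

  coord≡ : ∀ l (X : Square) → coord K l X ≡ X (row l) (col l)
  coord≡ (off i j) X = ≡.refl
  coord≡ (cart i)  X = ≡.refl

  basisMat≡ : ∀ l → basisMat K l ≡ basis l
  basisMat≡ (off i j) = ≡.refl
  basisMat≡ (cart i)  = ≡.refl

  evalF≈pairing : ∀ f X → evalF K m f X ≈ pairing f (coords X)
  evalF≈pairing f X = trans (sumF≈∑ _) (∑-cong λ a → *-congˡ (reflexive (coord≡ (labelAt m a) X)))

  mat-δ : ∀ b → mat (δ b) ≋ basis (labelAt m b)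
  mat-δ b i j = ∑-δ b (λ a → basis (labelAt m a) i j)

  module _ (f : Vect d) where
    Frobenius : Set (c ⊔ ℓ)
    Frobenius = ∀ X → Member X → (∀ Y → Member Y → pairing f (coords (comm X Y)) ≈ 0#) → ∀ i j → X i j ≈ 0#

    Principal : Square → Set (c ⊔ ℓ)
    Principal F = Member F × (∀ X → Member X → pairing f (coords (comm F X)) ≈ pairing f (coords X))

    frobenius : IsFrobenius K m f → Frobenius
    frobenius frob X mX kills = frob X (inG mX) λ Y mY →
      trans (evalF≈pairing f _) (trans (pairing-cong (λ _ → refl) λ k → ⟦⟧≈comm X Y _ _) (kills Y (member mY)))

    principal : ∀ {F} → IsPrincipal K m f F → Principal F
    principal {F} (mF , eq) = member mF , λ X mX → begin
      pairing f (coords (comm F X))         ≈⟨ pairing-cong (λ _ → refl) (λ k → ⟦⟧≈comm F X _ _) ⟨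
      pairing f (coords (Defs.⟦_,_⟧ K F X)) ≈⟨ evalF≈pairing f _ ⟨
      evalF K m f (Defs.⟦_,_⟧ K F X)        ≈⟨ eq X (inG mX) ⟩
      evalF K m f X                         ≈⟨ evalF≈pairing f X ⟩
      pairing f (coords X)                  ∎

    -- Nondegeneracy is injectivity of the matrix of the form. By `injective⇒det` its determinant
    -- cannot vanish, and this negative statement is exactly what inversion in the field asks for.
    frobenius⇒unit : Frobenius → Σ Carrier λ u → det (form f) * u ≈ 1#
    frobenius⇒unit frob = inverse (det (form f)) λ det≈0 → 1≉0 (injective⇒det (form f) injective det≈0)
      where
      injective : Injective (form f)
      injective x ker k = trans (sym (coords-mat x k)) (frob (mat x) (mat-member x) kills _ _)
        where
        represents : Represents f x (λ _ → 0#)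
        represents b = trans (sym (form-mul f x b)) (ker b)
        kills : ∀ Y → Member Y → pairing f (coords (comm (mat x) Y)) ≈ 0#
        kills Y mY = begin
          pairing f (coords (comm (mat x) Y))  ≈⟨ pairing-cong (λ _ → refl) (λ k → comm-cong {X = mat x} (λ _ _ → refl) (mat-coords mY) _ _) ⟨
          pairing f (bracket x (coords Y))     ≈⟨ represents-pairing f represents (coords Y) ⟩
          pairing (λ _ → 0#) (coords Y)        ≈⟨ ∑-0 (λ _ → zeroˡ _) ⟩
          0#                                   ∎

    principal⇒represents : ∀ {F} → Principal F → Represents f (coords F) f
    principal⇒represents {F} (mF , eq) b = begin
      pairing f (bracket (coords F) (δ b))  ≈⟨ pairing-cong (λ _ → refl) (λ k → comm-cong {Y = mat (δ b)} (mat-coords mF) (λ _ _ → refl) _ _) ⟩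
      pairing f (coords (comm F (mat (δ b)))) ≈⟨ eq (mat (δ b)) (mat-member (δ b)) ⟩
      pairing f (coords (mat (δ b)))        ≈⟨ pairing-cong (λ _ → refl) (coords-mat (δ b)) ⟩
      pairing f (δ b)                       ≈⟨ ∑-cong (λ a → *-comm _ _) ⟩
      pairing (δ b) f                       ≈⟨ ∑-δ b f ⟩
      f b                                   ∎

  det≈ : ∀ {n} (A : Mat′ n n) → Defs.det K A ≈ det A
  det≈ {zero}  A = refl
  det≈ {suc n} A = trans
    (+-cong (*-congˡ (*-congˡ (minor≈ zero))) (trans (sumF≈∑ laterTerms) (∑-cong later)))
    (sym (∑-suc _))
    where
    minor≈ : ∀ j → Defs.det K (minor j (A ∘ suc)) ≈ det (minor j (A ∘ suc))
    minor≈ j = det≈ (minor j (A ∘ suc))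
    -- The sign function of Defs.det is local to its clause, hence has no name here;
    -- unification recovers it.
    summands : ∀ {a} {f : Fin n → Carrier} → a + sumF K f ≈ a + sumF K f → Fin n → Carrier
    summands {f = f} _ = f
    laterTerms : Fin n → Carrier
    laterTerms = summands (refl {Defs.det K A})
    sign : (s : ℕ → Carrier) → s 0 ≡ - 1# → s 1 ≡ 1# → (∀ k → s (suc (suc k)) ≡ s k) → ∀ k → s k ≈ sgn (suc k)
    sign s s₀ s₁ s₂ zero          = reflexive s₀
    sign s s₀ s₁ s₂ (suc zero)    = trans (reflexive s₁) (sym (-‿involutive _))
    sign s s₀ s₁ s₂ (suc (suc k)) = trans (reflexive (s₂ k)) (trans (sign s s₀ s₁ s₂ k) (sym (-‿involutive _)))
    laterSign : ℕ → Carrier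
    laterSign = _
    later : ∀ j → laterTerms j ≈ sgn (suc (toℕ j)) * (A zero (suc j) * det (minor (suc j) (A ∘ suc)))
    later j with toℕ j
    ... | k = *-cong (sign laterSign ≡.refl ≡.refl (λ _ → ≡.refl) k) (*-congˡ (minor≈ (suc j)))

  charPolyAt≈ : ∀ F t → Member F → charPolyAt K (adMat K m F) t ≈ det (charMatrix t (coords F))
  charPolyAt≈ F t mF = trans (det≈ {dimG m} _) (det-cong λ i j → +-cong (scaled i j) (-‿cong (entry i j)))
    where
    scaled : ∀ i j → (if does (i Fin.≟ j) then t else 0#) ≈ t * δ i j
    scaled i j with does (i Fin.≟ j)
    ... | true  = sym (*-identityʳ t)
    ... | false = sym (zeroʳ t)
    entry : ∀ i j → adMat K m F i j ≈ ad (coords F) i j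
    entry i j = trans (reflexive (≡.trans (coord≡ (labelAt m i) _)
        (≡.cong (λ B → Defs.⟦_,_⟧ K F B (row (labelAt m i)) (col (labelAt m i))) (basisMat≡ (labelAt m j)))))
      (trans (⟦⟧≈comm F (basis (labelAt m j)) _ _)
        (sym (comm-cong {Y = mat (δ j)} (mat-coords mF) (mat-δ j) _ _)))

  spectrum-independent : ∀ {f f′ F F′} → Frobenius f → Frobenius f′ → Principal f F → Principal f′ F′ →
    ∀ t → det (charMatrix t (coords F)) ≈ det (charMatrix t (coords F′))
  spectrum-independent {f} {f′} frob frob′ prin prin′ =
    -- The segment runs from `f′` at 0 to `f` at 1, which explains the order of the arguments.
    SpectrumConstant.det-charMatrix-constant (seaweed m) commutativeRing
      (proj₂ (frobenius⇒unit f′ frob′)) (proj₂ (frobenius⇒unit f frob))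
      (principal⇒represents f′ prin′) (principal⇒represents f prin) torsionFree

-- Matrices indexed by natural numbers, extended by zero.

module ExtensionByZero {c ℓ : Level} (R : CommutativeRing c ℓ) where
  open CommutativeRing R hiding (zero)
  open Sums R
  open import Algebra.Properties.Ring ring using (-0#≈0#)

  -- Total on natural numbers, so that positions such as 2 + j or L + 1 + j can be computed without
  -- carrying bounds.
  entry : ∀ {n} → (Fin n → Carrier) → ℕ → Carrier
  entry {zero}  v a       = 0#
  entry {suc n} v zero    = v zero
  entry {suc n} v (suc a) = entry (v ∘ suc) a

  entry-toℕ : ∀ {n} (v : Fin n → Carrier) i → entry v (toℕ i) ≡ v i
  entry-toℕ v zero    = ≡.refl
  entry-toℕ v (suc i) = entry-toℕ (v ∘ suc) i

  entry-cong : ∀ {n} {v w : Fin n → Carrier} → (∀ i → v i ≈ w i) → ∀ a → entry v a ≈ entry w a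
  entry-cong {zero}  v≈w a       = refl
  entry-cong {suc n} v≈w zero    = v≈w zero
  entry-cong {suc n} v≈w (suc a) = entry-cong (v≈w ∘ suc) a

  entry-0 : ∀ n a → entry {n} (λ _ → 0#) a ≡ 0#
  entry-0 zero    a       = ≡.refl
  entry-0 (suc n) zero    = ≡.refl
  entry-0 (suc n) (suc a) = entry-0 n a

  entry-outside : ∀ {n} (v : Fin n → Carrier) a → n ℕ.≤ a → entry v a ≡ 0#
  entry-outside {zero}  v a       _           = ≡.refl
  entry-outside {suc n} v (suc a) (ℕ.s≤s n≤a) = entry-outside (v ∘ suc) a n≤a

  entry-scale : ∀ {n} (g : ℕ → Carrier) (v : Fin n → Carrier) a → entry (λ i → g (toℕ i) * v i) a ≈ g a * entry v a
  entry-scale {zero}  g v a       = sym (zeroʳ _)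
  entry-scale {suc n} g v zero    = refl
  entry-scale {suc n} g v (suc a) = entry-scale (g ∘ suc) (v ∘ suc) a

  entry-+ : ∀ {n} (v w : Fin n → Carrier) a → entry (λ i → v i + w i) a ≈ entry v a + entry w a
  entry-+ {zero}  v w a       = sym (+-identityˡ 0#)
  entry-+ {suc n} v w zero    = refl
  entry-+ {suc n} v w (suc a) = entry-+ (v ∘ suc) (w ∘ suc) a

  entry-neg : ∀ {n} (v : Fin n → Carrier) a → entry (λ i → - v i) a ≈ - entry v a
  entry-neg {zero}  v a       = sym -0#≈0#
  entry-neg {suc n} v zero    = refl
  entry-neg {suc n} v (suc a) = entry-neg (v ∘ suc) a

  entry-if : ∀ {n} b (v : Fin n → Carrier) a → entry (λ i → if b then v i else 0#) a ≈ (if b then entry v a else 0#)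
  entry-if {n} true  v a = refl
  entry-if {n} false v a = reflexive (entry-0 n a)

  entry-indicator : ∀ {n} (q : Fin n) x a → entry {n} (λ i → if toℕ i ℕ.≡ᵇ toℕ q then x else 0#) a ≈ (if a ℕ.≡ᵇ toℕ q then x else 0#)
  entry-indicator {suc n} zero x zero = refl
  entry-indicator {suc n} zero x (suc a) = reflexive (entry-0 n a)
  entry-indicator {suc n} (suc q) x zero = refl
  entry-indicator {suc n} (suc q) x (suc a) = entry-indicator q x a

  at : ∀ {n} → (Fin n → Fin n → Carrier) → ℕ → ℕ → Carrier
  at X a b = entry (λ i → entry (X i) b) a

  module _ {n} {X Y : Fin n → Fin n → Carrier} where
    at-cong : (∀ i j → X i j ≈ Y i j) → ∀ a b → at X a b ≈ at Y a b
    at-cong X≈Y a b = entry-cong (λ i → entry-cong (X≈Y i) b) a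

  at-toℕ : ∀ {n} (X : Fin n → Fin n → Carrier) i j → at X (toℕ i) (toℕ j) ≡ X i j
  at-toℕ X i j = ≡.trans (entry-toℕ _ i) (entry-toℕ (X i) j)

  at-rows : ∀ {n} (g : ℕ → Carrier) (X : Fin n → Fin n → Carrier) a b → at (λ i j → g (toℕ i) * X i j) a b ≈ g a * at X a b
  at-rows g X a b = trans (entry-cong (λ i → entry-scale (λ _ → g (toℕ i)) (X i) b) a) (entry-scale g (λ i → entry (X i) b) a)

  at-columns : ∀ {n} (g : ℕ → Carrier) (X : Fin n → Fin n → Carrier) a b → at (λ i j → g (toℕ j) * X i j) a b ≈ g b * at X a b
  at-columns g X a b = trans (entry-cong (λ i → entry-scale g (X i) b) a) (entry-scale (λ _ → g b) (λ i → entry (X i) b) a)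

  at-+ : ∀ {n} (X Y : Fin n → Fin n → Carrier) a b → at (λ i j → X i j + Y i j) a b ≈ at X a b + at Y a b
  at-+ X Y a b = trans (entry-cong (λ i → entry-+ (X i) (Y i) b) a) (entry-+ (λ i → entry (X i) b) (λ i → entry (Y i) b) a)

  at-⊙ : ∀ {n} c (X : Fin n → Fin n → Carrier) a b → at (λ i j → c * X i j) a b ≈ c * at X a b
  at-⊙ c X a b = trans (entry-cong (λ i → entry-scale (λ _ → c) (X i) b) a) (entry-scale (λ _ → c) (λ i → entry (X i) b) a)

  at-neg : ∀ {n} (X : Fin n → Fin n → Carrier) a b → at (λ i j → - X i j) a b ≈ - at X a b
  at-neg X a b = trans (entry-cong (λ i → entry-neg (X i) b) a) (entry-neg (λ i → entry (X i) b) a)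

  at-- : ∀ {n} (X Y : Fin n → Fin n → Carrier) a b → at (λ i j → X i j - Y i j) a b ≈ at X a b - at Y a b
  at-- X Y a b = trans (at-+ X (λ i j → - Y i j) a b) (+-congˡ (at-neg Y a b))

  -- Here `σ` lists end points of a family of edges; since it is injective, at most one edge of the
  -- family ends at q.
  ∑-hit : ∀ n {σ : ℕ → ℕ} (σ-injective : ∀ {a b} → σ a ≡ σ b → a ≡ b) (g : ℕ → Carrier) {c q} →
    c ℕ.< n → σ c ≡ q → ∑ {n} (λ j → if σ (toℕ j) ℕ.≡ᵇ q then g (toℕ j) else 0#) ≈ g c
  ∑-hit n {σ} σ-injective g {c} {q} c<n ≡.refl = trans (∑-single _ (Fin.fromℕ< c<n) miss) hit
    where
    miss : ∀ j → Fin.fromℕ< c<n ≢ j → (if σ (toℕ j) ℕ.≡ᵇ σ c then g (toℕ j) else 0#) ≈ 0#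
    miss j c≢j rewrite ≢⇒≡ᵇ-false {σ (toℕ j)} {σ c}
      (λ eq → c≢j (Finₚ.toℕ-injective (≡.trans (Finₚ.toℕ-fromℕ< c<n) (≡.sym (σ-injective eq))))) = refl
    hit : (if σ (toℕ (Fin.fromℕ< c<n)) ℕ.≡ᵇ σ c then g (toℕ (Fin.fromℕ< c<n)) else 0#) ≈ g c
    hit rewrite Finₚ.toℕ-fromℕ< c<n | ≡ᵇ-refl (σ c) = refl

  ∑-miss : ∀ n (σ : ℕ → ℕ) (g : ℕ → Carrier) {q} → (∀ j → j ℕ.< n → σ j ≢ q) →
    ∑ {n} (λ j → if σ (toℕ j) ℕ.≡ᵇ q then g (toℕ j) else 0#) ≈ 0#
  ∑-miss n σ g {q} miss = ∑-0 term
    where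
    term : ∀ (j : Fin n) → (if σ (toℕ j) ℕ.≡ᵇ q then g (toℕ j) else 0#) ≈ 0#
    term j rewrite ≢⇒≡ᵇ-false (miss (toℕ j) (Finₚ.toℕ<n j)) = refl

  if-0 : ∀ b {x} → x ≈ 0# → (if b then x else 0#) ≈ 0#
  if-0 true  x≈0 = x≈0
  if-0 false x≈0 = refl

-- The kernel of the form of the standard functional.

-- With V₁ = ⟨v₀, …, v_L⟩ and V / V₁ = ⟨w₀, …, w_{n-1}⟩ (positions 0, …, L and suc L + j),
-- the functional is X ↦ Σ_j X(v_{j+2}, w_j) + Σ_j X(v_j, v_{j+2}) + X(v₁, v₀).
-- Its value on the commutator [X, E_pq] is value p q below.
module StandardFunctional {c ℓ : Level} (R : CommutativeRing c ℓ) (k : ℕ) where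
  open CommutativeRing R hiding (zero)
  open IntegerCoefficients R using (nat; solve; con; _:=_; _:+_; _:-_; :-_)
  open Sums R
  open ExtensionByZero R
  open ScalarBlock R
  open import Algebra.Properties.Ring ring
  open import Relation.Binary.Reasoning.Setoid setoid

  n L : ℕ
  n = suc (k ℕ.+ k)
  L = bound k

  V-W V-V : (ℕ → ℕ → Carrier) → Carrier
  V-W x = ∑ {n} (λ j → x (2 ℕ.+ toℕ j) (suc L ℕ.+ toℕ j))
  V-V x = ∑ {n} (λ j → x (toℕ j) (2 ℕ.+ toℕ j))

  functional : (ℕ → ℕ → Carrier) → Carrier
  functional x = V-W x + V-V x + x 1 0

  module Kernel (torsionFree : ∀ n x → nat (suc n) * x ≈ 0# → x ≈ 0#)
    (x : ℕ → ℕ → Carrier) (s : Carrier) where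

    right left value : ℕ → ℕ → Carrier
    right p q = functional (λ a b → if b ℕ.≡ᵇ q then x a p else 0#)
    left  p q = functional (λ a b → if a ℕ.≡ᵇ p then x q b else 0#)
    value p q = right p q - left p q

    module _
      (zeros   : ∀ i j → L ℕ.< i → j ℕ.≤ L → x i j ≈ 0#)
      (value-≢ : ∀ p q → p ℕ.< suc L ℕ.+ n → q ℕ.< suc L ℕ.+ n → p ≢ q → ¬ (L ℕ.< p × q ℕ.≤ L) → value p q ≈ 0#)
      -- Only the differences E_pp - E_00 have trace zero, so the diagonal equations hold up to a
      -- common unknown s, the multiplier of the trace condition.
      (value-≡ : ∀ p → p ℕ.< suc L ℕ.+ n → value p p ≈ s)
      where

      private
        2+-injective : ∀ {a b} → 2 ℕ.+ a ≡ 2 ℕ.+ b → a ≡ b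
        2+-injective ≡.refl = ≡.refl

        L+-injective : ∀ {a b} → suc L ℕ.+ a ≡ suc L ℕ.+ b → a ≡ b
        L+-injective = ℕP.+-cancelˡ-≡ (suc L) _ _

        small : ∀ {a} → a ℕ.≤ L → a ℕ.< suc L ℕ.+ n
        small a≤L = ℕP.≤-trans (ℕ.s≤s a≤L) (ℕP.m≤m+n (suc L) n)

        large : ∀ {r} → r ℕ.< n → suc L ℕ.+ r ℕ.< suc L ℕ.+ n
        large = ℕP.+-monoʳ-< (suc L)

        inner : ∀ {r} → r ℕ.< n → 2 ℕ.+ r ℕ.≤ L
        inner r<n = ℕ.s≤s r<n

        L<large : ∀ r → L ℕ.< suc L ℕ.+ r
        L<large r = ℕ.s≤s (ℕP.m≤m+n L r)

        small≢large : ∀ {a r} → a ℕ.≤ L → a ≢ suc L ℕ.+ r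
        small≢large {r = r} a≤L ≡.refl = ℕP.<⇒≱ (L<large r) a≤L

        right-VW-large : ∀ p {r} → r ℕ.< n →
          V-W (λ a b → if b ℕ.≡ᵇ suc L ℕ.+ r then x a p else 0#) ≈ x (2 ℕ.+ r) p
        right-VW-large p r<n = ∑-hit n L+-injective (λ j → x (2 ℕ.+ j) p) r<n ≡.refl

        right-VW-small : ∀ p {q} → q ℕ.≤ L → V-W (λ a b → if b ℕ.≡ᵇ q then x a p else 0#) ≈ 0#
        right-VW-small p q≤L = ∑-miss n (suc L ℕ.+_) (λ j → x (2 ℕ.+ j) p) λ j _ eq → small≢large q≤L (≡.sym eq)

        right-VV-large : ∀ p r → V-V (λ a b → if b ℕ.≡ᵇ suc L ℕ.+ r then x a p else 0#) ≈ 0#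
        right-VV-large p r = ∑-miss n (2 ℕ.+_) (λ j → x j p) λ j j<n → small≢large (inner j<n)

        right-VV-2+ : ∀ p {i} → i ℕ.< n → V-V (λ a b → if b ℕ.≡ᵇ 2 ℕ.+ i then x a p else 0#) ≈ x i p
        right-VV-2+ p i<n = ∑-hit n 2+-injective (λ j → x j p) i<n ≡.refl

        right-VV-<2 : ∀ p {q} → q ℕ.< 2 → V-V (λ a b → if b ℕ.≡ᵇ q then x a p else 0#) ≈ 0#
        right-VV-<2 p q<2 = ∑-miss n (2 ℕ.+_) (λ j → x j p) λ j _ eq → ℕP.<⇒≱ q<2 (≡.subst (2 ℕ.≤_) eq (ℕ.s≤s (ℕ.s≤s ℕ.z≤n)))

        left-VW-2+ : ∀ q {i} → i ℕ.< n → V-W (λ a b → if a ℕ.≡ᵇ 2 ℕ.+ i then x q b else 0#) ≈ x q (suc L ℕ.+ i)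
        left-VW-2+ q i<n = ∑-hit n 2+-injective (λ j → x q (suc L ℕ.+ j)) i<n ≡.refl

        left-VW-<2 : ∀ q {p} → p ℕ.< 2 → V-W (λ a b → if a ℕ.≡ᵇ p then x q b else 0#) ≈ 0#
        left-VW-<2 q p<2 = ∑-miss n (2 ℕ.+_) (λ j → x q (suc L ℕ.+ j)) λ j _ eq → ℕP.<⇒≱ p<2 (≡.subst (2 ℕ.≤_) eq (ℕ.s≤s (ℕ.s≤s ℕ.z≤n)))

        left-VW-large : ∀ q r → V-W (λ a b → if a ℕ.≡ᵇ suc L ℕ.+ r then x q b else 0#) ≈ 0#
        left-VW-large q r = ∑-miss n (2 ℕ.+_) (λ j → x q (suc L ℕ.+ j)) λ j j<n → small≢large (inner j<n)

        left-VV-large : ∀ q r → V-V (λ a b → if a ℕ.≡ᵇ suc L ℕ.+ r then x q b else 0#) ≈ 0#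
        left-VV-large q r = ∑-miss n id (λ j → x q (2 ℕ.+ j)) λ j j<n → small≢large (ℕP.≤-trans (ℕP.m≤n+m j 2) (inner j<n))

        left-VV-zero : ∀ {q} → L ℕ.< q → ∀ p → V-V (λ a b → if a ℕ.≡ᵇ p then x q b else 0#) ≈ 0#
        left-VV-zero {q} L<q p = ∑-0 λ j → if-0 (toℕ j ℕ.≡ᵇ p) (zeros q (2 ℕ.+ toℕ j) L<q (inner (Finₚ.toℕ<n j)))

      -- Cut off after column L, where the edges v_j to v_{j+2} end: then `left-VV` has one formula
      -- for all p, and the hypothesis `outside` of `ScalarBlock` holds.
      y : ℕ → ℕ → Carrier
      y i j = if j ℕ.<ᵇ suc L then x i j else 0#

      private
        y-inside : ∀ i {j} → j ℕ.≤ L → y i j ≡ x i j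
        y-inside i {j} j≤L with j ℕ.<ᵇ suc L in eq
        ... | true  = ≡.refl
        ... | false = ⊥-elim (≡.subst T eq (ℕP.<⇒<ᵇ (ℕ.s≤s j≤L)))

        y-outside : ∀ i j → L ℕ.< j → y i j ≈ 0#
        y-outside i j L<j with j ℕ.<ᵇ suc L in eq
        ... | false = refl
        ... | true  = ⊥-elim (ℕP.<⇒≱ L<j (ℕP.m<1+n⇒m≤n (ℕP.<ᵇ⇒< j (suc L) (≡.subst T (≡.sym eq) tt))))

        left-VV : ∀ q p → V-V (λ a b → if a ℕ.≡ᵇ p then x q b else 0#) ≈ y q (2 ℕ.+ p)
        left-VV q p with p ℕ.<? n
        ... | yes p<n = trans (∑-hit n id (λ j → x q (2 ℕ.+ j)) p<n ≡.refl) (sym (reflexive (y-inside q (inner p<n))))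
        ... | no  p≮n = trans (∑-miss n id (λ j → x q (2 ℕ.+ j)) λ { j j<n ≡.refl → p≮n j<n })
                          (sym (y-outside q (2 ℕ.+ p) (ℕ.s≤s (ℕ.s≤s (ℕP.≮⇒≥ p≮n)))))

        right-large : ∀ p {r} → r ℕ.< n → right p (suc L ℕ.+ r) ≈ x (2 ℕ.+ r) p
        right-large p {r} r<n = trans (+-identityʳ _) (trans (+-cong (right-VW-large p r<n) (right-VV-large p r)) (+-identityʳ _))

        right-2+ : ∀ p {i} → i ℕ.< n → right p (2 ℕ.+ i) ≈ x i p
        right-2+ p i<n = trans (+-identityʳ _) (trans (+-cong (right-VW-small p (inner i<n)) (right-VV-2+ p i<n)) (+-identityˡ _))

        right-0 : ∀ p → right p 0 ≈ x 1 p
        right-0 p = trans (+-congʳ (trans (+-cong (right-VW-small p ℕ.z≤n) (right-VV-<2 p (ℕ.s≤s ℕ.z≤n))) (+-identityˡ _))) (+-identityˡ _)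

        right-1 : ∀ p → right p 1 ≈ 0#
        right-1 p = trans (+-identityʳ _) (trans (+-cong (right-VW-small p (ℕ.s≤s ℕ.z≤n)) (right-VV-<2 p (ℕ.s≤s (ℕ.s≤s ℕ.z≤n)))) (+-identityˡ _))

        left-2+ : ∀ q {i} → i ℕ.< n → left (2 ℕ.+ i) q ≈ x q (suc L ℕ.+ i) + y q (4 ℕ.+ i)
        left-2+ q {i} i<n = trans (+-identityʳ _) (+-cong (left-VW-2+ q i<n) (left-VV q (2 ℕ.+ i)))

        left-0 : ∀ q → left 0 q ≈ y q 2
        left-0 q = trans (+-identityʳ _) (trans (+-cong (left-VW-<2 q (ℕ.s≤s ℕ.z≤n)) (left-VV q 0)) (+-identityˡ _))

        left-1 : ∀ q → left 1 q ≈ y q 3 + x q 0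
        left-1 q = +-congʳ (trans (+-cong (left-VW-<2 q (ℕ.s≤s (ℕ.s≤s ℕ.z≤n))) (left-VV q 1)) (+-identityˡ _))

        left-large : ∀ q r → left (suc L ℕ.+ r) q ≈ 0#
        left-large q r = trans (+-identityʳ _) (trans (+-cong (left-VW-large q r) (left-VV-large q r)) (+-identityˡ _))

        a-0≈a : ∀ a → a - 0# ≈ a
        a-0≈a a = trans (+-congˡ -0#≈0#) (+-identityʳ a)

        difference : ∀ {a b} → a - b ≈ 0# → a ≈ b
        difference {a} {b} eq = trans (solve 2 (λ a b → a := (a :- b) :+ b) refl a b) (trans (+-congʳ eq) (+-identityˡ b))

        -- Test matrix E_{p, w_r} with p < 2: no w is attached to v₀ or v₁, so only one entry of X
        -- contributes.
        lower-zeros : ∀ {r} → r ℕ.< n → ∀ {p} → p ℕ.< 2 → x (2 ℕ.+ r) p ≈ 0#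
        lower-zeros {r} r<n {p} p<2 = begin
          x (2 ℕ.+ r) p              ≈⟨ right-large p r<n ⟨
          right p (suc L ℕ.+ r)      ≈⟨ difference (value-≢ p _ (small p≤L) (large r<n) (small≢large p≤L) λ { (L<p , _) → ℕP.<⇒≱ L<p p≤L }) ⟩
          left p (suc L ℕ.+ r)       ≈⟨ left-zero p<2 ⟩
          0#                         ∎
          where
          p≤L : p ℕ.≤ L
          p≤L = ℕP.≤-trans (ℕP.<⇒≤ p<2) (ℕ.s≤s (ℕ.s≤s ℕ.z≤n))
          left-zero : ∀ {p} → p ℕ.< 2 → left p (suc L ℕ.+ r) ≈ 0#
          left-zero {p} p<2 = trans (+-cong (trans (+-cong (left-VW-<2 _ p<2) (left-VV-zero (L<large r) p)) (+-identityˡ _))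
            (if-0 (1 ℕ.≡ᵇ p) (zeros _ 0 (L<large r) ℕ.z≤n))) (+-identityˡ _)

        -- Test matrix E_{v_{t+2}, w_r}: the edges between the v and the w make the action on V / V₁
        -- a copy of the block on v₂, v₃, ....
        corner : ∀ {r t} → r ℕ.< n → t ℕ.< n → x (2 ℕ.+ r) (2 ℕ.+ t) ≈ x (suc L ℕ.+ r) (suc L ℕ.+ t)
        corner {r} {t} r<n t<n = begin
          x (2 ℕ.+ r) (2 ℕ.+ t)             ≈⟨ right-large (2 ℕ.+ t) r<n ⟨
          right (2 ℕ.+ t) (suc L ℕ.+ r)     ≈⟨ difference (value-≢ (2 ℕ.+ t) _ (small (inner t<n)) (large r<n) (small≢large (inner t<n))
                                                 λ { (L<p , _) → ℕP.<⇒≱ L<p (inner t<n) }) ⟩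
          left (2 ℕ.+ t) (suc L ℕ.+ r)      ≈⟨ trans (+-identityʳ _) (+-cong (left-VW-2+ _ t<n) (left-VV-zero (L<large r) (2 ℕ.+ t))) ⟩
          x (suc L ℕ.+ r) (suc L ℕ.+ t) + 0# ≈⟨ +-identityʳ _ ⟩
          x (suc L ℕ.+ r) (suc L ℕ.+ t)     ∎

        -- Test matrix E_{w_t, w_r}: no edge starts at a w, hence the left product contributes
        -- nothing.
        nilradical : ∀ {r t} → r ℕ.< n → t ℕ.< n → x (2 ℕ.+ r) (suc L ℕ.+ t) ≈ value (suc L ℕ.+ t) (suc L ℕ.+ r)
        nilradical {r} {t} r<n t<n = sym (trans (+-cong (right-large _ r<n) (-‿cong (left-large _ t))) (a-0≈a _))

        nilradical-≡ : ∀ {r} → r ℕ.< n → x (2 ℕ.+ r) (suc L ℕ.+ r) ≈ s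
        nilradical-≡ r<n = trans (nilradical r<n r<n) (value-≡ _ (large r<n))

        nilradical-≢ : ∀ {r t} → r ℕ.< n → t ℕ.< n → t ≢ r → x (2 ℕ.+ r) (suc L ℕ.+ t) ≈ 0#
        nilradical-≢ {r} r<n t<n t≢r = trans (nilradical r<n t<n)
          (value-≢ _ _ (large t<n) (large r<n) (t≢r ∘ L+-injective) λ { (_ , q≤L) → ℕP.<⇒≱ (L<large r) q≤L })

        value-V : ∀ {p q} → p ℕ.≤ L → q ℕ.≤ L → p ≢ q → right p q ≈ left p q
        value-V p≤L q≤L p≢q = difference (value-≢ _ _ (small p≤L) (small q≤L) p≢q λ { (L<p , _) → ℕP.<⇒≱ L<p p≤L })

        0≤L : 0 ℕ.≤ L
        0≤L = ℕ.z≤n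
        1≤L : 1 ℕ.≤ L
        1≤L = ℕ.s≤s ℕ.z≤n

        outer : ∀ {i} → 2 ℕ.+ i ℕ.≤ L → i ℕ.< n
        outer (ℕ.s≤s le) = le

        -- Test matrix E_{p, v_{i+2}}: the only edge ending at v_{i+2} comes from v_i. The
        -- nilradical entry that also appears for p ≥ 2 is off its diagonal, thus zero.
        shift-off : ∀ i p → 2 ℕ.+ i ℕ.≤ L → p ℕ.≤ L → p ≢ 2 ℕ.+ i → y (2 ℕ.+ i) (2 ℕ.+ p) ≈ y i p
        shift-off i p i≤ p≤L p≢ = sym (begin
          y i p              ≡⟨ y-inside i p≤L ⟩
          x i p              ≈⟨ right-2+ p (outer i≤) ⟨
          right p (2 ℕ.+ i)  ≈⟨ value-V p≤L i≤ p≢ ⟩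
          left p (2 ℕ.+ i)   ≈⟨ left≈ p p≤L p≢ ⟩
          y (2 ℕ.+ i) (2 ℕ.+ p) ∎)
          where
          left≈ : ∀ p → p ℕ.≤ L → p ≢ 2 ℕ.+ i → left p (2 ℕ.+ i) ≈ y (2 ℕ.+ i) (2 ℕ.+ p)
          left≈ zero          p≤L p≢ = left-0 _
          left≈ (suc zero)    p≤L p≢ = trans (left-1 _) (trans (+-congˡ (lower-zeros (outer i≤) (ℕ.s≤s ℕ.z≤n))) (+-identityʳ _))
          left≈ (suc (suc t)) p≤L p≢ = trans (left-2+ _ (outer p≤L))
            (trans (+-congʳ (nilradical-≢ (outer i≤) (outer p≤L) λ { ≡.refl → p≢ ≡.refl })) (+-identityˡ _))

        -- One s is the value of the diagonal test E_pp with p = i + 2, the other is the nilradical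
        -- entry `nilradical-≡` occurring in it.
        shift-diag : ∀ i → 2 ℕ.+ i ℕ.≤ L → y (2 ℕ.+ i) (4 ℕ.+ i) ≈ y i (2 ℕ.+ i) - (s + s)
        shift-diag i i≤ = begin
          y (2 ℕ.+ i) (4 ℕ.+ i)
            ≈⟨ solve 3 (λ a z w → w := a :- ((a :- (z :+ w)) :+ z)) refl (y i (2 ℕ.+ i)) s _ ⟩
          y i (2 ℕ.+ i) - ((y i (2 ℕ.+ i) - (s + y (2 ℕ.+ i) (4 ℕ.+ i))) + s)
            ≈⟨ +-congˡ (-‿cong (+-congʳ diagonal)) ⟩
          y i (2 ℕ.+ i) - (s + s) ∎
          where
          diagonal : y i (2 ℕ.+ i) - (s + y (2 ℕ.+ i) (4 ℕ.+ i)) ≈ s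
          diagonal = begin
            y i (2 ℕ.+ i) - (s + y (2 ℕ.+ i) (4 ℕ.+ i))
              ≈⟨ +-cong (trans (reflexive (y-inside i i≤)) (sym (right-2+ (2 ℕ.+ i) (outer i≤))))
                   (-‿cong (trans (+-congʳ (sym (nilradical-≡ (outer i≤)))) (sym (left-2+ (2 ℕ.+ i) (outer i≤))))) ⟩
            value (2 ℕ.+ i) (2 ℕ.+ i)
              ≈⟨ value-≡ (2 ℕ.+ i) (small i≤) ⟩
            s ∎

        column : ∀ {p} → p ℕ.< 2 → ∀ i → 2 ℕ.+ i ℕ.≤ L → y (2 ℕ.+ i) p ≈ 0#
        column {p} p<2 i i≤ = trans (reflexive (y-inside (2 ℕ.+ i) (ℕP.≤-trans (ℕP.<⇒≤ p<2) (ℕ.s≤s (ℕ.s≤s ℕ.z≤n))))) (lower-zeros (outer i≤) p<2)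

        eq₀₀ : y 1 0 - y 0 2 ≈ s
        eq₀₀ = trans (+-cong (sym (right-0 0)) (-‿cong (sym (left-0 0)))) (value-≡ 0 (small 0≤L))

        eq₁₀ : y 1 2 ≈ 0#
        eq₁₀ = trans (sym (left-0 1)) (trans (sym (value-V 0≤L 1≤L λ ())) (right-1 0))

        eq₀₁ : y 1 1 ≈ y 0 3 + y 0 0
        eq₀₁ = trans (sym (right-0 1)) (trans (value-V 1≤L 0≤L λ ()) (left-1 0))

        eq₁₁ : - y 1 3 - y 1 0 ≈ s
        eq₁₁ = trans (solve 2 (λ a b → (:- a) :- b := con (+ 0) :- (a :+ b)) refl (y 1 3) (y 1 0))
          (trans (+-cong (sym (right-1 1)) (-‿cong (sym (left-1 1)))) (value-≡ 1 (small 1≤L)))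

        s≈0 : s ≈ 0#
        s≈0 = scalar≈0 k torsionFree y s shift-off shift-diag y-outside
          (column (ℕ.s≤s ℕ.z≤n)) (column (ℕ.s≤s (ℕ.s≤s ℕ.z≤n))) eq₀₀ eq₁₀ eq₀₁ eq₁₁

        y-scalar : ∀ i j → i ℕ.≤ L → j ℕ.≤ L → y i j ≈ (if i ℕ.≡ᵇ j then x 0 0 else 0#)
        y-scalar = scalar k torsionFree y s shift-off shift-diag y-outside
          (column (ℕ.s≤s ℕ.z≤n)) (column (ℕ.s≤s (ℕ.s≤s ℕ.z≤n))) eq₀₀ eq₁₀ eq₀₁ eq₁₁

        y-zero : ∀ i j → i ℕ.≤ L → i ≢ j → y i j ≈ 0#
        y-zero i j i≤L i≢j with j ℕ.≤? L
        ... | no  j≰L = y-outside i j (ℕP.≰⇒> j≰L)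
        ... | yes j≤L = trans (y-scalar i j i≤L j≤L) (reflexive (≡.cong (λ b → if b then x 0 0 else 0#) (≢⇒≡ᵇ-false i≢j)))

        x-scalar : ∀ {i j} → i ℕ.≤ L → j ℕ.≤ L → x i j ≈ (if i ℕ.≡ᵇ j then x 0 0 else 0#)
        x-scalar {i} {j} i≤L j≤L = trans (sym (reflexive (y-inside i j≤L))) (y-scalar i j i≤L j≤L)

        -- Rows 0 and 1 are reached by testing with E_{v_{t+2}, v_0} and E_{v_{t+2}, v_1}, once the
        -- block on V₁ is known to be scalar. The other rows were found before, with s on the
        -- diagonal.
        nilradical-0 : ∀ {i t} → i ℕ.≤ L → t ℕ.< n → x i (suc L ℕ.+ t) ≈ 0#
        nilradical-0 {zero} {t} _ t<n = begin
          x 0 (suc L ℕ.+ t)                  ≈⟨ trans (+-congˡ (y-zero 0 (4 ℕ.+ t) 0≤L λ ())) (+-identityʳ _) ⟨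
          x 0 (suc L ℕ.+ t) + y 0 (4 ℕ.+ t)  ≈⟨ left-2+ 0 t<n ⟨
          left (2 ℕ.+ t) 0                   ≈⟨ value-V (inner t<n) 0≤L (λ ()) ⟨
          right (2 ℕ.+ t) 0                  ≈⟨ right-0 (2 ℕ.+ t) ⟩
          x 1 (2 ℕ.+ t)                      ≈⟨ x-scalar 1≤L (inner t<n) ⟩
          0#                                 ∎
        nilradical-0 {suc zero} {t} _ t<n = begin
          x 1 (suc L ℕ.+ t)                  ≈⟨ trans (+-congˡ (y-zero 1 (4 ℕ.+ t) 1≤L λ ())) (+-identityʳ _) ⟨
          x 1 (suc L ℕ.+ t) + y 1 (4 ℕ.+ t)  ≈⟨ left-2+ 1 t<n ⟨
          left (2 ℕ.+ t) 1                   ≈⟨ value-V (inner t<n) 1≤L (λ ()) ⟨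
          right (2 ℕ.+ t) 1                  ≈⟨ right-1 (2 ℕ.+ t) ⟩
          0#                                 ∎
        nilradical-0 {suc (suc r)} {t} i≤L t<n with t ℕ.≟ r
        ... | no  t≢r    = nilradical-≢ (outer i≤L) t<n t≢r
        ... | yes ≡.refl = trans (nilradical-≡ t<n) s≈0

        position : ∀ a → a ℕ.< suc L ℕ.+ n → a ℕ.≤ L ⊎ Σ ℕ λ r → r ℕ.< n × a ≡ suc L ℕ.+ r
        position a a<N with a ℕ.≤? L
        ... | yes a≤L = inj₁ a≤L
        ... | no  a≰L = inj₂ (a ℕ.∸ suc L ,
          ℕP.+-cancelˡ-< (suc L) _ _ (≡.subst (ℕ._< suc L ℕ.+ n) (≡.sym (ℕP.m+[n∸m]≡n (ℕP.≰⇒> a≰L))) a<N) ,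
          ≡.sym (ℕP.m+[n∸m]≡n (ℕP.≰⇒> a≰L)))

      kernel-scalar : ∀ a b → a ℕ.< suc L ℕ.+ n → b ℕ.< suc L ℕ.+ n → x a b ≈ (if a ℕ.≡ᵇ b then x 0 0 else 0#)
      kernel-scalar a b a<N b<N with position a a<N | position b b<N
      ... | inj₁ a≤L | inj₁ b≤L = x-scalar a≤L b≤L
      ... | inj₁ a≤L | inj₂ (t , t<n , ≡.refl) = trans (nilradical-0 a≤L t<n)
        (reflexive (≡.cong (λ b → if b then x 0 0 else 0#) (≡.sym (≢⇒≡ᵇ-false (small≢large a≤L)))))
      ... | inj₂ (r , r<n , ≡.refl) | inj₁ b≤L = trans (zeros _ _ (L<large r) b≤L)
        (reflexive (≡.cong (λ b → if b then x 0 0 else 0#) (≡.sym (≢⇒≡ᵇ-false (small≢large b≤L ∘ ≡.sym)))))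
      ... | inj₂ (r , r<n , ≡.refl) | inj₂ (t , t<n , ≡.refl) = trans (sym (corner r<n t<n))
        (trans (x-scalar (inner r<n) (inner t<n)) (reflexive (≡.cong (λ b → if b then x 0 0 else 0#) (same (suc L)))))
        where
        same : ∀ a → (r ℕ.≡ᵇ t) ≡ (a ℕ.+ r ℕ.≡ᵇ a ℕ.+ t)
        same zero    = ≡.refl
        same (suc a) = same a

-- Weights of the basis vectors.

module Weights (k : ℕ) where
  L : ℕ
  L = suc (suc (k ℕ.+ k))

  size≡ : sizeN (suc k) ≡ suc L ℕ.+ suc (k ℕ.+ k)
  size≡ = solve 1 (λ k → con 4 :* (con 1 :+ k) := con 3 :+ (k :+ k) :+ (con 1 :+ (k :+ k))) ≡.refl k
    where open +-*-Solver

  2m≡L : 2 ℕ.* suc k ≡ L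
  2m≡L = solve 1 (λ k → con 2 :* (con 1 :+ k) := con 2 :+ (k :+ k)) ≡.refl k
    where open +-*-Solver

  -- The eigenvalue of the principal element on the basis vector at a position,
  -- up to a common summand: v₀, v₁, v₂, … have weights m, m+1, m-1, m, …, and the
  -- weight of w_j is one less than that of v_{j+2}.
  weightV : ℕ → ℤ
  weightV zero          = + suc k
  weightV (suc zero)    = + suc (suc k)
  weightV (suc (suc j)) = weightV j ℤ.- + 1

  weight : ℕ → ℤ
  weight a = if a ℕ.<ᵇ suc L then weightV a else weightV (2 ℕ.+ (a ℕ.∸ suc L)) ℤ.- + 1

  labelWeight : Label (sizeN (suc k)) → ℤ
  labelWeight l = weight (toℕ (Labels.row (suc k) l)) ℤ.- weight (toℕ (Labels.col (suc k) l))

  weight-V : ∀ {a} → a ℕ.≤ L → weight a ≡ weightV a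
  weight-V {a} a≤L with a ℕ.<ᵇ suc L in eq
  ... | true  = ≡.refl
  ... | false = ⊥-elim (≡.subst T eq (ℕP.<⇒<ᵇ (ℕ.s≤s a≤L)))

  weight-W : ∀ j → weight (suc L ℕ.+ j) ≡ weightV (2 ℕ.+ j) ℤ.- + 1
  weight-W j with suc L ℕ.+ j ℕ.<ᵇ suc L in eq
  ... | false = ≡.cong (λ i → weightV (2 ℕ.+ i) ℤ.- + 1) (ℕP.m+n∸m≡n L j)
  ... | true  = ⊥-elim (ℕP.<⇒≱ (ℕP.<ᵇ⇒< (suc L ℕ.+ j) (suc L) (≡.subst T (≡.sym eq) tt)) (ℕP.m≤m+n (suc L) j))

-- The standard functional is Frobenius, with diagonal principal element.

module StandardFrobenius {c ℓ : Level} (K : Field c ℓ) (charZero : CharZero K) (k : ℕ) where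
  open Field K hiding (zero)
  open IntegerCoefficients commutativeRing using (nat; int; int--; solve; con; _:=_; _:+_; _:*_; _:-_; :-_)
  open Sums commutativeRing
  open Determinant commutativeRing
  open FrobeniusForm commutativeRing
  open Labels (suc k)
  open Seaweed (suc k) commutativeRing
  open SeaweedBracket (suc k) commutativeRing
  open Bracket bracket-isLie
  open OverField K charZero (suc k)
  open ExtensionByZero commutativeRing
  open StandardFunctional commutativeRing k
  open Weights k using (size≡; 2m≡L; weight; weight-V; weight-W; labelWeight)
  open import Algebra.Properties.Ring ring
  open import Algebra.Properties.Monoid.Sum *-monoid using () renaming (sum to product; sum-cong-≋ to product-cong)
  import Algebra.Properties.Semiring.Mult semiring as Mult
  open import Relation.Binary.Reasoning.Setoid setoid

  functional-cong : ∀ {x y : ℕ → ℕ → Carrier} → (∀ a b → x a b ≈ y a b) → functional x ≈ functional y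
  functional-cong x≈y = +-cong (+-cong (∑-cong λ j → x≈y _ _) (∑-cong λ j → x≈y _ _)) (x≈y 1 0)

  functional-linear : ∀ a (x y : ℕ → ℕ → Carrier) →
    functional (λ i j → a * x i j + y i j) ≈ a * functional x + functional y
  functional-linear a x y = trans (+-congʳ (+-cong
      (trans (∑-+ _ _) (+-congʳ (sym (*-∑ a _)))) (trans (∑-+ _ _) (+-congʳ (sym (*-∑ a _))))))
    (solve 7 (λ a p q r p′ q′ r′ → ((a :* p :+ p′) :+ (a :* q :+ q′)) :+ (a :* r :+ r′)
                                := a :* ((p :+ q) :+ r) :+ ((p′ :+ q′) :+ r′)) refl a
      (V-W x) (V-V x) (x 1 0) (V-W y) (V-V y) (y 1 0))

  functional-- : ∀ (x y : ℕ → ℕ → Carrier) → functional (λ i j → x i j - y i j) ≈ functional x - functional y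
  functional-- x y = trans (functional-cong {λ i j → x i j - y i j} {λ i j → - 1# * y i j + x i j} λ a b →
      trans (+-comm _ _) (+-congʳ (sym (-1*x≈-x (y a b)))))
    (trans (functional-linear (- 1#) y x) (trans (+-congʳ (-1*x≈-x _)) (+-comm _ _)))

  φ : Square → Carrier
  φ X = functional (at X)

  φ-cong : ∀ {X Y} → X ≋ Y → φ X ≈ φ Y
  φ-cong X≋Y = functional-cong (at-cong X≋Y)

  standard : Vect d
  standard a = φ (mat (δ a))

  pairing-standard : ∀ {X} → Member X → pairing standard (coords X) ≈ φ X
  pairing-standard {X} mX = begin
    pairing standard (coords X)            ≈⟨ ∑-cong (λ a → *-comm _ _) ⟩
    ∑[ a ] (coords X a * φ (mat (δ a)))    ≈⟨ linear-δ (φ ∘ mat) (φ-cong ∘ mat-cong) φ-mat-linear (coords X) ⟨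
    φ (mat (coords X))                     ≈⟨ φ-cong (mat-coords mX) ⟩
    φ X                                    ∎
    where
    φ-mat-linear : ∀ a x y → φ (mat (a ⊙ x ⊕ y)) ≈ a * φ (mat x) + φ (mat y)
    φ-mat-linear a x y = trans
      (functional-cong λ i j → trans (at-cong (mat-linear a x y) i j)
        (trans (at-+ (λ i j → a * mat x i j) (mat y) i j) (+-congʳ (at-⊙ a (mat x) i j))))
      (functional-linear a (at (mat x)) (at (mat y)))

  module _ (X : Square) where
    open Kernel torsionFree (at X)

    φ-comm-unit : ∀ p q → φ (comm X (unit (toℕ p) (toℕ q))) ≈ value 0# (toℕ p) (toℕ q)
    φ-comm-unit p q = trans
      (functional-cong λ a b → trans (at-- (X ⊡ U) (U ⊡ X) a b) (+-cong (rightAt a b) (-‿cong (leftAt a b))))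
      (functional-- (λ a b → if b ℕ.≡ᵇ toℕ q then at X a (toℕ p) else 0#) (λ a b → if a ℕ.≡ᵇ toℕ p then at X (toℕ q) b else 0#))
      where
      U : Square
      U = unit (toℕ p) (toℕ q)
      right⊡ : ∀ i j → (X ⊡ U) i j ≈ (if toℕ j ℕ.≡ᵇ toℕ q then X i p else 0#)
      right⊡ i j = trans
        (∑-single _ p λ l p≢l → trans (*-congˡ (reflexive (unit-row _ j (p≢l ∘ ≡.sym ∘ Finₚ.toℕ-injective)))) (zeroʳ _))
        at-p
        where
        at-p : X i p * U p j ≈ (if toℕ j ℕ.≡ᵇ toℕ q then X i p else 0#)
        at-p rewrite ≡ᵇ-refl (toℕ p) with toℕ j ℕ.≡ᵇ toℕ q
        ... | true  = *-identityʳ _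
        ... | false = zeroʳ _
      left⊡ : ∀ i j → (U ⊡ X) i j ≈ (if toℕ i ℕ.≡ᵇ toℕ p then X q j else 0#)
      left⊡ i j = trans
        (∑-single _ q λ l q≢l → trans (*-congʳ (reflexive (unit-col {p = l} _ i (q≢l ∘ ≡.sym ∘ Finₚ.toℕ-injective)))) (zeroˡ _))
        at-q
        where
        at-q : U i q * X q j ≈ (if toℕ i ℕ.≡ᵇ toℕ p then X q j else 0#)
        at-q rewrite ≡ᵇ-refl (toℕ q) with toℕ i ℕ.≡ᵇ toℕ p
        ... | true  = *-identityˡ _
        ... | false = zeroˡ _
      rightAt : ∀ a b → at (X ⊡ U) a b ≈ (if b ℕ.≡ᵇ toℕ q then at X a (toℕ p) else 0#)
      rightAt a b = trans (at-cong right⊡ a b) (trans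
        (entry-cong (λ i → trans (entry-indicator q (X i p) b)
          (reflexive (≡.cong (λ v → if b ℕ.≡ᵇ toℕ q then v else 0#) (≡.sym (entry-toℕ (X i) p))))) a)
        (entry-if (b ℕ.≡ᵇ toℕ q) (λ i → entry (X i) (toℕ p)) a))
      leftAt : ∀ a b → at (U ⊡ X) a b ≈ (if a ℕ.≡ᵇ toℕ p then at X (toℕ q) b else 0#)
      leftAt a b = trans (at-cong left⊡ a b) (trans
        (entry-cong (λ (i : Fin N) → entry-if (toℕ i ℕ.≡ᵇ toℕ p) (X q) b) a)
        (trans (entry-indicator p (entry (X q) b) a)
          (reflexive (≡.cong (λ v → if a ℕ.≡ᵇ toℕ p then v else 0#) (≡.sym (entry-toℕ (λ i → entry (X i) b) q))))))

  allowed-false : ∀ {i j : Fin N} → L ℕ.< toℕ i → toℕ j ℕ.≤ L → allowedᵇ (suc k) i j ≡ false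
  allowed-false {i} {j} L<i j≤L = ≡.cong not (≡.cong₂ _∧_
    (true≡ (≡.subst (λ a → T (a ℕ.<ᵇ toℕ i)) (≡.sym 2m≡L) (ℕP.<⇒<ᵇ L<i)))
    (true≡ (≡.subst (λ a → T (toℕ j ℕ.<ᵇ a)) (≡.trans (ℕP.+-comm 1 L) (≡.cong (ℕ._+ 1) (≡.sym 2m≡L))) (ℕP.<⇒<ᵇ (ℕ.s≤s j≤L)))))
    where
    true≡ : ∀ {b} → T b → b ≡ true
    true≡ {true} _ = ≡.refl

  allowed-true : ∀ {i j : Fin N} → ¬ (L ℕ.< toℕ i × toℕ j ℕ.≤ L) → T (allowedᵇ (suc k) i j)
  allowed-true {i} {j} ok with 2 ℕ.* suc k ℕ.<ᵇ toℕ i in eq₁ | toℕ j ℕ.<ᵇ 2 ℕ.* suc k ℕ.+ 1 in eq₂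
  ... | false | _     = tt
  ... | true  | false = tt
  ... | true  | true  = ok
    ( ≡.subst (ℕ._< toℕ i) 2m≡L (ℕP.<ᵇ⇒< _ _ (≡.subst T (≡.sym eq₁) tt))
    , ℕP.m<1+n⇒m≤n (≡.subst (toℕ j ℕ.<_) (≡.trans (ℕP.+-comm _ 1) (≡.cong suc 2m≡L)) (ℕP.<ᵇ⇒< _ _ (≡.subst T (≡.sym eq₂) tt))))

  ∧-T : ∀ {a b} → T a → T b → T (a ∧ b)
  ∧-T {true} _ b = b

  not-T : ∀ {b} → b ≡ false → T (not b)
  not-T ≡.refl = tt

  index : ∀ a → a ℕ.< suc L ℕ.+ n → Σ (Fin N) λ i → toℕ i ≡ a
  index a a<N = Fin.fromℕ< a<N′ , Finₚ.toℕ-fromℕ< a<N′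
    where
    a<N′ : a ℕ.< N
    a<N′ = ≡.subst (a ℕ.<_) (≡.sym size≡) a<N

  small-index : ∀ {a} → a ℕ.≤ L → a ℕ.< suc L ℕ.+ n
  small-index a≤L = ℕP.≤-trans (ℕ.s≤s a≤L) (ℕP.m≤m+n (suc L) n)

  at-zeros : ∀ {X} → Member X → ∀ i j → L ℕ.< i → j ℕ.≤ L → at X i j ≈ 0#
  at-zeros {X} (_ , zeros) i j L<i j≤L with i ℕ.<? suc L ℕ.+ n
  ... | no  i≮N = reflexive (entry-outside (λ p → entry (X p) j) i (≡.subst (ℕ._≤ i) (≡.sym size≡) (ℕP.≮⇒≥ i≮N)))
  ... | yes i<N with index i i<N | index j (small-index j≤L)
  ...   | p , ≡.refl | q , ≡.refl = trans (reflexive (at-toℕ X p q)) (zeros p q (allowed-false {p} {q} L<i j≤L))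

  comm-sub : ∀ (X A B : Square) → comm X (λ i j → A i j - B i j) ≋ (λ i j → comm X A i j - comm X B i j)
  comm-sub X A B i j = trans (+-cong (⊡-subʳ A B X i j) (-‿cong (⊡-subˡ A B X i j)))
    (solve 4 (λ p q r s → (p :- q) :- (r :- s) := (p :- r) :- (q :- s)) refl _ _ _ _)

  -- A matrix in the kernel is scalar by `kernel-scalar`, and a scalar matrix of trace zero vanishes
  -- in characteristic zero.
  standard-frobenius : Frobenius standard
  standard-frobenius X mX kills i j = begin
    X i j                    ≡⟨ at-toℕ X i j ⟨
    at X (toℕ i) (toℕ j)     ≈⟨ entries (toℕ i) (toℕ j) (bounded i) (bounded j) ⟩
    (if toℕ i ℕ.≡ᵇ toℕ j then at X 0 0 else 0#) ≈⟨ if-0 (toℕ i ℕ.≡ᵇ toℕ j) x₀₀≈0 ⟩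
    0#                       ∎
    where
    open Kernel torsionFree (at X)
    bounded : ∀ (i : Fin N) → toℕ i ℕ.< suc L ℕ.+ n
    bounded i = ≡.subst (toℕ i ℕ.<_) size≡ (Finₚ.toℕ<n i)
    φ-kills : ∀ {Y} → Member Y → φ (comm X Y) ≈ 0#
    φ-kills {Y} mY = trans (sym (pairing-standard (comm-member mX mY))) (kills Y mY)
    value-≢ : ∀ p q → p ℕ.< suc L ℕ.+ n → q ℕ.< suc L ℕ.+ n → p ≢ q → ¬ (L ℕ.< p × q ℕ.≤ L) → value 0# p q ≈ 0#
    value-≢ p q p<N q<N p≢q ok with index p p<N | index q q<N
    ... | a , ≡.refl | b , ≡.refl = trans (sym (φ-comm-unit X a b))
      (φ-kills {basis (off a b)} (trace-basis (off a b) v , zeros-basis (off a b) v))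
      where
      v : Valid (off a b)
      v = ∧-T (not-T (≢⇒≡ᵇ-false p≢q)) (allowed-true {a} {b} ok)
    value-≡ : ∀ p → p ℕ.< suc L ℕ.+ n → value 0# p p ≈ value 0# 0 0
    value-≡ zero    p<N = refl
    value-≡ (suc p) p<N with index (suc p) p<N
    ... | a , a≡ = begin
      value 0# (suc p) (suc p)                       ≡⟨ ≡.cong (λ r → value 0# r r) a≡ ⟨
      value 0# (toℕ a) (toℕ a)                       ≈⟨ φ-comm-unit X a a ⟨
      φ (comm X (unit (toℕ a) (toℕ a)))              ≈⟨ solve 2 (λ p q → p := (p :- q) :+ q) refl (φ (comm X (unit (toℕ a) (toℕ a)))) (φ (comm X (unit 0 0))) ⟩
      (φ (comm X (unit (toℕ a) (toℕ a))) - φ (comm X (unit 0 0))) + φ (comm X (unit 0 0))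
        ≈⟨ +-cong (trans (sym (functional-- (at (comm X (unit (toℕ a) (toℕ a)))) (at (comm X (unit 0 0))))) (trans (functional-cong λ i j → trans (sym (at-- (comm X (unit (toℕ a) (toℕ a))) (comm X (unit 0 0)) i j))
             (sym (at-cong (comm-sub X (unit (toℕ a) (toℕ a)) (unit 0 0)) i j)))
             (φ-kills {basis (cart a)} (trace-basis (cart a) v , zeros-basis (cart a) v)))) (φ-comm-unit X zero zero) ⟩
      0# + value 0# 0 0                              ≈⟨ +-identityˡ _ ⟩
      value 0# 0 0                                   ∎
      where
      v : Valid (cart a)
      v = ≡.subst (λ r → T (not (r ℕ.≡ᵇ 0))) (≡.sym a≡) tt
    entries : ∀ a b → a ℕ.< suc L ℕ.+ n → b ℕ.< suc L ℕ.+ n → at X a b ≈ (if a ℕ.≡ᵇ b then at X 0 0 else 0#)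
    -- The common value s of the diagonal tests is that of E_00, the functional at [X, E_00].
    entries = kernel-scalar (value 0# 0 0) (at-zeros mX) value-≢ value-≡
    x₀₀≈0 : at X 0 0 ≈ 0#
    -- The size N = 4 (k + 1) unfolds to the successor of this number.
    x₀₀≈0 = torsionFree (k ℕ.+ 3 ℕ.* suc k) (at X 0 0) (begin
      nat N * at X 0 0         ≈⟨ Mult.×-assoc-* N 1# (at X 0 0) ⟩
      N Mult.× (1# * at X 0 0) ≈⟨ Mult.×-congʳ N (*-identityˡ _) ⟩
      N Mult.× at X 0 0        ≈⟨ ∑-replicate N (at X 0 0) ⟨
      ∑ {N} (λ i → at X 0 0)   ≈⟨ ∑-cong (λ i → trans (sym (entries-diag i)) (reflexive (at-toℕ X i i))) ⟩
      trace X                  ≈⟨ proj₁ mX ⟩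
      0#                       ∎)
      where
      entries-diag : ∀ i → at X (toℕ i) (toℕ i) ≈ at X 0 0
      entries-diag i = trans (entries (toℕ i) (toℕ i) (bounded i) (bounded i))
        (reflexive (≡.cong (λ b → if b then at X 0 0 else 0#) (≡ᵇ-refl (toℕ i))))

  g : ℕ → Carrier
  g a = int (weight a)

  private
    unitN : Σ Carrier λ u → nat N * u ≈ 1#
    unitN = inverse (nat N) λ eq → charZero (k ℕ.+ 3 ℕ.* suc k) (trans (reflexive (natK≡nat N)) eq)

    average : Carrier
    average = proj₁ unitN * ∑ {N} (λ i → g (toℕ i))

  -- Subtracting the mean makes the trace zero and leaves all commutators unchanged.
  standardPrincipal : Square
  standardPrincipal i j = δ i j * (g (toℕ i) - average)

  comm-standardPrincipal : ∀ X i j → comm standardPrincipal X i j ≈ g (toℕ i) * X i j - g (toℕ j) * X i j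
  comm-standardPrincipal X i j = begin
    (standardPrincipal ⊡ X) i j - (X ⊡ standardPrincipal) i j
      ≈⟨ +-cong
           (trans (∑-cong λ l → *-assoc (δ i l) _ _) (∑-δ i (λ l → (g (toℕ i) - average) * X l j)))
           (-‿cong (trans (∑-single _ j λ l j≢l → trans (*-congˡ (trans (*-congʳ (reflexive (δ-off (j≢l ∘ ≡.sym)))) (zeroˡ _))) (zeroʳ _))
             (*-congˡ (trans (*-congʳ (reflexive (δ-refl j))) (*-identityˡ _))))) ⟩
    (g (toℕ i) - average) * X i j - X i j * (g (toℕ j) - average)
      ≈⟨ solve 4 (λ a b c x → (a :- c) :* x :- x :* (b :- c) := a :* x :- b :* x) refl (g (toℕ i)) (g (toℕ j)) average (X i j) ⟩
    g (toℕ i) * X i j - g (toℕ j) * X i j ∎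

  standard-principal : Principal standard standardPrincipal
  standard-principal = (trace≈0 , zeros) , λ X mX → begin
      pairing standard (coords (comm standardPrincipal X))  ≈⟨ pairing-standard (comm-member (trace≈0 , zeros) mX) ⟩
      φ (comm standardPrincipal X)                          ≈⟨ φ-eigen X ⟩
      φ X                                                   ≈⟨ pairing-standard mX ⟨
      pairing standard (coords X)                           ∎
    where
    trace≈0 : trace standardPrincipal ≈ 0#
    trace≈0 = begin
      ∑[ i ] (δ i i * (g (toℕ i) - average))   ≈⟨ ∑-cong (λ (i : Fin N) → trans (*-congʳ (reflexive (δ-refl i))) (*-identityˡ _)) ⟩
      ∑ {N} (λ i → g (toℕ i) - average)        ≈⟨ ∑-- {N} (g ∘ toℕ) (λ _ → average) ⟩
      total - ∑ {N} (λ i → average)            ≈⟨ +-congˡ (-‿cong (trans (∑-replicate N average)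
                                                    (trans (Mult.×-congʳ N (sym (*-identityˡ _))) (sym (Mult.×-assoc-* N 1# average))))) ⟩
      total - nat N * average                  ≈⟨ +-congˡ (-‿cong (trans (sym (*-assoc _ _ _)) (trans (*-congʳ (proj₂ unitN)) (*-identityˡ _)))) ⟩
      total - total                            ≈⟨ -‿inverseʳ total ⟩
      0#                                       ∎
      where
      total : Carrier
      total = ∑ {N} (λ i → g (toℕ i))
    zeros : ∀ i j → allowedᵇ (suc k) i j ≡ false → standardPrincipal i j ≈ 0#
    zeros i j forbidden with i Fin.≟ j
    ... | no _       = zeroˡ _
    ... | yes ≡.refl = ⊥-elim (≡.subst T forbidden (allowed-true {i} {i} λ { (L<i , i≤L) → ℕP.<⇒≱ L<i i≤L }))
    φ-eigen : ∀ X → φ (comm standardPrincipal X) ≈ φ X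
    -- Along every edge the weight drops by exactly 1, so each entry read by `φ` is multiplied by 1.
    φ-eigen X = trans (functional-cong atComm) (+-cong (+-cong
        (∑-cong {n} λ j → edge (2 ℕ.+ toℕ j) (suc L ℕ.+ toℕ j) (weight-V (ℕ.s≤s (Finₚ.toℕ<n j))) (weight-W (toℕ j)))
        (∑-cong {n} λ j → edge (toℕ j) (2 ℕ.+ toℕ j)
          (weight-V (ℕP.≤-trans (ℕP.m≤n+m (toℕ j) 2) (ℕ.s≤s (Finₚ.toℕ<n j)))) (weight-V (ℕ.s≤s (Finₚ.toℕ<n j)))))
        (edge 1 0 (weight-V {1} (ℕ.s≤s ℕ.z≤n)) (weight-V {0} ℕ.z≤n)))
      where
      atComm : ∀ a b → at (comm standardPrincipal X) a b ≈ g a * at X a b - g b * at X a b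
      atComm a b = trans (at-cong (comm-standardPrincipal X) a b)
        (trans (at-- (λ i j → g (toℕ i) * X i j) (λ i j → g (toℕ j) * X i j) a b)
          (+-cong (at-rows g X a b) (-‿cong (at-columns g X a b))))
      edge : ∀ a b {z} → weight a ≡ z → weight b ≡ z ℤ.- + 1 → g a * at X a b - g b * at X a b ≈ at X a b
      edge a b {z} a≡ b≡ = begin
        g a * at X a b - g b * at X a b   ≈⟨ +-cong (*-congʳ (reflexive (≡.cong int a≡))) (-‿cong (*-congʳ (trans (reflexive (≡.cong int b≡)) (int-- z (+ 1))))) ⟩
        int z * at X a b - (int z - nat 1) * at X a b ≈⟨ solve 2 (λ z x → z :* x :- (z :- con (+ 1)) :* x := con (+ 1) :* x) refl (int z) (at X a b) ⟩
        nat 1 * at X a b                  ≈⟨ trans (*-congʳ (+-identityʳ 1#)) (*-identityˡ _) ⟩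
        at X a b                          ∎

  -- The basis consists of eigenvectors of the adjoint action. A Cartan label has equal row and
  -- column, hence weight 0, so one formula serves both kinds of labels.
  standard-charPoly : ∀ t → det (charMatrix t (coords standardPrincipal)) ≈ product (λ a → t - int (labelWeight (labelAt (suc k) a)))
  standard-charPoly t = trans (det-diagonal (charMatrix t (coords standardPrincipal)) off-diagonal) (product-cong on-diagonal)
    where
    ad-entry : ∀ a b → ad (coords standardPrincipal) a b ≈
      int (labelWeight (labelAt (suc k) a)) * basis (labelAt (suc k) b) (row (labelAt (suc k) a)) (col (labelAt (suc k) a))
    ad-entry a b = begin
      ad (coords standardPrincipal) a b
        ≈⟨ comm-cong {Y = mat (δ b)} (mat-coords (proj₁ standard-principal)) (mat-δ b) i j ⟩
      comm standardPrincipal B i j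
        ≈⟨ comm-standardPrincipal B i j ⟩
      g (toℕ i) * B i j - g (toℕ j) * B i j
        ≈⟨ solve 3 (λ p q x → p :* x :- q :* x := (p :- q) :* x) refl (g (toℕ i)) (g (toℕ j)) (B i j) ⟩
      (g (toℕ i) - g (toℕ j)) * B i j
        ≈⟨ *-congʳ (int-- (weight (toℕ i)) (weight (toℕ j))) ⟨
      int (labelWeight (labelAt (suc k) a)) * B i j ∎
      where
      i j : Fin N
      i = row (labelAt (suc k) a)
      j = col (labelAt (suc k) a)
      B : Square
      B = basis (labelAt (suc k) b)
    off-diagonal : ∀ {a b} → a ≢ b → charMatrix t (coords standardPrincipal) a b ≈ 0#
    off-diagonal {a} {b} a≢b = trans (+-cong (trans (*-congˡ (reflexive (δ-off a≢b))) (zeroʳ t))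
      (-‿cong (trans (ad-entry a b) (trans (*-congˡ (coord-other (labelAt (suc k) a) (labelAt (suc k) b) (valid a) (valid b)
        (a≢b ∘ labelAt-injective))) (zeroʳ _))))) (-‿inverseʳ 0#)
    on-diagonal : ∀ a → charMatrix t (coords standardPrincipal) a a ≈ t - int (labelWeight (labelAt (suc k) a))
    on-diagonal a = +-cong (trans (*-congˡ (reflexive (δ-refl a))) (*-identityʳ t))
      (-‿cong (trans (ad-entry a a) (trans (*-congˡ (coord-same (labelAt (suc k) a) (valid a))) (*-identityʳ _))))

-- Sums over the differences of weights.

module Ranges {c ℓ : Level} (M : CommutativeMonoid c ℓ) where
  open CommutativeMonoid M
  open import Algebra.Properties.CommutativeSemigroup commutativeSemigroup using (interchange; x∙yz≈y∙xz)
  open import Algebra.Properties.Monoid.Sum monoid using (sum)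
  open import Relation.Binary.Reasoning.Setoid setoid

  opaque
    range : (ℕ → Carrier) → ℕ → Carrier
    range φ zero    = ε
    range φ (suc n) = φ 0 ∙ range (φ ∘ suc) n

  opaque
    unfolding range

    range-0 : ∀ φ → range φ 0 ≈ ε
    range-0 φ = refl

    range-suc : ∀ φ n → range φ (suc n) ≈ φ 0 ∙ range (φ ∘ suc) n
    range-suc φ n = refl

    sum≈range : ∀ {n} (φ : ℕ → Carrier) → sum {n} (φ ∘ toℕ) ≈ range φ n
    sum≈range {zero}  φ = refl
    sum≈range {suc n} φ = ∙-congˡ (sum≈range {n} (φ ∘ suc))

    range-cong : ∀ {φ ψ} n → (∀ i → i ℕ.< n → φ i ≈ ψ i) → range φ n ≈ range ψ n
    range-cong zero    φ≈ψ = refl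
    range-cong (suc n) φ≈ψ = ∙-cong (φ≈ψ 0 (ℕ.s≤s ℕ.z≤n)) (range-cong n λ i i<n → φ≈ψ (suc i) (ℕ.s≤s i<n))

    range-ε : ∀ {φ} n → (∀ i → i ℕ.< n → φ i ≈ ε) → range φ n ≈ ε
    range-ε zero    φ≈ε = refl
    range-ε (suc n) φ≈ε = trans (∙-cong (φ≈ε 0 (ℕ.s≤s ℕ.z≤n)) (range-ε n λ i i<n → φ≈ε (suc i) (ℕ.s≤s i<n))) (identityˡ ε)

    range-∙ : ∀ φ ψ n → range (λ i → φ i ∙ ψ i) n ≈ range φ n ∙ range ψ n
    range-∙ φ ψ zero    = sym (identityˡ ε)
    range-∙ φ ψ (suc n) = trans (∙-congˡ (range-∙ (φ ∘ suc) (ψ ∘ suc) n)) (interchange _ _ _ _)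

    range-+ : ∀ φ a b → range φ (a ℕ.+ b) ≈ range φ a ∙ range (λ i → φ (a ℕ.+ i)) b
    range-+ φ zero    b = sym (identityˡ _)
    range-+ φ (suc a) b = trans (∙-congˡ (range-+ (φ ∘ suc) a b)) (sym (assoc _ _ _))

    range-snoc : ∀ φ n → range φ (suc n) ≈ range φ n ∙ φ n
    range-snoc φ zero    = comm _ _
    range-snoc φ (suc n) = trans (∙-congˡ (range-snoc (φ ∘ suc) n)) (sym (assoc _ _ _))

    range-reverse : ∀ φ ψ n → (∀ i j → suc (i ℕ.+ j) ≡ n → φ i ≈ ψ j) → range φ n ≈ range ψ n
    range-reverse φ ψ zero    eq = refl
    range-reverse φ ψ (suc n) eq = begin
      φ 0 ∙ range (φ ∘ suc) n  ≈⟨ ∙-cong (eq 0 n ≡.refl) (range-reverse (φ ∘ suc) ψ n λ i j i+j → eq (suc i) j (≡.cong suc i+j)) ⟩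
      ψ n ∙ range ψ n          ≈⟨ comm _ _ ⟩
      range ψ n ∙ ψ n          ≈⟨ range-snoc ψ n ⟨
      range ψ (suc n)          ∎

    -- Positions are separated by parity because the weights along V₁ form two interleaved chains,
    -- each descending by 1.
    range-parity : ∀ φ n → range φ (suc (n ℕ.+ n)) ≈ range (λ q → φ (q ℕ.+ q)) (suc n) ∙ range (λ q → φ (suc (q ℕ.+ q))) n
    range-parity φ zero    = sym (identityʳ _)
    range-parity φ (suc n) rewrite ℕP.+-suc n n = begin
      φ 0 ∙ (φ 1 ∙ range (λ i → φ (2 ℕ.+ i)) (suc (n ℕ.+ n)))
        ≈⟨ ∙-congˡ (∙-congˡ (range-parity (λ i → φ (2 ℕ.+ i)) n)) ⟩
      φ 0 ∙ (φ 1 ∙ (range (λ q → φ (2 ℕ.+ (q ℕ.+ q))) (suc n) ∙ range (λ q → φ (3 ℕ.+ (q ℕ.+ q))) n))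
        ≈⟨ trans (∙-congˡ (x∙yz≈y∙xz _ _ _)) (sym (assoc _ _ _)) ⟩
      (φ 0 ∙ range (λ q → φ (2 ℕ.+ (q ℕ.+ q))) (suc n)) ∙ (φ 1 ∙ range (λ q → φ (3 ℕ.+ (q ℕ.+ q))) n)
        ≈⟨ ∙-cong (∙-congˡ (range-cong (suc n) λ q _ → reflexive (≡.cong (φ ∘ suc) (≡.sym (ℕP.+-suc q q)))))
                  (∙-congˡ (range-cong n λ q _ → reflexive (≡.cong (λ i → φ (suc (suc i))) (≡.sym (ℕP.+-suc q q))))) ⟩
      range (λ q → φ (q ℕ.+ q)) (suc (suc n)) ∙ range (λ q → φ (suc (q ℕ.+ q))) (suc n) ∎

    range-single : ∀ (φ : ℕ → Carrier) n i → i ℕ.< n → range (λ j → if i ℕ.≡ᵇ j then φ j else ε) n ≈ φ i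
    range-single φ (suc n) zero    i<n = trans (∙-congˡ (range-ε n λ _ _ → refl)) (identityʳ _)
    range-single φ (suc n) (suc i) (ℕ.s≤s i<n) = trans (identityˡ _) (range-single (φ ∘ suc) n i i<n)

  -- Sums over the two families of weights {m, …, 0} ∪ {m+1, …, 2} of V₁ and
  -- {m-2, …, -1} ∪ {m-1, …, 1} of V / V₁, where m = suc k.
  sumV sumW : ℕ → (ℤ → Carrier) → Carrier
  sumV k F = range (λ q → F (+ suc k ℤ.- + q)) (2 ℕ.+ k) ∙ range (λ q → F (+ suc (suc k) ℤ.- + q)) (suc k)
  sumW k F = range (λ q → F (+ k ℤ.- + 1 ℤ.- + q)) (suc k) ∙ range (λ q → F (+ k ℤ.- + q)) k

  sumV-cong : ∀ k {F G} → (∀ z → F z ≈ G z) → sumV k F ≈ sumV k G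
  sumV-cong k F≈G = ∙-cong (range-cong _ λ _ _ → F≈G _) (range-cong _ λ _ _ → F≈G _)

  sumW-cong : ∀ k {F G} → (∀ z → F z ≈ G z) → sumW k F ≈ sumW k G
  sumW-cong k F≈G = ∙-cong (range-cong _ λ _ _ → F≈G _) (range-cong _ λ _ _ → F≈G _)

  sumV-∙ : ∀ k F G → sumV k (λ z → F z ∙ G z) ≈ sumV k F ∙ sumV k G
  sumV-∙ k F G = trans (∙-cong (range-∙ _ _ _) (range-∙ _ _ _)) (interchange _ _ _ _)

  sumW-∙ : ∀ k F G → sumW k (λ z → F z ∙ G z) ≈ sumW k F ∙ sumW k G
  sumW-∙ k F G = trans (∙-cong (range-∙ _ _ _) (range-∙ _ _ _)) (interchange _ _ _ _)

  module _ (g : ℤ → Carrier) (k : ℕ) where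
    open Weights k
    open Labels (suc k) using (N; isOff; isCart)
    open ListSum M using (sum-labels)

    -- The blocks V × V, V × W and W × W of the seaweed; the block with row in W and column in V is
    -- the forbidden one.
    differences : Carrier
    differences = sumV k (λ a → sumV k (λ b → g (a ℤ.- b))) ∙ sumV k (λ a → sumW k (λ b → g (a ℤ.- b)))
                ∙ sumW k (λ a → sumW k (λ b → g (a ℤ.- b)))

    private
      n : ℕ
      n = suc (k ℕ.+ k)

      pred-minus : ∀ z q → z ℤ.- + q ℤ.- + 1 ≡ z ℤ.- + suc q
      pred-minus z q = solve 2 (λ z q → z :- q :- con (+ 1) := z :- (con (+ 1) :+ q)) ≡.refl z (+ q)
        where open ℤ-Solver

      weightV-even : ∀ q → weightV (q ℕ.+ q) ≡ + suc k ℤ.- + q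
      weightV-even zero    = ≡.sym (ℤP.+-identityʳ (+ suc k))
      weightV-even (suc q) rewrite ℕP.+-suc q q = ≡.trans (≡.cong (ℤ._- + 1) (weightV-even q)) (pred-minus (+ suc k) q)

      weightV-odd : ∀ q → weightV (suc (q ℕ.+ q)) ≡ + suc (suc k) ℤ.- + q
      weightV-odd zero    = ≡.sym (ℤP.+-identityʳ (+ suc (suc k)))
      weightV-odd (suc q) rewrite ℕP.+-suc q q = ≡.trans (≡.cong (ℤ._- + 1) (weightV-odd q)) (pred-minus (+ suc (suc k)) q)

      rangeV : ∀ F → range (λ a → F (weight a)) (suc L) ≈ sumV k F
      rangeV F = begin
        range (λ a → F (weight a)) (suc L)
          ≈⟨ range-cong (suc L) (λ a a<L → reflexive (≡.cong F (weight-V (ℕP.m<1+n⇒m≤n a<L)))) ⟩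
        range (F ∘ weightV) (suc L)
          ≡⟨ ≡.cong (λ b → range (F ∘ weightV) (suc (suc b))) (ℕP.+-suc k k) ⟨
        range (F ∘ weightV) (suc (suc k ℕ.+ suc k))
          ≈⟨ range-parity (F ∘ weightV) (suc k) ⟩
        range (λ q → F (weightV (q ℕ.+ q))) (2 ℕ.+ k) ∙ range (λ q → F (weightV (suc (q ℕ.+ q)))) (suc k)
          ≈⟨ ∙-cong (range-cong (2 ℕ.+ k) λ q _ → reflexive (≡.cong F (weightV-even q)))
                    (range-cong (suc k) λ q _ → reflexive (≡.cong F (weightV-odd q))) ⟩
        sumV k F ∎

      rangeW : ∀ F → range (λ j → F (weight (suc L ℕ.+ j))) n ≈ sumW k F
      rangeW F = begin
        range (λ j → F (weight (suc L ℕ.+ j))) n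
          ≈⟨ range-cong n (λ j _ → reflexive (≡.cong F (weight-W j))) ⟩
        range (λ j → F (weightV j ℤ.- + 1 ℤ.- + 1)) n
          ≈⟨ range-parity (λ j → F (weightV j ℤ.- + 1 ℤ.- + 1)) k ⟩
        range (λ q → F (weightV (q ℕ.+ q) ℤ.- + 1 ℤ.- + 1)) (suc k) ∙ range (λ q → F (weightV (suc (q ℕ.+ q)) ℤ.- + 1 ℤ.- + 1)) k
          ≈⟨ ∙-cong (range-cong (suc k) λ q _ → reflexive (≡.cong F (≡.trans (≡.cong (λ z → z ℤ.- + 1 ℤ.- + 1) (weightV-even q)) (even q))))
                    (range-cong k λ q _ → reflexive (≡.cong F (≡.trans (≡.cong (λ z → z ℤ.- + 1 ℤ.- + 1) (weightV-odd q)) (odd q)))) ⟩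
        sumW k F ∎
        where
        open ℤ-Solver
        even : ∀ q → + suc k ℤ.- + q ℤ.- + 1 ℤ.- + 1 ≡ + k ℤ.- + 1 ℤ.- + q
        even q = solve 2 (λ k q → con (+ 1) :+ k :- q :- con (+ 1) :- con (+ 1) := k :- con (+ 1) :- q) ≡.refl (+ k) (+ q)
        odd : ∀ q → + suc (suc k) ℤ.- + q ℤ.- + 1 ℤ.- + 1 ≡ + k ℤ.- + q
        odd q = solve 2 (λ k q → con (+ 2) :+ k :- q :- con (+ 1) :- con (+ 1) := k :- q) ≡.refl (+ k) (+ q)

      allowed : ℕ → ℕ → Bool
      allowed i j = not ((2 ℕ.* suc k ℕ.<ᵇ i) ∧ (j ℕ.<ᵇ 2 ℕ.* suc k ℕ.+ 1))

      term : ℕ → ℕ → Carrier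
      term i j = g (weight i ℤ.- weight j)

      true≡ : ∀ {b} → T b → b ≡ true
      true≡ {true} _ = ≡.refl

      <ᵇ-true : ∀ {a b} → a ℕ.< b → (a ℕ.<ᵇ b) ≡ true
      <ᵇ-true a<b = true≡ (ℕP.<⇒<ᵇ a<b)

      <ᵇ-false : ∀ {a b} → b ℕ.≤ a → (a ℕ.<ᵇ b) ≡ false
      <ᵇ-false {a} {b} b≤a with a ℕ.<ᵇ b in eq
      ... | false = ≡.refl
      ... | true  = ⊥-elim (ℕP.<⇒≱ (ℕP.<ᵇ⇒< a b (≡.subst T (≡.sym eq) tt)) b≤a)

      allowed≡ : ∀ i j → allowed i j ≡ not ((L ℕ.<ᵇ i) ∧ (j ℕ.<ᵇ suc L))
      allowed≡ i j = ≡.cong₂ (λ a b → not ((a ℕ.<ᵇ i) ∧ (j ℕ.<ᵇ b))) 2m≡L (≡.trans (ℕP.+-comm _ 1) (≡.cong suc 2m≡L))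

      ∧-falseʳ : ∀ a → not (a ∧ false) ≡ true
      ∧-falseʳ true  = ≡.refl
      ∧-falseʳ false = ≡.refl

      allowed-V : ∀ {i} j → i ℕ.< suc L → allowed i j ≡ true
      allowed-V {i} j i<L = ≡.trans (allowed≡ i j)
        (≡.cong (λ b → not (b ∧ (j ℕ.<ᵇ suc L))) (<ᵇ-false {L} {i} (ℕP.m<1+n⇒m≤n i<L)))

      allowed-W : ∀ i j → allowed i (suc L ℕ.+ j) ≡ true
      allowed-W i j = ≡.trans (allowed≡ i (suc L ℕ.+ j)) (≡.trans
        (≡.cong (λ b → not ((L ℕ.<ᵇ i) ∧ b)) (<ᵇ-false {suc L ℕ.+ j} {suc L} (ℕP.m≤m+n (suc L) j))) (∧-falseʳ (L ℕ.<ᵇ i)))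

      allowed-WV : ∀ i {j} → j ℕ.< suc L → allowed (suc L ℕ.+ i) j ≡ false
      allowed-WV i {j} j<L = ≡.trans (allowed≡ (suc L ℕ.+ i) j)
        (≡.cong₂ (λ a b → not (a ∧ b)) (<ᵇ-true {L} {suc L ℕ.+ i} (ℕP.m≤m+n (suc L) i)) (<ᵇ-true j<L))

      if-≡ : ∀ {b b′ x} → b ≡ b′ → (if b then x else ε) ≈ (if b′ then x else ε)
      if-≡ ≡.refl = refl

      blocks : range (λ i → range (λ j → if allowed i j then term i j else ε) N) N ≈ differences
      blocks = trans (reflexive (≡.cong (λ b → range (λ i → range (λ j → if allowed i j then term i j else ε) b) b) size≡)) (trans (range-+ _ (suc L) n) (∙-cong
        (trans (range-cong (suc L) λ i i<L → trans (range-+ _ (suc L) n) (∙-cong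
            (trans (range-cong (suc L) λ j j<L → if-≡ (allowed-V j i<L)) (rangeV (λ z → g (weight i ℤ.- z))))
            (trans (range-cong n λ j _ → if-≡ (allowed-W i j)) (rangeW (λ z → g (weight i ℤ.- z))))))
          (trans (range-∙ _ _ (suc L)) (∙-cong (rangeV (λ a → sumV k (λ b → g (a ℤ.- b)))) (rangeV (λ a → sumW k (λ b → g (a ℤ.- b)))))))
        (trans (range-cong n λ i _ → trans (range-+ _ (suc L) n) (trans (∙-cong
            (range-ε (suc L) λ j j<L → if-≡ (allowed-WV i j<L))
            (trans (range-cong n λ j _ → if-≡ (allowed-W (suc L ℕ.+ i) j)) (rangeW (λ z → g (weight (suc L ℕ.+ i) ℤ.- z)))))
            (identityˡ _)))
          (rangeW (λ a → sumW k (λ b → g (a ℤ.- b)))))))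

    -- The added g 0 stands for E_00. It completes the Cartan labels to the whole diagonal, which
    -- then merges with the off-diagonal labels into all allowed positions.
    sum-labelWeight : sum (λ a → g (labelWeight (labelAt (suc k) a))) ∙ g (+ 0) ≈ differences
    sum-labelWeight = begin
      sum (λ a → g (labelWeight (labelAt (suc k) a))) ∙ g (+ 0)
        ≈⟨ ∙-congʳ (sum-labels (suc k) (g ∘ labelWeight)) ⟩
      sum (λ (i : Fin N) → sum (λ (j : Fin N) → if isOff i j then term (toℕ i) (toℕ j) else ε))
        ∙ sum (λ (i : Fin N) → if isCart i then term (toℕ i) (toℕ i) else ε) ∙ g (+ 0)
        ≈⟨ ∙-congʳ (∙-cong (trans (sum-cong {N} {λ i → sum {N} (offTerm (toℕ i) ∘ toℕ)} λ i → sum≈range {N} (offTerm (toℕ i))) (sum≈range {N} (λ i → range (offTerm i) N)))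
             (sum≈range {N} (λ i → if not (i ℕ.≡ᵇ 0) then term i i else ε))) ⟩
      range (λ i → range (offTerm i) N) N ∙ range (λ i → if not (i ℕ.≡ᵇ 0) then term i i else ε) N ∙ g (+ 0)
        ≈⟨ trans (assoc _ _ _) (∙-congˡ (trans (∙-congʳ (trans (range-suc _ (k ℕ.+ 3 ℕ.* suc k)) (identityˡ _)))
             (trans (comm _ _) (trans (∙-congʳ (reflexive (≡.cong g (≡.sym (ℤP.+-inverseʳ (weight 0))))))
               (sym (range-suc (λ i → term i i) (k ℕ.+ 3 ℕ.* suc k))))))) ⟩
      range (λ i → range (offTerm i) N) N ∙ range (λ i → term i i) N
        ≈⟨ range-∙ _ _ N ⟨
      range (λ i → range (offTerm i) N ∙ term i i) N
        ≈⟨ range-cong N (λ i i<N → trans (∙-congˡ (sym (range-single (term i) N i i<N)))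
             (trans (sym (range-∙ _ _ N)) (range-cong N λ j _ → merge i j))) ⟩
      range (λ i → range (λ j → if allowed i j then term i j else ε) N) N
        ≈⟨ blocks ⟩
      differences ∎
      where
      open import Algebra.Properties.Monoid.Sum monoid using () renaming (sum-cong-≋ to sum-cong)
      offTerm : ℕ → ℕ → Carrier
      offTerm i j = if not (i ℕ.≡ᵇ j) ∧ allowed i j then term i j else ε
      allowed-diag : ∀ i → allowed i i ≡ true
      allowed-diag i with i ℕ.<? suc L
      ... | yes i<L = allowed-V i i<L
      ... | no  i≮L = ≡.subst (λ j → allowed i j ≡ true) (ℕP.m+[n∸m]≡n (ℕP.≮⇒≥ i≮L)) (allowed-W i (i ℕ.∸ suc L))
      merge : ∀ i j → offTerm i j ∙ (if i ℕ.≡ᵇ j then term i j else ε) ≈ (if allowed i j then term i j else ε)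
      merge i j with i ℕ.≡ᵇ j in eq
      ... | false = identityʳ _
      ... | true rewrite ≡ᵇ-sound {i} {j} eq = trans (identityˡ _) (if-≡ (≡.sym (allowed-diag j)))

-- Growth of the weight differences when m increases by 1.

module Increment {c ℓ : Level} (M : CommutativeMonoid c ℓ) (g : ℤ → CommutativeMonoid.Carrier M) where
  open CommutativeMonoid M
  open Ranges M
  open import Algebra.Properties.CommutativeSemigroup commutativeSemigroup using (interchange)
  open import Algebra.Solver.CommutativeMonoid M using (solve; _⊕_; _⊜_)
  open import Relation.Binary.Reasoning.Setoid setoid

  asc : ℤ → ℕ → Carrier
  asc w = range (λ i → g (w ℤ.+ + i))

  -- The same sum as `asc`, but one that unfolds into single terms at a concrete length, since
  -- `range` is opaque.
  block : ℤ → ℕ → Carrier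
  block w zero    = ε
  block w (suc n) = g w ∙ block (ℤ.suc w) n

  asc≈block : ∀ w n → asc w n ≈ block w n
  asc≈block w zero    = range-0 _
  asc≈block w (suc n) = trans (range-suc _ n) (∙-cong (reflexive (≡.cong g (ℤP.+-identityʳ w)))
    (trans (range-cong n λ i _ → reflexive (≡.cong g (shift i))) (asc≈block (ℤ.suc w) n)))
    where
    shift : ∀ i → w ℤ.+ + suc i ≡ ℤ.suc w ℤ.+ + i
    shift i = ≡.trans (≡.sym (ℤP.+-assoc w (+ 1) (+ i))) (≡.cong (ℤ._+ + i) (ℤP.+-comm w (+ 1)))

  asc-+ : ∀ w {w′} a b → w′ ≡ w ℤ.+ + a → asc w (a ℕ.+ b) ≈ asc w a ∙ asc w′ b
  asc-+ w a b ≡.refl = trans (range-+ _ a b) (∙-congˡ (range-cong b λ i _ → reflexive (≡.cong g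
    (≡.trans (≡.cong (λ z → w ℤ.+ z) (ℤP.pos-+ a i)) (≡.sym (ℤP.+-assoc w (+ a) (+ i)))))))

  -- Separates the few end terms from a core of length j. The same two cores, `P` and `Q` below,
  -- occur in all intervals, so that only finitely many terms have to be compared.
  asc-split : ∀ w {w′ w″} a j e → w′ ≡ w ℤ.+ + a → w″ ≡ w′ ℤ.+ + j →
    asc w (a ℕ.+ e ℕ.+ j) ≈ block w a ∙ (asc w′ j ∙ block w″ e)
  asc-split w {w′} {w″} a j e eq eq′ = begin
    asc w (a ℕ.+ e ℕ.+ j)              ≡⟨ ≡.cong (asc w) (≡.trans (ℕP.+-assoc a e j) (≡.cong (a ℕ.+_) (ℕP.+-comm e j))) ⟩
    asc w (a ℕ.+ (j ℕ.+ e))            ≈⟨ asc-+ w a (j ℕ.+ e) eq ⟩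
    asc w a ∙ asc w′ (j ℕ.+ e)         ≈⟨ ∙-cong (asc≈block w a) (trans (asc-+ w′ j e eq′) (∙-congˡ (asc≈block w″ e))) ⟩
    block w a ∙ (asc w′ j ∙ block w″ e) ∎

  minus-range : ∀ x z w n → x ≡ w ℤ.+ z → range (λ q → g (x ℤ.- (z ℤ.- + q))) n ≈ asc w n
  minus-range x z w n ≡.refl = range-cong n λ q _ → reflexive (≡.cong g (S.solve 3
    (λ w z q → w S.:+ z S.:- (z S.:- q) S.:= w S.:+ q) ≡.refl w z (+ q)))
    where module S = ℤ-Solver

  -- The differences descend from z - y, so the sum is reversed; the hypothesis says that z - y is
  -- the last term w + n - 1 of the ascending interval.
  range-minus : ∀ y z w n → + 1 ℤ.+ z ≡ y ℤ.+ w ℤ.+ + n → range (λ q → g (z ℤ.- + q ℤ.- y)) n ≈ asc w n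
  range-minus y z w n eq = range-reverse _ _ n λ i j i+j → reflexive (≡.cong g (≡.trans
    (S.solve 3 (λ z i y → z S.:- i S.:- y S.:= S.con (+ 1) S.:+ z S.:- i S.:- y S.:- S.con (+ 1)) ≡.refl z (+ i) y)
    (≡.trans
      (≡.cong (λ a → a ℤ.- + i ℤ.- y ℤ.- + 1) (≡.trans eq (≡.cong (λ a → y ℤ.+ w ℤ.+ + a) (≡.sym i+j))))
      (S.solve 4 (λ y w i j → y S.:+ w S.:+ (S.con (+ 1) S.:+ (i S.:+ j)) S.:- i S.:- y S.:- S.con (+ 1) S.:= w S.:+ j)
        ≡.refl y w (+ i) (+ j)))))
    where module S = ℤ-Solver

  sumV-minus : ∀ k x w w′ → x ≡ w ℤ.+ + suc k → x ≡ w′ ℤ.+ + suc (suc k) →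
    sumV k (λ b → g (x ℤ.- b)) ≈ asc w (2 ℕ.+ k) ∙ asc w′ (suc k)
  sumV-minus k x w w′ eq eq′ = ∙-cong (minus-range x (+ suc k) w (2 ℕ.+ k) eq) (minus-range x (+ suc (suc k)) w′ (suc k) eq′)

  sumW-minus : ∀ k x w w′ → x ≡ w ℤ.+ (+ k ℤ.- + 1) → x ≡ w′ ℤ.+ + k →
    sumW k (λ b → g (x ℤ.- b)) ≈ asc w (suc k) ∙ asc w′ k
  sumW-minus k x w w′ eq eq′ = ∙-cong (minus-range x (+ k ℤ.- + 1) w (suc k) eq) (minus-range x (+ k) w′ k eq′)

  minus-sumV : ∀ k y w w′ → + 1 ℤ.+ + suc k ≡ y ℤ.+ w ℤ.+ + (2 ℕ.+ k) → + 1 ℤ.+ + suc (suc k) ≡ y ℤ.+ w′ ℤ.+ + suc k →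
    sumV k (λ a → g (a ℤ.- y)) ≈ asc w (2 ℕ.+ k) ∙ asc w′ (suc k)
  minus-sumV k y w w′ eq eq′ = ∙-cong (range-minus y (+ suc k) w (2 ℕ.+ k) eq) (range-minus y (+ suc (suc k)) w′ (suc k) eq′)

  minus-sumW : ∀ k y w w′ → + 1 ℤ.+ (+ k ℤ.- + 1) ≡ y ℤ.+ w ℤ.+ + suc k → + 1 ℤ.+ + k ≡ y ℤ.+ w′ ℤ.+ + k →
    sumW k (λ a → g (a ℤ.- y)) ≈ asc w (suc k) ∙ asc w′ k
  minus-sumW k y w w′ eq eq′ = ∙-cong (range-minus y (+ k ℤ.- + 1) w (suc k) eq) (range-minus y (+ k) w′ k eq′)

  private
    shifted : ∀ (F : ℤ → Carrier) z n → range (λ q → F (+ 1 ℤ.+ z ℤ.- + q)) (suc n) ≈ F (+ 1 ℤ.+ z) ∙ range (λ q → F (z ℤ.- + q)) n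
    shifted F z n = trans (range-suc _ n) (∙-cong (reflexive (≡.cong F (ℤP.+-identityʳ (+ 1 ℤ.+ z))))
      (range-cong n λ q _ → reflexive (≡.cong F (S.solve 2 (λ z q → S.con (+ 1) S.:+ z S.:- (S.con (+ 1) S.:+ q) S.:= z S.:- q) ≡.refl z (+ q)))))
      where module S = ℤ-Solver

  -- The minima 0 and 2 of the two chains do not depend on m; each chain only gains a new maximum.
  -- The same holds for W, with minima -1 and 1.
  sumV-suc : ∀ k F → sumV (suc k) F ≈ (F (+ (2 ℕ.+ k)) ∙ F (+ (3 ℕ.+ k))) ∙ sumV k F
  sumV-suc k F = trans (∙-cong (shifted F (+ suc k) (2 ℕ.+ k)) (shifted F (+ suc (suc k)) (suc k))) (interchange _ _ _ _)

  sumW-suc : ∀ k F → sumW (suc k) F ≈ (F (+ k) ∙ F (+ suc k)) ∙ sumW k F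
  sumW-suc k F = trans (∙-cong
    (trans (range-cong (2 ℕ.+ k) λ q _ → reflexive (≡.cong (λ z → F (z ℤ.- + q)) (S.solve 1 (λ k → S.con (+ 1) S.:+ k S.:- S.con (+ 1) S.:= S.con (+ 1) S.:+ (k S.:- S.con (+ 1))) ≡.refl (+ k))))
      (trans (shifted F (+ k ℤ.- + 1) (suc k)) (∙-congʳ (reflexive (≡.cong F (S.solve 1 (λ k → S.con (+ 1) S.:+ (k S.:- S.con (+ 1)) S.:= k) ≡.refl (+ k)))))))
    (shifted F (+ k) k)) (interchange _ _ _ _)
    where module S = ℤ-Solver

  module _ {x₁ x₂ y₁ y₂ : ℤ} (S S′ T T′ : (ℤ → Carrier) → Carrier)
    (S-suc : ∀ F → S′ F ≈ (F x₁ ∙ F x₂) ∙ S F) (T-suc : ∀ F → T′ F ≈ (F y₁ ∙ F y₂) ∙ T F)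
    (S-cong : ∀ {F G} → (∀ z → F z ≈ G z) → S F ≈ S G) (S-∙ : ∀ F G → S (λ z → F z ∙ G z) ≈ S F ∙ S G) where

    -- The new pairs of a block: four single differences between new weights, and the new weights of
    -- each side against the old chains of the other, which gives eight intervals as each side has
    -- two chains.
    cross-suc : S′ (λ a → T′ (λ b → g (a ℤ.- b))) ≈ S (λ a → T (λ b → g (a ℤ.- b))) ∙
      ((g (x₁ ℤ.- y₁) ∙ g (x₁ ℤ.- y₂) ∙ T (λ b → g (x₁ ℤ.- b))) ∙ (g (x₂ ℤ.- y₁) ∙ g (x₂ ℤ.- y₂) ∙ T (λ b → g (x₂ ℤ.- b)))
        ∙ (S (λ a → g (a ℤ.- y₁)) ∙ S (λ a → g (a ℤ.- y₂))))
    cross-suc = begin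
      S′ (λ a → T′ (λ b → g (a ℤ.- b)))
        ≈⟨ S-suc _ ⟩
      (T′ (λ b → g (x₁ ℤ.- b)) ∙ T′ (λ b → g (x₂ ℤ.- b))) ∙ S (λ a → T′ (λ b → g (a ℤ.- b)))
        ≈⟨ ∙-cong (∙-cong (T-suc _) (T-suc _)) (trans (S-cong λ a → T-suc _) (trans (S-∙ _ _) (∙-congʳ (S-∙ _ _)))) ⟩
      _ ∙ ((S (λ a → g (a ℤ.- y₁)) ∙ S (λ a → g (a ℤ.- y₂))) ∙ S (λ a → T (λ b → g (a ℤ.- b))))
        ≈⟨ trans (sym (assoc _ _ _)) (comm _ _) ⟩
      _ ∎

  module _ (j : ℕ) where
    -- In terms of m = 5 + j: the cores are 4, ..., m - 2 and -m + 3, ..., -3, while `highs` is m -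
    -- 1, ..., m + 3 and `negs` is -m - 2, ..., -m + 2. The values between the cores are in `lows`
    -- and `mids`.
    lows highs negs : List Carrier
    lows  = g (+ 0) ∷ g (+ 1) ∷ g (+ 2) ∷ g (+ 3) ∷ []
    highs = g (+ (4 ℕ.+ j)) ∷ g (+ (5 ℕ.+ j)) ∷ g (+ (6 ℕ.+ j)) ∷ g (+ (7 ℕ.+ j)) ∷ g (+ (8 ℕ.+ j)) ∷ []
    negs  = g -[1+ 6 ℕ.+ j ] ∷ g -[1+ 5 ℕ.+ j ] ∷ g -[1+ 4 ℕ.+ j ] ∷ g -[1+ 3 ℕ.+ j ] ∷ g -[1+ 2 ℕ.+ j ] ∷ []
    mids : List Carrier
    mids  = g -[1+ 1 ] ∷ g -[1+ 0 ] ∷ g (+ 0) ∷ g (+ 1) ∷ g (+ 2) ∷ []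

    P Q : Carrier
    P = asc (+ 4) j
    Q = asc -[1+ suc j ] j

    total : List Carrier → Carrier
    total = List.foldr _∙_ ε

    -- up u e sums g over u, …, m-2+e and down a e over -m+3-a, …, -3+e (with m = 5+j).
    up down : ℕ → ℕ → Carrier
    up u e   = total (List.drop u lows) ∙ (P ∙ total (List.take e highs))
    down a e = total (List.drop (5 ℕ.∸ a) negs) ∙ (Q ∙ total (List.take e mids))

    private
      ends : ∀ i → -[1+ 1 ] ≡ -[1+ suc i ] ℤ.+ + i
      ends i = S.solve 1 (λ i → S.con -[1+ 1 ] S.:= (S.:- (S.con (+ 2) S.:+ i)) S.:+ i) ≡.refl (+ i)
        where module S = ℤ-Solver

      k m₁ m₂ : ℕ
      k  = 4 ℕ.+ j
      m₁ = 6 ℕ.+ j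
      m₂ = 7 ℕ.+ j

      module S = ℤ-Solver

      offset : ∀ a b e → + (a ℕ.+ j) ≡ + e ℤ.+ + (b ℕ.+ j) → g (+ (a ℕ.+ j) ℤ.- + (b ℕ.+ j)) ≈ g (+ e)
      offset a b e eq = reflexive (≡.cong g (≡.trans (≡.cong (ℤ._- + (b ℕ.+ j)) eq)
        (S.solve 2 (λ e b → e S.:+ b S.:- b S.:= e) ≡.refl (+ e) (+ (b ℕ.+ j)))))

      offset₋₁ : ∀ a → g (+ (a ℕ.+ j) ℤ.- + suc (a ℕ.+ j)) ≈ g -[1+ 0 ]
      offset₋₁ a = reflexive (≡.cong g (S.solve 1 (λ a → a S.:- (S.con (+ 1) S.:+ a) S.:= S.con -[1+ 0 ]) ≡.refl (+ (a ℕ.+ j))))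

    -- The lines are the blocks V × V, V × W and W × W, each arranged as in `cross-suc`. Twelve
    -- intervals are of type `up` and twelve of type `down`, so every value in either core gains
    -- multiplicity 12: this is the 12 in the stated multiplicities.
    increment : Carrier
    increment =
      ((g (+ 0) ∙ g -[1+ 0 ] ∙ (up 1 3 ∙ up 0 1)) ∙ (g (+ 1) ∙ g (+ 0) ∙ (up 2 4 ∙ up 1 2)) ∙ ((down 4 2 ∙ down 2 3) ∙ (down 5 1 ∙ down 3 2))) ∙
      ((g (+ 2) ∙ g (+ 1) ∙ (up 3 4 ∙ up 2 2)) ∙ (g (+ 3) ∙ g (+ 2) ∙ (up 4 5 ∙ up 3 3)) ∙ ((down 2 4 ∙ down 0 5) ∙ (down 3 3 ∙ down 1 4))) ∙
      ((g (+ 0) ∙ g -[1+ 0 ] ∙ (up 1 2 ∙ up 0 0)) ∙ (g (+ 1) ∙ g (+ 0) ∙ (up 2 3 ∙ up 1 1)) ∙ ((down 3 2 ∙ down 1 3) ∙ (down 4 1 ∙ down 2 2)))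

    differences-suc : differences g (suc k) ≈ differences g k ∙ increment
    differences-suc = trans
      (∙-cong (∙-cong
        (trans (cross-suc (sumV k) (sumV (suc k)) (sumV k) (sumV (suc k)) (sumV-suc k) (sumV-suc k) (sumV-cong k) (sumV-∙ k))
          (∙-congˡ (∙-cong (∙-cong
            (∙-cong (∙-cong (offset 6 6 0 ≡.refl) (offset₋₁ 6)) (trans (sumV-minus k (+ m₁) (+ 1) (+ 0) ≡.refl ≡.refl)
              (∙-cong (asc-split (+ 1) 3 j 3 ≡.refl ≡.refl) (asc-split (+ 0) 4 j 1 ≡.refl ≡.refl))))
            (∙-cong (∙-cong (offset 7 6 1 ≡.refl) (offset 7 7 0 ≡.refl)) (trans (sumV-minus k (+ m₂) (+ 2) (+ 1) ≡.refl ≡.refl)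
              (∙-cong (asc-split (+ 2) 2 j 4 ≡.refl ≡.refl) (asc-split (+ 1) 3 j 2 ≡.refl ≡.refl)))))
            (∙-cong
              (trans (minus-sumV k (+ m₁) -[1+ 5 ℕ.+ j ] -[1+ 3 ℕ.+ j ] (cancel 5 6 6 6 ≡.refl) (cancel 6 6 4 5 ≡.refl))
                (∙-cong (asc-split -[1+ 5 ℕ.+ j ] 4 j 2 ≡.refl (ends j)) (asc-split -[1+ 3 ℕ.+ j ] 2 j 3 ≡.refl (ends j))))
              (trans (minus-sumV k (+ m₂) -[1+ 6 ℕ.+ j ] -[1+ 4 ℕ.+ j ] (cancel 5 7 7 6 ≡.refl) (cancel 6 7 5 5 ≡.refl))
                (∙-cong (asc-split -[1+ 6 ℕ.+ j ] 5 j 1 ≡.refl (ends j)) (asc-split -[1+ 4 ℕ.+ j ] 3 j 2 ≡.refl (ends j))))))))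
        (trans (cross-suc (sumV k) (sumV (suc k)) (sumW k) (sumW (suc k)) (sumV-suc k) (sumW-suc k) (sumV-cong k) (sumV-∙ k))
          (∙-congˡ (∙-cong (∙-cong
            (∙-cong (∙-cong (offset 6 4 2 ≡.refl) (offset 6 5 1 ≡.refl)) (trans (sumW-minus k (+ m₁) (+ 3) (+ 2) ≡.refl ≡.refl)
              (∙-cong (asc-split (+ 3) 1 j 4 ≡.refl ≡.refl) (asc-split (+ 2) 2 j 2 ≡.refl ≡.refl))))
            (∙-cong (∙-cong (offset 7 4 3 ≡.refl) (offset 7 5 2 ≡.refl)) (trans (sumW-minus k (+ m₂) (+ 4) (+ 3) ≡.refl ≡.refl)
              (∙-cong (asc-split (+ 4) 0 j 5 ≡.refl ≡.refl) (asc-split (+ 3) 1 j 3 ≡.refl ≡.refl)))))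
            (∙-cong
              (trans (minus-sumV k (+ k) -[1+ 3 ℕ.+ j ] -[1+ 1 ℕ.+ j ] (cancel 5 4 4 6 ≡.refl) (cancel 6 4 2 5 ≡.refl))
                (∙-cong (asc-split -[1+ 3 ℕ.+ j ] 2 j 4 ≡.refl (ends j)) (asc-split -[1+ 1 ℕ.+ j ] 0 j 5 ≡.refl (ends j))))
              (trans (minus-sumV k (+ suc k) -[1+ 4 ℕ.+ j ] -[1+ 2 ℕ.+ j ] (cancel 5 5 5 6 ≡.refl) (cancel 6 5 3 5 ≡.refl))
                (∙-cong (asc-split -[1+ 4 ℕ.+ j ] 3 j 3 ≡.refl (ends j)) (asc-split -[1+ 2 ℕ.+ j ] 1 j 4 ≡.refl (ends j)))))))))
        (trans (cross-suc (sumW k) (sumW (suc k)) (sumW k) (sumW (suc k)) (sumW-suc k) (sumW-suc k) (sumW-cong k) (sumW-∙ k))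
          (∙-congˡ (∙-cong (∙-cong
            (∙-cong (∙-cong (offset 4 4 0 ≡.refl) (offset₋₁ 4)) (trans (sumW-minus k (+ k) (+ 1) (+ 0) ≡.refl ≡.refl)
              (∙-cong (asc-split (+ 1) 3 j 2 ≡.refl ≡.refl) (asc-split (+ 0) 4 j 0 ≡.refl ≡.refl))))
            (∙-cong (∙-cong (offset 5 4 1 ≡.refl) (offset 5 5 0 ≡.refl)) (trans (sumW-minus k (+ suc k) (+ 2) (+ 1) ≡.refl ≡.refl)
              (∙-cong (asc-split (+ 2) 2 j 3 ≡.refl ≡.refl) (asc-split (+ 1) 3 j 1 ≡.refl ≡.refl)))))
            (∙-cong
              (trans (minus-sumW k (+ k) -[1+ 4 ℕ.+ j ] -[1+ 2 ℕ.+ j ] (cancel 3 4 5 5 ≡.refl) (cancel 4 4 3 4 ≡.refl))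
                (∙-cong (asc-split -[1+ 4 ℕ.+ j ] 3 j 2 ≡.refl (ends j)) (asc-split -[1+ 2 ℕ.+ j ] 1 j 3 ≡.refl (ends j))))
              (trans (minus-sumW k (+ suc k) -[1+ 5 ℕ.+ j ] -[1+ 3 ℕ.+ j ] (cancel 3 5 6 5 ≡.refl) (cancel 4 5 4 4 ≡.refl))
                (∙-cong (asc-split -[1+ 5 ℕ.+ j ] 4 j 1 ≡.refl (ends j)) (asc-split -[1+ 3 ℕ.+ j ] 2 j 2 ≡.refl (ends j)))))))))
      (solve 6 (λ a b c x y z → ((a ⊕ x) ⊕ (b ⊕ y)) ⊕ (c ⊕ z) ⊜ ((a ⊕ b) ⊕ c) ⊕ ((x ⊕ y) ⊕ z)) refl _ _ _ _ _ _)
      where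
      cancel : ∀ z y s n → suc z ℕ.+ s ≡ y ℕ.+ n →
        + 1 ℤ.+ + (z ℕ.+ j) ≡ + (y ℕ.+ j) ℤ.+ ℤ.- + (s ℕ.+ j) ℤ.+ + (n ℕ.+ j)
      cancel z y s n eq = ≡.trans
        (S.solve 3 (λ z s j → S.con (+ 1) S.:+ (z S.:+ j) S.:= S.con (+ 1) S.:+ z S.:+ s S.:- s S.:+ j) ≡.refl (+ z) (+ s) (+ j))
        (≡.trans (≡.cong (λ a → + a ℤ.- + s ℤ.+ + j) eq)
          (S.solve 4 (λ y s n j → y S.:+ n S.:- s S.:+ j S.:= (y S.:+ j) S.:+ S.:- (s S.:+ j) S.:+ (n S.:+ j)) ≡.refl (+ y) (+ s) (+ n) (+ j)))

-- Growth of the stated spectrum when m increases by 1.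

module SpectrumIncrement {c ℓ : Level} (M : CommutativeMonoid c ℓ) (g : ℤ → CommutativeMonoid.Carrier M) where
  open CommutativeMonoid M
  open Ranges M
  open Increment M g
  open ListSum M
  open import Algebra.Properties.Monoid.Mult monoid using (×-homo-+; ×-congʳ) renaming (_×_ to _×′_)
  open import Algebra.Solver.CommutativeMonoid M using (solve; _⊕_; _⊜_; Expr) renaming (id to id′)
  open import Relation.Binary.Reasoning.Setoid setoid

  listSum-^^ : ∀ z n → listSum g (z ^^ n) ≈ n ×′ g z
  listSum-^^ z zero    = refl
  listSum-^^ z (suc n) = ∙-congˡ (listSum-^^ z n)

  listSum-upTo : ∀ (f : ℕ → Carrier) n → listSum f (List.upTo n) ≈ range f n
  listSum-upTo f n = applyUpTo id n
    where
    applyUpTo : ∀ (h : ℕ → ℕ) n → listSum f (List.applyUpTo h n) ≈ range (f ∘ h) n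
    applyUpTo h zero    = sym (range-0 _)
    applyUpTo h (suc n) = trans (∙-congˡ (applyUpTo (h ∘ suc) n)) (sym (range-suc _ n))

  range-×′ : ∀ m φ n → range (λ i → m ×′ φ i) n ≈ m ×′ range φ n
  range-×′ zero    φ n = range-ε n λ _ _ → refl
  range-×′ (suc m) φ n = trans (range-∙ φ _ n) (∙-congˡ (range-×′ m φ n))

  -- The part of the spectrum with multiplicities 30, 42, …
  middle : ℕ → Carrier
  middle j = range (λ i → (30 ℕ.+ i ℕ.* 12) ×′ g (-[1+ suc j ] ℤ.+ + i) ∙ (30 ℕ.+ i ℕ.* 12) ×′ g (+ (3 ℕ.+ j) ℤ.- + i)) (suc j)

  -- The stated formula at m = 5 + j without truncated subtraction: 6 (2m - 1) - 14 is 40 + 12 j and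
  -- 6 (2m - 1) - 8 is 46 + 12 j.
  spectral : ℕ → Carrier
  spectral j = 1 ×′ g -[1+ 5 ℕ.+ j ] ∙ (4 ×′ g -[1+ 4 ℕ.+ j ] ∙ (10 ×′ g -[1+ 3 ℕ.+ j ] ∙ (19 ×′ g -[1+ 2 ℕ.+ j ] ∙
    ((40 ℕ.+ j ℕ.* 12) ×′ g -[1+ 0 ] ∙ ((46 ℕ.+ j ℕ.* 12) ×′ g (+ 0) ∙ ((46 ℕ.+ j ℕ.* 12) ×′ g (+ 1) ∙ ((40 ℕ.+ j ℕ.* 12) ×′ g (+ 2) ∙
    (19 ×′ g (+ (4 ℕ.+ j)) ∙ (10 ×′ g (+ (5 ℕ.+ j)) ∙ (4 ×′ g (+ (6 ℕ.+ j)) ∙ (1 ×′ g (+ (7 ℕ.+ j)) ∙ middle j)))))))))))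

  -- Separates values and multiplicities from the list they generate, so that all of them can be
  -- simplified by one equation between lists of pairs.
  segments : List (ℤ × ℕ) → List ℤ → List ℤ
  segments []             xs = xs
  segments ((z , n) ∷ ps) xs = z ^^ n ++ segments ps xs

  listSum-segments : ∀ ps {xs y} → listSum g xs ≈ y →
    listSum g (segments ps xs) ≈ List.foldr (λ (z , n) s → n ×′ g z ∙ s) y ps
  listSum-segments []             xs≈y = xs≈y
  listSum-segments ((z , n) ∷ ps) xs≈y = trans (listSum-++ g (z ^^ n) _) (∙-cong (listSum-^^ z n) (listSum-segments ps xs≈y))

  listSum-spectrum : ∀ j → listSum g (spectrum (5 ℕ.+ j)) ≈ spectral j
  listSum-spectrum j = trans
    (reflexive (≡.cong (λ ps → listSum g (segments ps (concatMap F (map suc (List.upTo (suc j)))))) simplify))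
    (listSum-segments (shape -[1+ 5 ℕ.+ j ] (+ (6 ℕ.+ j)) (+ (7 ℕ.+ j)) (40 ℕ.+ j ℕ.* 12) (46 ℕ.+ j ℕ.* 12)) tail)
    where
    module S = ℤ-Solver
    count : ∀ a b → 6 ℕ.* (4 ℕ.+ j ℕ.+ (5 ℕ.+ j ℕ.+ 0)) ≡ a ℕ.+ (b ℕ.+ j ℕ.* 12) → 6 ℕ.* kOf (5 ℕ.+ j) ℕ.∸ a ≡ b ℕ.+ j ℕ.* 12
    count a b eq = ≡.trans (≡.cong (ℕ._∸ a) eq) (ℕP.m+n∸m≡n a _)
    count₄₀ : 6 ℕ.* kOf (5 ℕ.+ j) ℕ.∸ 14 ≡ 40 ℕ.+ j ℕ.* 12
    count₄₀ = count 14 40 (N.solve 1 (λ j → N.con 6 N.:* (N.con 4 N.:+ j N.:+ (N.con 5 N.:+ j N.:+ N.con 0)) N.:= N.con 14 N.:+ (N.con 40 N.:+ j N.:* N.con 12)) ≡.refl j)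
      where module N = +-*-Solver
    count₄₆ : 6 ℕ.* kOf (5 ℕ.+ j) ℕ.∸ 8 ≡ 46 ℕ.+ j ℕ.* 12
    count₄₆ = count 8 46 (N.solve 1 (λ j → N.con 6 N.:* (N.con 4 N.:+ j N.:+ (N.con 5 N.:+ j N.:+ N.con 0)) N.:= N.con 8 N.:+ (N.con 46 N.:+ j N.:* N.con 12)) ≡.refl j)
      where module N = +-*-Solver
    shape : (a b d : ℤ) (p q : ℕ) → List (ℤ × ℕ)
    shape a b d p q = (a , 1) ∷ (-[1+ 4 ℕ.+ j ] , 4) ∷ (-[1+ 3 ℕ.+ j ] , 10) ∷ (-[1+ 2 ℕ.+ j ] , 19) ∷
      (-[1+ 0 ] , p) ∷ (+ 0 , q) ∷ (+ 1 , q) ∷ (+ 2 , p) ∷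
      (+ (4 ℕ.+ j) , 19) ∷ (+ (5 ℕ.+ j) , 10) ∷ (b , 4) ∷ (d , 1) ∷ []
    shape-cong : ∀ {a a′ b b′ d d′ p p′ q q′} → a ≡ a′ → b ≡ b′ → d ≡ d′ → p ≡ p′ → q ≡ q′ → shape a b d p q ≡ shape a′ b′ d′ p′ q′
    shape-cong ≡.refl ≡.refl ≡.refl ≡.refl ≡.refl = ≡.refl
    simplify : shape (ℤ.- + (5 ℕ.+ j) ℤ.- + 1) (+ (5 ℕ.+ j) ℤ.+ + 1) (+ (5 ℕ.+ j) ℤ.+ + 2)
        (6 ℕ.* kOf (5 ℕ.+ j) ℕ.∸ 14) (6 ℕ.* kOf (5 ℕ.+ j) ℕ.∸ 8)
      ≡ shape -[1+ 5 ℕ.+ j ] (+ (6 ℕ.+ j)) (+ (7 ℕ.+ j)) (40 ℕ.+ j ℕ.* 12) (46 ℕ.+ j ℕ.* 12)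
    simplify = shape-cong
      (≡.cong -[1+_] (≡.cong (5 ℕ.+_) (ℕP.+-identityʳ j)))
      (≡.cong +_ (ℕP.+-comm (5 ℕ.+ j) 1)) (≡.cong +_ (ℕP.+-comm (5 ℕ.+ j) 2)) count₄₀ count₄₆
    F : ℕ → List ℤ
    F i = (ℤ.- + (5 ℕ.+ j) ℤ.+ + i ℤ.+ + 2) ^^ (12 ℕ.* i ℕ.+ 18) ++ (+ (5 ℕ.+ j) ℤ.- + i ℤ.- + 1) ^^ (12 ℕ.* i ℕ.+ 18)
    tail : listSum g (concatMap F (map suc (List.upTo (suc j)))) ≈ middle j
    tail = trans (listSum-concatMap g F (map suc (List.upTo (suc j)))) (trans (listSum-map (listSum g ∘ F) suc (List.upTo (suc j)))
      (trans (listSum-upTo (listSum g ∘ F ∘ suc) (suc j)) (range-cong (suc j) λ i _ →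
        trans (listSum-++ g ((ℤ.- + (5 ℕ.+ j) ℤ.+ + suc i ℤ.+ + 2) ^^ (12 ℕ.* suc i ℕ.+ 18)) _) (∙-cong
          (trans (listSum-^^ _ (12 ℕ.* suc i ℕ.+ 18)) (reflexive (≡.cong₂ (λ n z → n ×′ g z) (multiplicity i)
            (S.solve 2 (λ i j → S.:- (S.con (+ 5) S.:+ j) S.:+ (S.con (+ 1) S.:+ i) S.:+ S.con (+ 2) S.:= S.:- (S.con (+ 2) S.:+ j) S.:+ i) ≡.refl (+ i) (+ j)))))
          (trans (listSum-^^ _ (12 ℕ.* suc i ℕ.+ 18)) (reflexive (≡.cong₂ (λ n z → n ×′ g z) (multiplicity i)
            (S.solve 2 (λ i j → (S.con (+ 5) S.:+ j) S.:- (S.con (+ 1) S.:+ i) S.:- S.con (+ 1) S.:= (S.con (+ 3) S.:+ j) S.:- i) ≡.refl (+ i) (+ j)))))))))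
      where
      multiplicity : ∀ i → 12 ℕ.* suc i ℕ.+ 18 ≡ 30 ℕ.+ i ℕ.* 12
      multiplicity i = N.solve 1 (λ i → N.con 12 N.:* (N.con 1 N.:+ i) N.:+ N.con 18 N.:= N.con 30 N.:+ i N.:* N.con 12) ≡.refl i
        where module N = +-*-Solver

  module _ (j : ℕ) where
    private
      ×-12 : ∀ a r x → (a ℕ.+ (12 ℕ.+ r)) ×′ x ≈ 12 ×′ x ∙ (a ℕ.+ r) ×′ x
      ×-12 a r x = trans (reflexive (≡.cong (_×′ x) (N.solve 2 (λ a r → a N.:+ (N.con 12 N.:+ r) N.:= N.con 12 N.:+ (a N.:+ r)) ≡.refl a r)))
        (×-homo-+ x 12 (a ℕ.+ r))
        where module N = +-*-Solver

      ends : -[1+ suc j ] ℤ.+ + j ≡ -[1+ 1 ]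
      ends = S.solve 1 (λ j → S.:- (S.con (+ 2) S.:+ j) S.:+ j S.:= S.con -[1+ 1 ]) ≡.refl (+ j)
        where module S = ℤ-Solver

    -- A value at place i of the middle part moves to place i + 1 and so gains 12; a new outermost
    -- pair enters at place 0 with multiplicity 30.
    middle-suc : middle (suc j) ≈
      (30 ×′ g -[1+ 2 ℕ.+ j ] ∙ 30 ×′ g (+ (4 ℕ.+ j))) ∙ ((12 ×′ (Q j ∙ g -[1+ 1 ]) ∙ 12 ×′ (g (+ 3) ∙ P j)) ∙ middle j)
    middle-suc = begin
      middle (suc j)
        ≈⟨ range-suc _ (suc j) ⟩
      _ ∙ range (λ i → (30 ℕ.+ suc i ℕ.* 12) ×′ g (-[1+ 2 ℕ.+ j ] ℤ.+ + suc i) ∙ (30 ℕ.+ suc i ℕ.* 12) ×′ g (+ (4 ℕ.+ j) ℤ.- + suc i)) (suc j)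
        ≈⟨ ∙-cong (∙-congˡ (reflexive (≡.cong (λ z → 30 ×′ g z) (ℤP.+-identityʳ (+ (4 ℕ.+ j))))))
             (range-cong (suc j) λ i _ → trans
               (∙-cong (trans (×-12 30 (i ℕ.* 12) _) (reflexive (≡.cong (λ z → 12 ×′ g z ∙ (30 ℕ.+ i ℕ.* 12) ×′ g z) (lower i))))
                       (trans (×-12 30 (i ℕ.* 12) _) (reflexive (≡.cong (λ z → 12 ×′ g z ∙ (30 ℕ.+ i ℕ.* 12) ×′ g z) (upper i)))))
               (interchange _ _ _ _)) ⟩
      _ ∙ range (λ i → (12 ×′ g (-[1+ suc j ] ℤ.+ + i) ∙ 12 ×′ g (+ (3 ℕ.+ j) ℤ.- + i)) ∙
            ((30 ℕ.+ i ℕ.* 12) ×′ g (-[1+ suc j ] ℤ.+ + i) ∙ (30 ℕ.+ i ℕ.* 12) ×′ g (+ (3 ℕ.+ j) ℤ.- + i))) (suc j)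
        ≈⟨ ∙-congˡ (trans (range-∙ _ _ (suc j)) (∙-congʳ (trans (range-∙ _ _ (suc j))
             (∙-cong (trans (range-×′ 12 _ (suc j)) (×-congʳ 12 ascending)) (trans (range-×′ 12 _ (suc j)) (×-congʳ 12 descending)))))) ⟩
      _ ∎
      where
      open import Algebra.Properties.CommutativeSemigroup commutativeSemigroup using (interchange)
      module S = ℤ-Solver
      lower : ∀ i → -[1+ 2 ℕ.+ j ] ℤ.+ + suc i ≡ -[1+ suc j ] ℤ.+ + i
      lower i = S.solve 2 (λ i j → S.:- (S.con (+ 3) S.:+ j) S.:+ (S.con (+ 1) S.:+ i) S.:= S.:- (S.con (+ 2) S.:+ j) S.:+ i) ≡.refl (+ i) (+ j)
      upper : ∀ i → + (4 ℕ.+ j) ℤ.- + suc i ≡ + (3 ℕ.+ j) ℤ.- + i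
      upper i = S.solve 2 (λ i j → (S.con (+ 4) S.:+ j) S.:- (S.con (+ 1) S.:+ i) S.:= (S.con (+ 3) S.:+ j) S.:- i) ≡.refl (+ i) (+ j)
      ascending : asc -[1+ suc j ] (suc j) ≈ Q j ∙ g -[1+ 1 ]
      ascending = trans (range-snoc _ j) (∙-congˡ (reflexive (≡.cong g ends)))
      descending : range (λ i → g (+ (3 ℕ.+ j) ℤ.- + i)) (suc j) ≈ g (+ 3) ∙ P j
      descending = trans (range-reverse _ (λ i → g (+ 3 ℤ.+ + i)) (suc j) λ { i i′ ≡.refl → reflexive (≡.cong g
          (S.solve 2 (λ i i′ → (S.con (+ 3) S.:+ (i S.:+ i′)) S.:- i S.:= S.con (+ 3) S.:+ i′) ≡.refl (+ i) (+ i′))) })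
        (range-suc _ j)

    -- Once the multiplicities are split as 12 plus the old ones, both sides are combinations of the
    -- same 23 atoms: the cores, the values near them, and five old groups of terms that stay
    -- intact. Only coefficients remain to be compared.
    spectral-suc : spectral (suc j) ≈ spectral j ∙ increment j
    spectral-suc = trans
      (∙-congˡ (∙-congˡ (∙-congˡ (∙-congˡ (∙-cong (×-12 40 (j ℕ.* 12) _) (∙-cong (×-12 46 (j ℕ.* 12) _) (∙-cong (×-12 46 (j ℕ.* 12) _)
        (∙-cong (×-12 40 (j ℕ.* 12) _) (∙-congˡ (∙-congˡ (∙-congˡ (∙-congˡ middle-suc))))))))))))
      (solve 23 (λ P Q l₋₂ l₋₁ l₀ l₁ l₂ l₃ h₀ h₁ h₂ h₃ h₄ n₀ n₁ n₂ n₃ n₄ a b c d m →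
        (rep 1 n₄ ⊕ (rep 4 n₃ ⊕ (rep 10 n₂ ⊕ (rep 19 n₁ ⊕ ((rep 12 l₋₁ ⊕ a) ⊕ ((rep 12 l₀ ⊕ b) ⊕ ((rep 12 l₁ ⊕ c) ⊕ ((rep 12 l₂ ⊕ d) ⊕
          (rep 19 h₁ ⊕ (rep 10 h₂ ⊕ (rep 4 h₃ ⊕ (rep 1 h₄ ⊕ ((rep 30 n₀ ⊕ rep 30 h₀) ⊕ ((rep 12 (Q ⊕ l₋₂) ⊕ rep 12 (l₃ ⊕ P)) ⊕ m))))))))))))))
        ⊜ (rep 1 n₃ ⊕ (rep 4 n₂ ⊕ (rep 10 n₁ ⊕ (rep 19 n₀ ⊕ (a ⊕ (b ⊕ (c ⊕ (d ⊕ (rep 19 h₀ ⊕ (rep 10 h₁ ⊕ (rep 4 h₂ ⊕ (rep 1 h₃ ⊕ m))))))))))))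
          ⊕ incr P Q (l₀ ∷ l₁ ∷ l₂ ∷ l₃ ∷ []) (h₀ ∷ h₁ ∷ h₂ ∷ h₃ ∷ h₄ ∷ []) (n₄ ∷ n₃ ∷ n₂ ∷ n₁ ∷ n₀ ∷ []) (l₋₂ ∷ l₋₁ ∷ l₀ ∷ l₁ ∷ l₂ ∷ []) l₋₁ l₀ l₁ l₂ l₃)
        refl (P j) (Q j) (g -[1+ 1 ]) (g -[1+ 0 ]) (g (+ 0)) (g (+ 1)) (g (+ 2)) (g (+ 3))
        (g (+ (4 ℕ.+ j))) (g (+ (5 ℕ.+ j))) (g (+ (6 ℕ.+ j))) (g (+ (7 ℕ.+ j))) (g (+ (8 ℕ.+ j)))
        (g -[1+ 2 ℕ.+ j ]) (g -[1+ 3 ℕ.+ j ]) (g -[1+ 4 ℕ.+ j ]) (g -[1+ 5 ℕ.+ j ]) (g -[1+ 6 ℕ.+ j ])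
        ((40 ℕ.+ j ℕ.* 12) ×′ g -[1+ 0 ]) ((46 ℕ.+ j ℕ.* 12) ×′ g (+ 0)) ((46 ℕ.+ j ℕ.* 12) ×′ g (+ 1)) ((40 ℕ.+ j ℕ.* 12) ×′ g (+ 2))
        (middle j))
      where
      rep : ∀ {n} → ℕ → Expr n → Expr n
      rep zero    e = id′
      rep (suc k) e = e ⊕ rep k e
      prod : ∀ {n} → List (Expr n) → Expr n
      prod = List.foldr _⊕_ id′
      infixl 4 _⊞_
      _⊞_ : ∀ {n} → Expr n → Expr n → Expr n
      _⊞_ = _⊕_
      incr : ∀ {n} → Expr n → Expr n → (lows highs negs mids : List (Expr n)) → (l₋₁ l₀ l₁ l₂ l₃ : Expr n) → Expr n
      incr {n} P Q lows highs negs mids l₋₁ l₀ l₁ l₂ l₃ =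
          ((l₀ ⊞ l₋₁ ⊞ (up′ 1 3 ⊕ up′ 0 1)) ⊞ (l₁ ⊞ l₀ ⊞ (up′ 2 4 ⊕ up′ 1 2)) ⊞ ((down′ 4 2 ⊕ down′ 2 3) ⊕ (down′ 5 1 ⊕ down′ 3 2)))
        ⊞ ((l₂ ⊞ l₁ ⊞ (up′ 3 4 ⊕ up′ 2 2)) ⊞ (l₃ ⊞ l₂ ⊞ (up′ 4 5 ⊕ up′ 3 3)) ⊞ ((down′ 2 4 ⊕ down′ 0 5) ⊕ (down′ 3 3 ⊕ down′ 1 4)))
        ⊞ ((l₀ ⊞ l₋₁ ⊞ (up′ 1 2 ⊕ up′ 0 0)) ⊞ (l₁ ⊞ l₀ ⊞ (up′ 2 3 ⊕ up′ 1 1)) ⊞ ((down′ 3 2 ⊕ down′ 1 3) ⊕ (down′ 4 1 ⊕ down′ 2 2)))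
        where
        up′ down′ : ℕ → ℕ → Expr n
        up′ u e   = prod (List.drop u lows) ⊕ (P ⊕ prod (List.take e highs))
        down′ a e = prod (List.drop (5 ℕ.∸ a) negs) ⊕ (Q ⊕ prod (List.take e mids))

  -- The extra g 0 accounts for the Cartan subalgebra of gl versus sl.
  differences≈spectrum : differences g 4 ≈ listSum g (spectrum 5) ∙ g (+ 0) →
    ∀ j → differences g (4 ℕ.+ j) ≈ listSum g (spectrum (5 ℕ.+ j)) ∙ g (+ 0)
  differences≈spectrum base j = trans (induct j) (∙-congʳ (sym (listSum-spectrum j)))
    where
    open import Algebra.Properties.CommutativeSemigroup commutativeSemigroup using (xy∙z≈xz∙y)
    induct : ∀ j → differences g (4 ℕ.+ j) ≈ spectral j ∙ g (+ 0)
    induct zero    = trans base (∙-congʳ (listSum-spectrum 0))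
    induct (suc j) = trans (differences-suc j) (trans (∙-congʳ (induct j))
      (trans (xy∙z≈xz∙y _ _ _) (∙-congʳ (sym (spectral-suc j)))))

-- Equality of multisets of weights.

module Multiset where
  -- Lists up to permutation are the free commutative monoid on ℤ; with g the inclusion of
  -- generators, an identity of sums becomes an equality of multisets.
  𝕄 : CommutativeMonoid _ _
  𝕄 = PermP.++-commutativeMonoid {A = ℤ}

  [_]ₘ : ℤ → List ℤ
  [ z ]ₘ = z ∷ []

  open ListSum 𝕄

  listSum-singletons : ∀ {a} {A : Set a} (f : A → ℤ) xs → listSum ([_]ₘ ∘ f) xs ≡ map f xs
  listSum-singletons f []       = ≡.refl
  listSum-singletons f (x ∷ xs) = ≡.cong (f x ∷_) (listSum-singletons f xs)

  open SortingAlgorithm mergeSort using (sort; sort-↭)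

  -- Reduces a permutation of closed lists to a computation.
  sort-≡⇒↭ : ∀ {xs ys} → sort xs ≡ sort ys → xs ↭ ys
  sort-≡⇒↭ {xs} {ys} eq = ↭-trans (↭-sym (sort-↭ xs)) (↭-trans (↭-reflexive eq) (sort-↭ ys))

  opaque
    unfolding Ranges.range

    -- The separately listed spectra, m = 1 to 4, are verified by sorting both lists.
    small₁ : Ranges.differences 𝕄 [_]ₘ 0 ↭ listSum [_]ₘ (spectrum 1) ++ + 0 ∷ []
    small₁ = sort-≡⇒↭ ≡.refl

    small₂ : Ranges.differences 𝕄 [_]ₘ 1 ↭ listSum [_]ₘ (spectrum 2) ++ + 0 ∷ []
    small₂ = sort-≡⇒↭ ≡.refl

    small₃ : Ranges.differences 𝕄 [_]ₘ 2 ↭ listSum [_]ₘ (spectrum 3) ++ + 0 ∷ []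
    small₃ = sort-≡⇒↭ ≡.refl

    small₄ : Ranges.differences 𝕄 [_]ₘ 3 ↭ listSum [_]ₘ (spectrum 4) ++ + 0 ∷ []
    small₄ = sort-≡⇒↭ ≡.refl

    -- The base of the induction: k > 7 means m ≥ 5, and at m = 5 both cores are empty.
    small₅ : Ranges.differences 𝕄 [_]ₘ 4 ↭ listSum [_]ₘ (spectrum 5) ++ + 0 ∷ []
    small₅ = sort-≡⇒↭ ≡.refl

  differences↭ : ∀ k → Ranges.differences 𝕄 [_]ₘ k ↭ listSum [_]ₘ (spectrum (suc k)) ++ + 0 ∷ []
  differences↭ 0 = small₁
  differences↭ 1 = small₂
  differences↭ 2 = small₃
  differences↭ 3 = small₄
  differences↭ (suc (suc (suc (suc j)))) = SpectrumIncrement.differences≈spectrum 𝕄 [_]ₘ small₅ j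

  weights↭spectrum : ∀ k → map (Weights.labelWeight k) (labels (suc k)) ↭ spectrum (suc k)
  -- The zero added for E_00 is removed only now, because multisets admit cancellation whereas a
  -- general commutative monoid does not.
  weights↭spectrum k = PermP.drop-∷ {x = + 0} (begin
    + 0 ∷ map labelWeight (labels (suc k))                          ↭⟨ PermP.++-comm (+ 0 ∷ []) _ ⟩
    map labelWeight (labels (suc k)) ++ + 0 ∷ []                    ≡⟨ ≡.cong (_++ + 0 ∷ []) (listSum-singletons labelWeight (labels (suc k))) ⟨
    listSum ([_]ₘ ∘ labelWeight) (labels (suc k)) ++ + 0 ∷ []         ↭⟨ PermP.++⁺ʳ (+ 0 ∷ []) (sum-lookup ([_]ₘ ∘ labelWeight) (labels (suc k))) ⟨
    sum (λ a → [ labelWeight (labelAt (suc k) a) ]ₘ) ++ + 0 ∷ []      ↭⟨ Ranges.sum-labelWeight 𝕄 [_]ₘ k ⟩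
    Ranges.differences 𝕄 [_]ₘ k                                       ↭⟨ differences↭ k ⟩
    listSum [_]ₘ (spectrum (suc k)) ++ + 0 ∷ []                       ≡⟨ ≡.cong (_++ + 0 ∷ []) (≡.trans (listSum-singletons id (spectrum (suc k))) (ListP.map-id (spectrum (suc k)))) ⟩
    spectrum (suc k) ++ + 0 ∷ []                                      ↭⟨ PermP.++-comm (spectrum (suc k)) _ ⟩
    + 0 ∷ spectrum (suc k)                                            ∎)
    where
    open Perm.PermutationReasoning
    open Weights k using (labelWeight)
    open import Algebra.Properties.Monoid.Sum (CommutativeMonoid.monoid 𝕄) using (sum)

-- The characteristic polynomial of an arbitrary principal element.

module _ {c ℓ : Level} (K : Field c ℓ) (charZero : CharZero K) (k : ℕ) where
  open Field K
  open Weights k using (labelWeight)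
  open IntegerCoefficients commutativeRing using (int)
  open StandardFrobenius K charZero k using (standard-frobenius; standard-principal; standard-charPoly)
  open OverField K charZero (suc k)
  open ListSum *-commutativeMonoid
  open import Algebra.Properties.Monoid.Sum *-monoid using () renaming (sum to product)
  open import Relation.Binary.Reasoning.Setoid setoid

  charPoly-spectrum : ∀ {f F} → IsFrobenius K (suc k) f → IsPrincipal K (suc k) f F → ∀ t →
    charPolyAt K (adMat K (suc k) F) t ≈ prodL K (map (λ z → t - intK K z) (spectrum (suc k)))
  charPoly-spectrum {f} {F} frob prin t = begin
    charPolyAt K (adMat K (suc k) F) t
      ≈⟨ charPolyAt≈ F t (member (proj₁ prin)) ⟩
    _
      ≈⟨ spectrum-independent (frobenius f frob) standard-frobenius (principal f prin) standard-principal t ⟩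
    _
      ≈⟨ standard-charPoly t ⟩
    product (λ a → t - int (labelWeight (labelAt (suc k) a)))
      ≈⟨ sum-lookup (λ l → t - int (labelWeight l)) (labels (suc k)) ⟩
    listSum (λ l → t - int (labelWeight l)) (labels (suc k))
      ≈⟨ listSum-map (λ z → t - int z) labelWeight (labels (suc k)) ⟨
    listSum (λ z → t - int z) (map labelWeight (labels (suc k)))
      ≈⟨ listSum-↭ (λ z → t - int z) (Multiset.weights↭spectrum k) ⟩
    listSum (λ z → t - int z) (spectrum (suc k))
      ≈⟨ listSum-cong (λ z → t - int z) (λ z → +-congˡ (-‿cong (reflexive (≡.sym (intK≡int z))))) (spectrum (suc k)) ⟩
    listSum (λ z → t - intK K z) (spectrum (suc k))
      ≈⟨ listSum-map id (λ z → t - intK K z) (spectrum (suc k)) ⟨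
    prodL K (map (λ z → t - intK K z) (spectrum (suc k))) ∎

mainTheorem4 : ∀ {c ℓ : Level} (K : Field c ℓ) → CharZero K →
    (m : ℕ) → 1 ≤ m →
    (f : Functional K m) → IsFrobenius K m f →
    (Fh : Mat K (sizeN m)) → IsPrincipal K m f Fh →
    ∀ (t : Field.Carrier K) →
    Field._≈_ K (charPolyAt K (adMat K m Fh) t)
    (prodL K (map (λ λ₀ → Field._-_ K t (intK K λ₀)) (spectrum m)))
mainTheorem4 K charZero (suc k) 1≤m f frob Fh prin = charPoly-spectrum K charZero k frob prin
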